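{- Let $n\ge 1$ and $k\ge 0$ be integers, let $\alpha\in[0,1)$, and let $G\in\mathcal{C}_n^k$ be a cactus with $n$ vertices and $k$ cycles. Let $C^c\in\mathcal{C}_n^k$ be the cactus consisting of $k$ triangles and $n-2k-1$ pendant edges all sharing one common vertex $v$. Then $$\rho(G)\le \rho(C^c),$$ where $\rho(\cdot)$ denotes the $A_\alpha$-spectral radius.
   Context: All graphs are finite and simple. For a graph $G$, let $A(G)$ be its adjacency matrix and $D(G)$ the diagonal matrix of vertex degrees. For $\alpha\in[0,1]$, $A_\alpha(G)=\alpha D(G)+(1-\alpha)A(G)$. The $A_\alpha$-spectral radius $\rho(G)$ is the largest eigenvalue of the real symmetric matrix $A_\alpha(G)$. A cactus is a connected graph such that any two of its cycles have at most one common vertex. $\mathcal{C}_n^k$ denotes the set of all cacti with $n$ vertices and $k$ cycles (if $\mathcal{C}_n^k$ is nonempty then $n\ge 2k+1$). $C^c$ denotes the cactus in $\mathcal{C}_n^k$ with vertices $v,v_1,\dots,v_k,v_1',\dots,v_k',u_1,\dots,u_{n-2k-1}$ whose edges are those of the $k$ triangles $vv_iv_i'v$ ($1\le i\le k$) together with the pendant edges $vu_1,\dots,vu_{n-2k-1}$. When $k=0$, $C^c$ is a star. -}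

module Defs where

open import Algebra.Bundles using (RawMonoid)
import Algebra.Definitions.RawMonoid as RawMonoidDefs
open import Data.Bool.Base using (if_then_else_)
open import Data.Fin.Base using (Fin; toℕ)
import Data.Fin.Properties as Fin
open import Data.Integer.Base using (+_)
open import Data.List.Base using (length; filter; allFin)
open import Data.Nat.Base as ℕ using (ℕ; suc)
open import Data.Nat.DivMod using (_mod_)
import Data.Nat.Properties as ℕ
open import Data.Product.Base using (∃-syntax; _×_; _,_)
open import Data.Rational.Base as ℚ using (ℚ; 0ℚ; 1ℚ; ½)
import Data.Rational.Properties as ℚ
import Data.Rational.Solver as ℚ-Solver
open import Data.Sum.Base as Sum using (_⊎_; inj₁; inj₂)
open import Data.Vec.Functional using (Vector)
open import Function.Bundles using (Bijection; _⇔_)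
open import Function.Definitions using (Injective)
import Function.Properties.Equivalence as ⇔
open import Level using (0ℓ)
open import Relation.Binary.Bundles using (Setoid)
open import Relation.Binary.Construct.Closure.ReflexiveTransitive using (Star)
open import Relation.Binary.Core using (Rel)
open import Relation.Binary.Definitions using (Decidable; Irreflexive; Symmetric)
open import Relation.Binary.PropositionalEquality
  using (_≡_; _≢_; refl; sym; trans; cong; subst; setoid)
open import Relation.Nullary.Decidable using (does; ¬?; _×-dec_; _⊎-dec_)
open import Relation.Nullary.Negation using (¬_)

-- Real numbers are Cauchy sequences of rationals; their equality is _≈_.

Cauchy : (ℕ → ℚ) → Set
Cauchy s = ∀ ε → 0ℚ ℚ.< ε →
  ∃[ N ] (∀ m n → N ℕ.≤ m → N ℕ.≤ n → ℚ.∣ s m ℚ.- s n ∣ ℚ.< ε)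

record ℝ : Set where
  constructor mkℝ
  field
    seq    : ℕ → ℚ
    cauchy : Cauchy seq

open ℝ public

infix  4 _≈_ _≤ℝ_ _<ℝ_
infixl 6 _+ℝ_ _-ℝ_
infixl 7 _*ℝ_
infix  8 -ℝ_

_≈_ : Rel ℝ 0ℓ
x ≈ y = ∀ ε → 0ℚ ℚ.< ε →
  ∃[ N ] (∀ n → N ℕ.≤ n → ℚ.∣ seq x n ℚ.- seq y n ∣ ℚ.< ε)

_≤ℝ_ : Rel ℝ 0ℓ
x ≤ℝ y = ∀ ε → 0ℚ ℚ.< ε →
  ∃[ N ] (∀ n → N ℕ.≤ n → seq x n ℚ.< seq y n ℚ.+ ε)

_<ℝ_ : Rel ℝ 0ℓ
x <ℝ y = ∃[ ε ] (0ℚ ℚ.< ε ×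
  ∃[ N ] (∀ n → N ℕ.≤ n → seq x n ℚ.+ ε ℚ.< seq y n))

fromℚ : ℚ → ℝ
fromℚ q = mkℝ (λ _ → q) λ ε 0<ε → 0 , λ _ _ _ _ →
  subst (ℚ._< ε) (sym (cong ℚ.∣_∣ (ℚ.+-inverseʳ q))) 0<ε

fromℕ : ℕ → ℝ
fromℕ n = fromℚ (+ n ℚ./ 1)

0ℝ 1ℝ : ℝ
0ℝ = fromℚ 0ℚ
1ℝ = fromℚ 1ℚ

private
  half+half : ∀ ε → ½ ℚ.* ε ℚ.+ ½ ℚ.* ε ≡ ε
  half+half ε =
    trans (sym (ℚ.*-distribʳ-+ ε ½ ½))
          (trans (cong (ℚ._* ε) ½+½≡1) (ℚ.*-identityˡ ε))
    where
    ½+½≡1 : ½ ℚ.+ ½ ≡ 1ℚ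
    ½+½≡1 = refl

  0<half : ∀ {ε} → 0ℚ ℚ.< ε → 0ℚ ℚ.< ½ ℚ.* ε
  0<half {ε} 0<ε =
    subst (ℚ._< ½ ℚ.* ε) (ℚ.*-zeroʳ ½) (ℚ.*-monoʳ-<-pos ½ 0<ε)

  sum-split : ∀ a b c d →
    (a ℚ.+ b) ℚ.- (c ℚ.+ d) ≡ (a ℚ.- c) ℚ.+ (b ℚ.- d)
  sum-split = solve 4
    (λ a b c d → (a :+ b) :- (c :+ d) := (a :- c) :+ (b :- d)) refl
    where open ℚ-Solver.+-*-Solver

  neg-swap : ∀ a b → (ℚ.- a) ℚ.- (ℚ.- b) ≡ ℚ.- (a ℚ.- b)
  neg-swap = solve 2 (λ a b → (:- a) :- (:- b) := :- (a :- b)) refl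
    where open ℚ-Solver.+-*-Solver

  product-split : ∀ a b c d →
    (a ℚ.* b) ℚ.- (c ℚ.* d) ≡ a ℚ.* (b ℚ.- d) ℚ.+ d ℚ.* (a ℚ.- c)
  product-split = solve 4
    (λ a b c d → (a :* b) :- (c :* d) := a :* (b :- d) :+ d :* (a :- c)) refl
    where open ℚ-Solver.+-*-Solver

  cancel-sub : ∀ a b → a ≡ (a ℚ.- b) ℚ.+ b
  cancel-sub = solve 2 (λ a b → a := (a :- b) :+ b) refl
    where open ℚ-Solver.+-*-Solver

  ⊔-lub : ∀ M N {n} → M ℕ.⊔ N ℕ.≤ n → (M ℕ.≤ n) × (N ℕ.≤ n)
  ⊔-lub M N h = ℕ.m⊔n≤o⇒m≤o M N h , ℕ.m⊔n≤o⇒n≤o M N h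

  0<1 : 0ℚ ℚ.< 1ℚ
  0<1 = ℚ.positive⁻¹ 1ℚ

  eventually-bounded : (x : ℝ) → ∃[ K ] (ℚ.Positive K ×
    ∃[ N ] (∀ n → N ℕ.≤ n → ℚ.∣ seq x n ∣ ℚ.≤ K))
  eventually-bounded x with cauchy x 1ℚ 0<1
  ... | N , close = K , K-pos , N , bounded
    where
    K : ℚ
    K = 1ℚ ℚ.+ ℚ.∣ seq x N ∣

    K-pos : ℚ.Positive K
    K-pos = ℚ.pos+nonNeg⇒pos 1ℚ ℚ.∣ seq x N ∣ {{ℚ.∣-∣-nonNeg (seq x N)}}

    bounded : ∀ n → N ℕ.≤ n → ℚ.∣ seq x n ∣ ℚ.≤ K
    bounded n N≤n = begin
      ℚ.∣ seq x n ∣                                ≡⟨ cong ℚ.∣_∣ (cancel-sub (seq x n) (seq x N)) ⟩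
      ℚ.∣ (seq x n ℚ.- seq x N) ℚ.+ seq x N ∣       ≤⟨ ℚ.∣p+q∣≤∣p∣+∣q∣ (seq x n ℚ.- seq x N) (seq x N) ⟩
      ℚ.∣ seq x n ℚ.- seq x N ∣ ℚ.+ ℚ.∣ seq x N ∣   ≤⟨ ℚ.+-monoˡ-≤ ℚ.∣ seq x N ∣ (ℚ.<⇒≤ (close n N N≤n ℕ.≤-refl)) ⟩
      K                                            ∎
      where open ℚ.≤-Reasoning

_+ℝ_ : ℝ → ℝ → ℝ
x +ℝ y = mkℝ (λ n → seq x n ℚ.+ seq y n) +-cauchy
  where
  +-cauchy : Cauchy (λ n → seq x n ℚ.+ seq y n)
  +-cauchy ε 0<ε
    with cauchy x (½ ℚ.* ε) (0<half 0<ε) | cauchy y (½ ℚ.* ε) (0<half 0<ε)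
  ... | M , x-close | N , y-close = M ℕ.⊔ N , λ m n ≤m ≤n →
    let M≤m , N≤m = ⊔-lub M N ≤m
        M≤n , N≤n = ⊔-lub M N ≤n
        open ℚ.≤-Reasoning
    in begin-strict
      ℚ.∣ (seq x m ℚ.+ seq y m) ℚ.- (seq x n ℚ.+ seq y n) ∣
        ≡⟨ cong ℚ.∣_∣ (sum-split (seq x m) (seq y m) (seq x n) (seq y n)) ⟩
      ℚ.∣ (seq x m ℚ.- seq x n) ℚ.+ (seq y m ℚ.- seq y n) ∣
        ≤⟨ ℚ.∣p+q∣≤∣p∣+∣q∣ (seq x m ℚ.- seq x n) (seq y m ℚ.- seq y n) ⟩
      ℚ.∣ seq x m ℚ.- seq x n ∣ ℚ.+ ℚ.∣ seq y m ℚ.- seq y n ∣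
        <⟨ ℚ.+-mono-< (x-close m n M≤m M≤n) (y-close m n N≤m N≤n) ⟩
      ½ ℚ.* ε ℚ.+ ½ ℚ.* ε
        ≡⟨ half+half ε ⟩
      ε ∎

-ℝ_ : ℝ → ℝ
-ℝ x = mkℝ (λ n → ℚ.- seq x n) -‿cauchy
  where
  -‿cauchy : Cauchy (λ n → ℚ.- seq x n)
  -‿cauchy ε 0<ε with cauchy x ε 0<ε
  ... | N , close = N , λ m n N≤m N≤n → subst (ℚ._< ε)
    (sym (trans (cong ℚ.∣_∣ (neg-swap (seq x m) (seq x n)))
                (ℚ.∣-p∣≡∣p∣ (seq x m ℚ.- seq x n))))
    (close m n N≤m N≤n)

_-ℝ_ : ℝ → ℝ → ℝ
x -ℝ y = x +ℝ (-ℝ y)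

private
  module _ (K L ε : ℚ) (K-pos : ℚ.Positive K) (L-pos : ℚ.Positive L)
           (0<ε : 0ℚ ℚ.< ε) where

    split-tolerance : ∃[ δ ] (0ℚ ℚ.< δ × K ℚ.* δ ℚ.+ L ℚ.* δ ≡ ε)
    split-tolerance = r ℚ.* ε , 0<rε , total
      where
      instance
        K+L-pos : ℚ.Positive (K ℚ.+ L)
        K+L-pos = ℚ.pos+pos⇒pos K {{K-pos}} L {{L-pos}}

        K+L-nonZero : ℚ.NonZero (K ℚ.+ L)
        K+L-nonZero = ℚ.pos⇒nonZero (K ℚ.+ L)

      r : ℚ
      r = ℚ.1/ (K ℚ.+ L)

      0<rε : 0ℚ ℚ.< r ℚ.* ε
      0<rε = subst (ℚ._< r ℚ.* ε) (ℚ.*-zeroʳ r)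
        (ℚ.*-monoʳ-<-pos r {{ℚ.1/pos⇒pos (K ℚ.+ L)}} 0<ε)

      total : K ℚ.* (r ℚ.* ε) ℚ.+ L ℚ.* (r ℚ.* ε) ≡ ε
      total = trans (sym (ℚ.*-distribʳ-+ (r ℚ.* ε) K L))
        (trans (sym (ℚ.*-assoc (K ℚ.+ L) r ε))
        (trans (cong (ℚ._* ε) (ℚ.*-inverseʳ (K ℚ.+ L))) (ℚ.*-identityˡ ε)))

  bound-product : ∀ B δ a b → ℚ.Positive B →
    ℚ.∣ a ∣ ℚ.≤ B → ℚ.∣ b ∣ ℚ.< δ → ℚ.∣ a ℚ.* b ∣ ℚ.< B ℚ.* δ
  bound-product B δ a b B-pos a≤B b<δ = begin-strict
    ℚ.∣ a ℚ.* b ∣          ≡⟨ ℚ.∣p*q∣≡∣p∣*∣q∣ a b ⟩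
    ℚ.∣ a ∣ ℚ.* ℚ.∣ b ∣     ≤⟨ ℚ.*-monoʳ-≤-nonNeg ℚ.∣ b ∣ {{ℚ.∣-∣-nonNeg b}} a≤B ⟩
    B ℚ.* ℚ.∣ b ∣          <⟨ ℚ.*-monoʳ-<-pos B {{B-pos}} b<δ ⟩
    B ℚ.* δ               ∎
    where open ℚ.≤-Reasoning

  products-close : ∀ K L δ ε a b c d → ℚ.Positive K → ℚ.Positive L →
    K ℚ.* δ ℚ.+ L ℚ.* δ ≡ ε →
    ℚ.∣ a ∣ ℚ.≤ K → ℚ.∣ d ∣ ℚ.≤ L →
    ℚ.∣ a ℚ.- c ∣ ℚ.< δ → ℚ.∣ b ℚ.- d ∣ ℚ.< δ →
    ℚ.∣ a ℚ.* b ℚ.- c ℚ.* d ∣ ℚ.< ε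
  products-close K L δ ε a b c d K-pos L-pos total a≤K d≤L a-c b-d = begin-strict
    ℚ.∣ a ℚ.* b ℚ.- c ℚ.* d ∣                            ≡⟨ cong ℚ.∣_∣ (product-split a b c d) ⟩
    ℚ.∣ a ℚ.* (b ℚ.- d) ℚ.+ d ℚ.* (a ℚ.- c) ∣             ≤⟨ ℚ.∣p+q∣≤∣p∣+∣q∣ (a ℚ.* (b ℚ.- d)) (d ℚ.* (a ℚ.- c)) ⟩
    ℚ.∣ a ℚ.* (b ℚ.- d) ∣ ℚ.+ ℚ.∣ d ℚ.* (a ℚ.- c) ∣       <⟨ ℚ.+-mono-< (bound-product K δ a (b ℚ.- d) K-pos a≤K b-d)
                                                                      (bound-product L δ d (a ℚ.- c) L-pos d≤L a-c) ⟩
    K ℚ.* δ ℚ.+ L ℚ.* δ                                  ≡⟨ total ⟩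
    ε                                                   ∎
    where open ℚ.≤-Reasoning

  product-tail : ∀ (s t : ℕ → ℚ) {K L δ ε Nx Ny Mx My} →
    ℚ.Positive K → ℚ.Positive L → K ℚ.* δ ℚ.+ L ℚ.* δ ≡ ε →
    (∀ n → Nx ℕ.≤ n → ℚ.∣ s n ∣ ℚ.≤ K) →
    (∀ n → Ny ℕ.≤ n → ℚ.∣ t n ∣ ℚ.≤ L) →
    (∀ m n → Mx ℕ.≤ m → Mx ℕ.≤ n → ℚ.∣ s m ℚ.- s n ∣ ℚ.< δ) →
    (∀ m n → My ℕ.≤ m → My ℕ.≤ n → ℚ.∣ t m ℚ.- t n ∣ ℚ.< δ) →
    ∃[ N ] (∀ m n → N ℕ.≤ m → N ℕ.≤ n →
      ℚ.∣ s m ℚ.* t m ℚ.- s n ℚ.* t n ∣ ℚ.< ε)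
  product-tail s t {K} {L} {δ} {ε} {Nx} {Ny} {Mx} {My}
               K-pos L-pos total s≤K t≤L s-close t-close =
    (Nx ℕ.⊔ Ny) ℕ.⊔ (Mx ℕ.⊔ My) , close
    where
    close : ∀ m n → (Nx ℕ.⊔ Ny) ℕ.⊔ (Mx ℕ.⊔ My) ℕ.≤ m →
                    (Nx ℕ.⊔ Ny) ℕ.⊔ (Mx ℕ.⊔ My) ℕ.≤ n →
      ℚ.∣ s m ℚ.* t m ℚ.- s n ℚ.* t n ∣ ℚ.< ε
    close m n ≤m ≤n
      with ⊔-lub (Nx ℕ.⊔ Ny) (Mx ℕ.⊔ My) ≤m | ⊔-lub (Nx ℕ.⊔ Ny) (Mx ℕ.⊔ My) ≤n
    ... | N≤m , M≤m | N≤n , M≤n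
      with ⊔-lub Nx Ny N≤m | ⊔-lub Mx My M≤m | ⊔-lub Nx Ny N≤n | ⊔-lub Mx My M≤n
    ... | Nx≤m , _ | Mx≤m , My≤m | _ , Ny≤n | Mx≤n , My≤n =
      products-close K L δ ε (s m) (t m) (s n) (t n)
        K-pos L-pos total (s≤K m Nx≤m) (t≤L n Ny≤n)
        (s-close m n Mx≤m Mx≤n) (t-close m n My≤m My≤n)

_*ℝ_ : ℝ → ℝ → ℝ
x *ℝ y = mkℝ (λ n → seq x n ℚ.* seq y n) *-cauchy
  where
  *-cauchy : Cauchy (λ n → seq x n ℚ.* seq y n)
  *-cauchy ε 0<ε =
    let K , K-pos , _ , x≤K = eventually-bounded x
        L , L-pos , _ , y≤L = eventually-bounded y
        δ , 0<δ , total     = split-tolerance K L ε K-pos L-pos 0<ε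
        _ , x-close         = cauchy x δ 0<δ
        _ , y-close         = cauchy y δ 0<δ
    in product-tail (seq x) (seq y) K-pos L-pos total x≤K y≤L x-close y-close

+ℝ-0-rawMonoid : RawMonoid 0ℓ 0ℓ
+ℝ-0-rawMonoid = record { Carrier = ℝ ; _≈_ = _≈_ ; _∙_ = _+ℝ_ ; ε = 0ℝ }

open RawMonoidDefs +ℝ-0-rawMonoid public using (sum)

Matrix : ℕ → Set
Matrix n = Fin n → Fin n → ℝ

infixr 7 _*ᵥ_

_*ᵥ_ : ∀ {n} → Matrix n → Vector ℝ n → Vector ℝ n
(M *ᵥ x) i = sum (λ j → M i j *ℝ x j)

IsEigenvalue : ∀ {n} → Matrix n → ℝ → Set
IsEigenvalue M μ = ∃[ x ]
  (¬ (∀ i → x i ≈ 0ℝ)) × (∀ i → (M *ᵥ x) i ≈ μ *ℝ x i)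

IsLargestEigenvalue : ∀ {n} → Matrix n → ℝ → Set
IsLargestEigenvalue M ρ =
  IsEigenvalue M ρ × (∀ μ → IsEigenvalue M μ → μ ≤ℝ ρ)

record Graph (n : ℕ) : Set₁ where
  field
    Adj    : Rel (Fin n) 0ℓ
    adj?   : Decidable Adj
    symm   : Symmetric Adj
    irrefl : Irreflexive _≡_ Adj

module _ {n : ℕ} (G : Graph n) where
  open Graph G

  degree : Fin n → ℕ
  degree i = length (filter (adj? i) (allFin n))

  adjacencyMatrix : Matrix n
  adjacencyMatrix i j = if does (adj? i j) then 1ℝ else 0ℝ

  degreeMatrix : Matrix n
  degreeMatrix i j = if does (i Fin.≟ j) then fromℕ (degree i) else 0ℝ

  A[_] : ℝ → Matrix n
  A[ α ] i j = α *ℝ degreeMatrix i j +ℝ (1ℝ -ℝ α) *ℝ adjacencyMatrix i j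

  -- A relation rather than a function: as _≤ℝ_ is antisymmetric up to _≈_,
  -- at most one ρ satisfies it.
  IsSpectralRadius : ℝ → ℝ → Set
  IsSpectralRadius α ρ = IsLargestEigenvalue A[ α ] ρ

  Connected : Set
  Connected = ∀ u v → Star Adj u v

next : ∀ {m} → Fin (suc m) → Fin (suc m)
next {m} i = suc (toℕ i) mod suc m

-- A cyclic listing of the vertices of a cycle.  The same cycle, as a
-- subgraph, has several such listings; _≈ᶜ_ identifies them.  The length
-- is 3 + excess.
record Cycle {n} (G : Graph n) : Set where
  field
    excess    : ℕ
    vertex    : Fin (3 ℕ.+ excess) → Fin n
    injective : Injective _≡_ _≡_ vertex
    closed    : ∀ i → Graph.Adj G (vertex i) (vertex (next i))

module _ {n : ℕ} {G : Graph n} where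
  open Cycle

  infix 4 _onCycle_ _≈ᶜ_

  _onCycle_ : Fin n → Cycle G → Set
  v onCycle c = ∃[ i ] vertex c i ≡ v

  EdgeOf : Cycle G → Rel (Fin n) 0ℓ
  EdgeOf c u v = ∃[ i ]
    ((vertex c i ≡ u × vertex c (next i) ≡ v) ⊎
     (vertex c i ≡ v × vertex c (next i) ≡ u))

  _≈ᶜ_ : Rel (Cycle G) 0ℓ
  c ≈ᶜ d = ∀ u v → EdgeOf c u v ⇔ EdgeOf d u v

module _ {n : ℕ} (G : Graph n) where

  cycleSetoid : Setoid 0ℓ 0ℓ
  cycleSetoid = record
    { Carrier       = Cycle G
    ; _≈_           = _≈ᶜ_
    ; isEquivalence = record
      { refl  = λ u v → ⇔.refl
      ; sym   = λ c≈d u v → ⇔.sym (c≈d u v)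
      ; trans = λ c≈d d≈e u v → ⇔.trans (c≈d u v) (d≈e u v)
      }
    }

  HasCycleCount : ℕ → Set
  HasCycleCount k = Bijection (setoid (Fin k)) cycleSetoid

  IsCactus : Set
  IsCactus = Connected G ×
    (∀ (c d : Cycle G) → ¬ (c ≈ᶜ d) → ∀ u v →
       u onCycle c → u onCycle d → v onCycle c → v onCycle d → u ≡ v)

record _∈𝒞_ {n : ℕ} (G : Graph n) (k : ℕ) : Set where
  field
    isCactus   : IsCactus G
    cycleCount : HasCycleCount G k

-- The extremal cactus.  Vertex 0 is v, vertex i is vᵢ and vertex k + i is
-- vᵢ′ for 1 ≤ i ≤ k, and the vertices above 2k are the uⱼ.  This is the
-- intended graph only when 2k + 1 ≤ n, which holds whenever some cactus
-- has n vertices and k cycles.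

module _ (n k : ℕ) where

  Hub : Rel ℕ 0ℓ
  Hub a b = a ≡ 0 × b ≢ 0

  Rim : Rel ℕ 0ℓ
  Rim a b = 1 ℕ.≤ a × a ℕ.≤ k × b ≡ k ℕ.+ a

  Edge : Rel (Fin n) 0ℓ
  Edge u w = Hub (toℕ u) (toℕ w) ⊎ Rim (toℕ u) (toℕ w)

  edge? : Decidable Edge
  edge? u w =
    (toℕ u ℕ.≟ 0 ×-dec ¬? (toℕ w ℕ.≟ 0)) ⊎-dec
    (1 ℕ.≤? toℕ u ×-dec toℕ u ℕ.≤? k ×-dec toℕ w ℕ.≟ k ℕ.+ toℕ u)

  loopless : ∀ u → ¬ Edge u u
  loopless u (inj₁ (u≡0 , u≢0)) = u≢0 u≡0
  loopless u (inj₂ (1≤u , u≤k , u≡k+u)) =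
    ℕ.m+1+n≢m (toℕ u) (trans (cong (toℕ u ℕ.+_) (ℕ.suc-pred k {{ℕ.>-nonZero (ℕ.≤-trans 1≤u u≤k)}}))
      (trans (ℕ.+-comm (toℕ u) k) (sym u≡k+u)))

  Cᶜ : Graph n
  Cᶜ = record
    { Adj    = λ u w → Edge u w ⊎ Edge w u
    ; adj?   = λ u w → edge? u w ⊎-dec edge? w u
    ; symm   = Sum.swap
    ; irrefl = λ { refl → Sum.[ loopless _ , loopless _ ] }
    }

{-# OPTIONS --safe #-}

-- Let x be an eigenvector of A_α(G), v a vertex where |x| is largest, and grow
-- a breadth-first tree from v.  Two non-tree edges at a common vertex u would
-- have different fundamental cycles sharing u and its parent, so in a cactus
-- the non-tree edges form a matching avoiding v; and as every cycle contains a
-- non-tree edge and distinct cycles share no edge, there are exactly k of them.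
--
-- Let r be the largest root of the characteristic equation of Cᶜ, and put
-- β = 1 - α.  In xᵀA_α(G)x a tree edge from u to its parent w contributes
-- α(x_u² + x_w²) + 2β x_u x_w, and AM-GM gives
--   2β x_u x_w ≤ (r-1-α) x_u² + β²/(r-1-α) x_w²   if u is matched,
--   2β x_u x_w ≤ (r-α) x_u² + β²/(r-α) x_w²       otherwise,
-- while a matching edge uw contributes at most x_u² + x_w².  Replacing x_w² by
-- x_v² and summing, the coefficients add up to xᵀA_α(G)x ≤ r xᵀx by the
-- equation for r.  Finally r is an eigenvalue of A_α(Cᶜ).
--
-- The order of ℝ is ¬¬-stable, which licenses the choice of v.
module Submission where

open import Algebra.Bundles using (CommutativeRing)
import Algebra.Properties.Semiring.Sum as SemiringSum
import Algebra.Solver.Ring as RingSolver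
import Algebra.Solver.Ring.AlmostCommutativeRing as ACR
open import Data.Bool.Base using (Bool; true; false; if_then_else_)
open import Data.Fin.Base as Fin using (Fin; zero; suc; toℕ; fromℕ<; inject₁; splitAt; join; _↑ˡ_; _↑ʳ_)
import Data.Fin.Properties as Fin
open import Data.Integer.Base as ℤ using (+_; -[1+_])
import Data.Integer.Properties as ℤ
open import Data.List.Base using (List; []; _∷_; _++_; length; lookup; filter; tabulate)
open import Data.List.Membership.Propositional using (_∈_)
open import Data.List.Membership.Propositional.Properties using (∈-++⁺ˡ; ∈-lookup)
import Data.List.Properties as List
open import Data.List.Relation.Unary.All as All using (All; []; _∷_)
import Data.List.Relation.Unary.All.Properties as All
open import Data.List.Relation.Unary.AllPairs using ([]; _∷_)
open import Data.List.Relation.Unary.Any as Any using (here; there)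
open import Data.List.Relation.Unary.Any.Properties using (lookup-index)
open import Data.List.Relation.Unary.Unique.Propositional using (Unique)
import Data.List.Relation.Unary.Unique.Propositional.Properties as Unique
open import Data.Maybe.Base using (map)
open import Data.Nat.Base as ℕ using (ℕ; zero; suc)
import Data.Nat.Coprimality as Coprime
open import Data.Nat.DivMod using (_%_; m<n⇒m%n≡m; n%n≡0; m%n<n)
import Data.Nat.Properties as ℕ
open import Data.Product.Base using (∃-syntax; _×_; _,_; proj₁; proj₂)
open import Data.Rational.Base as ℚ using (ℚ; 0ℚ; 1ℚ; ½)
import Data.Rational.Properties as ℚ
import Data.Rational.Solver as ℚ-Solver
open import Data.Sum.Base as Sum using (_⊎_; inj₁; inj₂)
open import Function.Base using (_∘_)
open import Function.Bundles using (Bijection; Equivalence)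
open import Level using (0ℓ)
open import Relation.Binary.Core using (Rel)
open import Relation.Binary.Definitions using (tri<; tri≈; tri>)
import Relation.Binary.PropositionalEquality as ≡
open ≡ using (_≡_; _≢_)
open import Relation.Nullary.Decidable using (Dec; dec⇒maybe; does; yes; no; ¬?; _×-dec_)
open import Relation.Nullary.Negation using (¬_; contradiction)
open import Relation.Unary using (Decidable)

-- The constants of the two AM-GM estimates come from the positive eigenvector of `Cᶜ`: its rim and
-- leaf entries are `β/(r-1-α)` and `β/(r-α)` times the hub entry, and at these ratios both
-- estimates are equalities. A matched vertex collects `α + (r-1-α) + 1 = r`, any other vertex
-- except `v` collects `α + (r-α) = r`, so what remains is a multiple of `x_v²`; it vanishes because
-- `r = (n-1)α + β²((n-1-2k)/(r-α) + 2k/(r-1-α))`. Two obstacles shape the proof. For `k =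
-- 0` the number `r-1-α` can be zero (two vertices, `α = 0`, `r =
-- 1`), so a factor `e` that is then `1` replaces it, and everything is multiplied by `e (r-α)`
-- instead of divided. And the sign of a real cannot be decided, so bisection does not produce `r`.
-- The right-hand side above decreases in `r`, which settles a sign at one of any two points and
-- makes trisection possible; positivity is kept throughout as a rational lower bound.

-- The estimates are proved over any such ring, so that Cauchy sequences are
-- not unfolded.
record RealRing : Set₁ where
  infix 4 _≤_
  field
    commutativeRing : CommutativeRing 0ℓ 0ℓ
  open CommutativeRing commutativeRing public
  field
    _≤_          : Rel Carrier 0ℓ
    ≤-reflexive  : ∀ {x y} → x ≈ y → x ≤ y
    ≤-trans      : ∀ {x y z} → x ≤ y → y ≤ z → x ≤ z
    ≤-antisym    : ∀ {x y} → x ≤ y → y ≤ x → x ≈ y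
    ≤-stable     : ∀ {x y} → ¬ ¬ (x ≤ y) → x ≤ y
    ≤-total      : ∀ x y → ¬ ¬ (x ≤ y ⊎ y ≤ x)
    +-mono-≤     : ∀ {x y u v} → x ≤ y → u ≤ v → x + u ≤ y + v
    *-nonNeg     : ∀ {x y} → 0# ≤ x → 0# ≤ y → 0# ≤ x * y
    square-nonNeg : ∀ x → 0# ≤ x * x
    square≤0⇒≈0  : ∀ {x} → x * x ≤ 0# → x ≈ 0#
    ι            : ℚ → Carrier
    ι-+          : ∀ p q → ι (p ℚ.+ q) ≈ ι p + ι q
    ι-*          : ∀ p q → ι (p ℚ.* q) ≈ ι p * ι q
    ι-neg        : ∀ p → ι (ℚ.- p) ≈ - ι p
    ι-0          : ι 0ℚ ≈ 0#
    ι-1          : ι 1ℚ ≈ 1#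
    ι-mono       : ∀ {p q} → p ℚ.≤ q → ι p ≤ ι q
    separated    : ∀ {x y δ} → 0ℚ ℚ.< δ → x + ι δ ≤ y → x ≤ 0# ⊎ 0# ≤ y
    archimedean  : ∀ {x} → (∀ δ → 0ℚ ℚ.< δ → x ≤ ι δ) → x ≤ 0#
    bounded      : ∀ x → ∃[ K ] (0ℚ ℚ.< K × x ≤ ι K)
    nested       : ∀ (l u : ℕ → ℚ) → (∀ n → l n ℚ.≤ l (suc n)) →
                   (∀ n → u (suc n) ℚ.≤ u n) → (∀ n → l n ℚ.≤ u n) →
                   (∀ ε → 0ℚ ℚ.< ε → ∃[ N ] u N ℚ.- l N ℚ.< ε) →
                   ∃[ r ] (∀ n → ι (l n) ≤ r × r ≤ ι (u n))

-- Rational arithmetic and absolute values.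

module RationalLemmas where
  open ≡ using (refl; sym; trans; cong; subst; subst₂)
  open ℚ-Solver.+-*-Solver using (solve; con; _:=_; _:+_; _:*_; _:-_; :-_)

  sub-add : ∀ p q → q ℚ.- p ℚ.+ p ≡ q
  sub-add = solve 2 (λ p q → q :- p :+ p := q) refl

  neg-sub : ∀ p q → ℚ.- (p ℚ.- q) ≡ q ℚ.- p
  neg-sub = solve 2 (λ p q → :- (p :- q) := q :- p) refl

  add-sub : ∀ p q → q ℚ.+ (p ℚ.- q) ≡ p
  add-sub = solve 2 (λ p q → q :+ (p :- q) := p) refl

  sub-telescope : ∀ x y z → (x ℚ.- y) ℚ.+ (y ℚ.- z) ≡ x ℚ.- z
  sub-telescope = solve 3 (λ x y z → (x :- y) :+ (y :- z) := x :- z) refl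

  sub-sum : ∀ x y u v → (x ℚ.- y) ℚ.+ (u ℚ.- v) ≡ (x ℚ.+ u) ℚ.- (y ℚ.+ v)
  sub-sum = solve 4 (λ x y u v → (x :- y) :+ (u :- v) := (x :+ u) :- (y :+ v)) refl

  sub-product : ∀ x y u v → x ℚ.* (u ℚ.- v) ℚ.+ v ℚ.* (x ℚ.- y) ≡ x ℚ.* u ℚ.- y ℚ.* v
  sub-product = solve 4 (λ x y u v → x :* (u :- v) :+ v :* (x :- y) := x :* u :- y :* v) refl

  sub-neg : ∀ x y → ℚ.- (x ℚ.- y) ≡ (ℚ.- x) ℚ.- (ℚ.- y)
  sub-neg = solve 2 (λ x y → :- (x :- y) := (:- x) :- (:- y)) refl

  add-sub-cancelˡ : ∀ q e → (q ℚ.+ e) ℚ.- q ≡ e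
  add-sub-cancelˡ = solve 2 (λ q e → (q :+ e) :- q := e) refl

  sum-shift : ∀ y v e → (y ℚ.+ e) ℚ.+ (v ℚ.+ e) ≡ (y ℚ.+ v) ℚ.+ (e ℚ.+ e)
  sum-shift = solve 3 (λ y v e → (y :+ e) :+ (v :+ e) := (y :+ v) :+ (e :+ e)) refl

  -neg≡+ : ∀ p e → e ℚ.- (ℚ.- p) ≡ p ℚ.+ e
  -neg≡+ = solve 2 (λ p e → e :- (:- p) := p :+ e) refl

  neg-square : ∀ p → (ℚ.- p) ℚ.* (ℚ.- p) ≡ p ℚ.* p
  neg-square = solve 1 (λ p → (:- p) :* (:- p) := p :* p) refl

  neg-neg : ∀ p → ℚ.- (ℚ.- p) ≡ p
  neg-neg = solve 1 (λ p → :- (:- p) := p) refl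

  add-sub-cancelʳ : ∀ p q → (p ℚ.+ q) ℚ.- q ≡ p
  add-sub-cancelʳ = solve 2 (λ p q → (p :+ q) :- q := p) refl

  half : ℚ → ℚ
  half ε = ½ ℚ.* ε

  half+half : ∀ ε → half ε ℚ.+ half ε ≡ ε
  half+half ε = trans (sym (ℚ.*-distribʳ-+ ε ½ ½))
    (trans (cong (ℚ._* ε) ½+½≡1) (ℚ.*-identityˡ ε))
    where
    ½+½≡1 : ½ ℚ.+ ½ ≡ 1ℚ
    ½+½≡1 = refl

  half-pos : ∀ {ε} → 0ℚ ℚ.< ε → 0ℚ ℚ.< half ε
  half-pos {ε} 0<ε = subst (ℚ._< ½ ℚ.* ε) (ℚ.*-zeroʳ ½) (ℚ.*-monoʳ-<-pos ½ 0<ε)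

  -- Linear inequalities over ℚ are reduced to 0 < _ so that the solver can
  -- match both sides.
  0<⇒< : ∀ {p q} → 0ℚ ℚ.< q ℚ.- p → p ℚ.< q
  0<⇒< {p} {q} h = subst₂ ℚ._<_ (ℚ.+-identityˡ p)
    (sub-add p q) (ℚ.+-monoˡ-< p h)

  <⇒0< : ∀ {p q} → p ℚ.< q → 0ℚ ℚ.< q ℚ.- p
  <⇒0< {p} {q} h = subst (ℚ._< q ℚ.- p) (ℚ.+-inverseʳ p) (ℚ.+-monoˡ-< (ℚ.- p) h)

  ≤⇒0≤ : ∀ {p q} → p ℚ.≤ q → 0ℚ ℚ.≤ q ℚ.- p
  ≤⇒0≤ {p} {q} h = subst (ℚ._≤ q ℚ.- p) (ℚ.+-inverseʳ p) (ℚ.+-monoˡ-≤ (ℚ.- p) h)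

  0<+ : ∀ {p q} → 0ℚ ℚ.< p → 0ℚ ℚ.< q → 0ℚ ℚ.< p ℚ.+ q
  0<+ p q = ℚ.+-mono-< p q

  0<* : ∀ {p q} → 0ℚ ℚ.< p → 0ℚ ℚ.< q → 0ℚ ℚ.< p ℚ.* q
  0<* {p} {q} 0<p 0<q = subst (ℚ._< p ℚ.* q) (ℚ.*-zeroʳ p)
    (ℚ.*-monoʳ-<-pos p {{ℚ.positive 0<p}} 0<q)

  0≤* : ∀ {p q} → 0ℚ ℚ.≤ p → 0ℚ ℚ.≤ q → 0ℚ ℚ.≤ p ℚ.* q
  0≤* {p} {q} 0≤p 0≤q = subst (ℚ._≤ p ℚ.* q) (ℚ.*-zeroʳ p)
    (ℚ.*-monoˡ-≤-nonNeg p {{ℚ.nonNegative 0≤p}} 0≤q)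

  p≤∣p∣ : ∀ p → p ℚ.≤ ℚ.∣ p ∣
  p≤∣p∣ p with ℚ.≤-total 0ℚ p
  ... | inj₁ 0≤p = ℚ.≤-reflexive (sym (ℚ.0≤p⇒∣p∣≡p 0≤p))
  ... | inj₂ p≤0 = ℚ.≤-trans p≤0 (ℚ.0≤∣p∣ p)

  -p≤∣p∣ : ∀ p → ℚ.- p ℚ.≤ ℚ.∣ p ∣
  -p≤∣p∣ p = subst (ℚ.- p ℚ.≤_) (ℚ.∣-p∣≡∣p∣ p) (p≤∣p∣ (ℚ.- p))

  ∣∣<-intro : ∀ {p ε} → p ℚ.< ε → ℚ.- p ℚ.< ε → ℚ.∣ p ∣ ℚ.< ε
  ∣∣<-intro {p} {ε} a b with ℚ.∣p∣≡p∨∣p∣≡-p p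
  ... | inj₁ e = subst (ℚ._< ε) (sym e) a
  ... | inj₂ e = subst (ℚ._< ε) (sym e) b

  ∣∣<⇒< : ∀ {p ε} → ℚ.∣ p ∣ ℚ.< ε → p ℚ.< ε
  ∣∣<⇒< h = ℚ.≤-<-trans (p≤∣p∣ _) h

  ∣∣<⇒-< : ∀ {p ε} → ℚ.∣ p ∣ ℚ.< ε → ℚ.- p ℚ.< ε
  ∣∣<⇒-< h = ℚ.≤-<-trans (-p≤∣p∣ _) h

  ∣-∣-swap : ∀ p q → ℚ.∣ p ℚ.- q ∣ ≡ ℚ.∣ q ℚ.- p ∣
  ∣-∣-swap p q = trans (sym (ℚ.∣-p∣≡∣p∣ (p ℚ.- q)))
    (cong ℚ.∣_∣ (neg-sub p q))

  ∣*∣< : ∀ {K δ} p q → 0ℚ ℚ.< K → ℚ.∣ p ∣ ℚ.< K → ℚ.∣ q ∣ ℚ.< δ →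
    ℚ.∣ p ℚ.* q ∣ ℚ.< K ℚ.* δ
  ∣*∣< {K} {δ} p q 0<K p<K q<δ = begin-strict
    ℚ.∣ p ℚ.* q ∣       ≡⟨ ℚ.∣p*q∣≡∣p∣*∣q∣ p q ⟩
    ℚ.∣ p ∣ ℚ.* ℚ.∣ q ∣ ≤⟨ ℚ.*-monoʳ-≤-nonNeg ℚ.∣ q ∣ {{ℚ.∣-∣-nonNeg q}} (ℚ.<⇒≤ p<K) ⟩
    K ℚ.* ℚ.∣ q ∣       <⟨ ℚ.*-monoʳ-<-pos K {{ℚ.positive 0<K}} q<δ ⟩
    K ℚ.* δ             ∎
    where open ℚ.≤-Reasoning

  -- Callers receive `δ` with its defining equation, so the reciprocal and its instance arguments
  -- stay inside.
  divide : ∀ K ε → 0ℚ ℚ.< K → 0ℚ ℚ.< ε → ∃[ δ ] (0ℚ ℚ.< δ × K ℚ.* δ ≡ ε)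
  divide K ε 0<K 0<ε = r ℚ.* ε , 0<* (ℚ.positive⁻¹ r {{ℚ.1/pos⇒pos K}}) 0<ε ,
    trans (sym (ℚ.*-assoc K r ε))
      (trans (cong (ℚ._* ε) (ℚ.*-inverseʳ K)) (ℚ.*-identityˡ ε))
    where
    instance
      K-pos : ℚ.Positive K
      K-pos = ℚ.positive 0<K
      K-nonZero : ℚ.NonZero K
      K-nonZero = ℚ.pos⇒nonZero K
    r : ℚ
    r = ℚ.1/ K

  ∣∣<-nonPos : ∀ {p γ} → 0ℚ ℚ.< γ → p ℚ.≤ 0ℚ → 0ℚ ℚ.< p ℚ.+ γ → ℚ.∣ p ∣ ℚ.< γ
  ∣∣<-nonPos {p} {γ} c b a = ∣∣<-intro (ℚ.≤-<-trans b c)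
    (0<⇒< (subst (0ℚ ℚ.<_) (sym (-neg≡+ p γ)) a))

  ∣∣<⇒0<+ : ∀ {p ε} → ℚ.∣ p ∣ ℚ.< ε → 0ℚ ℚ.< p ℚ.+ ε
  ∣∣<⇒0<+ {p} {ε} h = subst (0ℚ ℚ.<_) (-neg≡+ p ε) (<⇒0< (∣∣<⇒-< h))

  -- A factor that is negative, but only within its tolerance, is small in absolute value; times the
  -- bound of the other factor it stays below `ε`. Two nonnegative factors need no tolerance.
  product-bound : ∀ {ε K L δ η} → 0ℚ ℚ.< ε → 0ℚ ℚ.< K → 0ℚ ℚ.< L → 0ℚ ℚ.< δ → 0ℚ ℚ.< η →
    K ℚ.* δ ≡ ε → L ℚ.* η ≡ ε → ∀ p q →
    ℚ.∣ p ∣ ℚ.< K → 0ℚ ℚ.< p ℚ.+ η → ℚ.∣ q ∣ ℚ.< L → 0ℚ ℚ.< q ℚ.+ δ →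
    0ℚ ℚ.< p ℚ.* q ℚ.+ ε
  product-bound 0<ε 0<K 0<L 0<δ 0<η Kδ≡ε Lη≡ε p q p<K 0<p+η q<L 0<q+δ
    with ℚ.≤-total 0ℚ p | ℚ.≤-total 0ℚ q
  ... | inj₁ 0≤p | inj₁ 0≤q = ℚ.+-mono-≤-< (0≤* 0≤p 0≤q) 0<ε
  ... | _ | inj₂ q≤0 = ∣∣<⇒0<+ (subst (ℚ.∣ p ℚ.* q ∣ ℚ.<_) Kδ≡ε
    (∣*∣< p q 0<K p<K (∣∣<-nonPos 0<δ q≤0 0<q+δ)))
  ... | inj₂ p≤0 | inj₁ _ = ∣∣<⇒0<+ (subst₂ (λ z w → ℚ.∣ z ∣ ℚ.< w) (ℚ.*-comm q p) Lη≡ε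
    (∣*∣< q p 0<L q<L (∣∣<-nonPos 0<η p≤0 0<p+η)))

  square-nonNegℚ : ∀ p → 0ℚ ℚ.≤ p ℚ.* p
  square-nonNegℚ p with ℚ.≤-total 0ℚ p
  ... | inj₁ 0≤p = 0≤* 0≤p 0≤p
  ... | inj₂ p≤0 = subst (0ℚ ℚ.≤_) (neg-square p)
    (0≤* (ℚ.neg-antimono-≤ p≤0) (ℚ.neg-antimono-≤ p≤0))

  -- `compare` tests one late term with margin `3θ`. Later terms of either sequence move by less
  -- than `θ`, so a passed test leaves `x < y + 5θ`, and a failed one leaves `y + θ < x` by
  -- `gap-lower`; hence the division of `ε` by five.
  gap-upper : ∀ xn xk yn yk θ →
    (θ ℚ.- (xn ℚ.- xk)) ℚ.+ (θ ℚ.- (ℚ.- (yn ℚ.- yk))) ℚ.+ ((yk ℚ.+ (θ ℚ.+ θ ℚ.+ θ)) ℚ.- xk) ≡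
    (yn ℚ.+ (θ ℚ.+ θ ℚ.+ θ ℚ.+ θ ℚ.+ θ)) ℚ.- xn
  gap-upper = solve 5 (λ xn xk yn yk θ →
    (θ :- (xn :- xk)) :+ (θ :- (:- (yn :- yk))) :+ ((yk :+ (θ :+ θ :+ θ)) :- xk) :=
    (yn :+ (θ :+ θ :+ θ :+ θ :+ θ)) :- xn) refl

  gap-lower : ∀ xn xk yn yk θ →
    (θ ℚ.- (ℚ.- (xn ℚ.- xk))) ℚ.+ (θ ℚ.- (yn ℚ.- yk)) ℚ.+ (xk ℚ.- (yk ℚ.+ (θ ℚ.+ θ ℚ.+ θ))) ≡
    xn ℚ.- (yn ℚ.+ θ)
  gap-lower = solve 5 (λ xn xk yn yk θ →
    (θ :- (:- (xn :- xk))) :+ (θ :- (yn :- yk)) :+ (xk :- (yk :+ (θ :+ θ :+ θ))) :=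
    xn :- (yn :+ θ)) refl

  five : ∀ θ → (1ℚ ℚ.+ 1ℚ ℚ.+ 1ℚ ℚ.+ 1ℚ ℚ.+ 1ℚ) ℚ.* θ ≡ θ ℚ.+ θ ℚ.+ θ ℚ.+ θ ℚ.+ θ
  five = solve 1 (λ θ → (con 1ℚ :+ con 1ℚ :+ con 1ℚ :+ con 1ℚ :+ con 1ℚ) :* θ :=
    θ :+ θ :+ θ :+ θ :+ θ) refl

  p<p+q : ∀ {p q} → 0ℚ ℚ.< q → p ℚ.< p ℚ.+ q
  p<p+q {p} {q} 0<q = subst (ℚ._< p ℚ.+ q) (ℚ.+-identityʳ p) (ℚ.+-monoʳ-< p 0<q)

-- Trisection of rational intervals.

module NestedIntervals where
  open RationalLemmas using (divide; sub-add; 0<*; 0≤*; 0<⇒<; <⇒0<)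
  open ℚ-Solver.+-*-Solver using (solve; con; _:=_; _:+_; _:*_; _:-_; :-_)

  ⅓ : ℚ
  ⅓ = + 1 ℚ./ 3

  ⅔ : ℚ
  ⅔ = + 2 ℚ./ 3

  2ℚ : ℚ
  2ℚ = 1ℚ ℚ.+ 1ℚ

  natℚ : ℕ → ℚ
  natℚ zero    = 0ℚ
  natℚ (suc n) = 1ℚ ℚ.+ natℚ n

  natℚ-nonNeg : ∀ n → 0ℚ ℚ.≤ natℚ n
  natℚ-nonNeg zero    = ℚ.≤-refl
  natℚ-nonNeg (suc n) = ℚ.+-mono-≤ (ℚ.nonNegative⁻¹ 1ℚ) (natℚ-nonNeg n)

  mkℚ-n/1 : ∀ n → ℚ.mkℚ (+ n) 0 (Coprime.sym (Coprime.1-coprimeTo n)) ≡ + n ℚ./ 1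
  mkℚ-n/1 n = ≡.sym (ℚ.normalize-coprime (Coprime.sym (Coprime.1-coprimeTo n)))

  suc/1 : ∀ n → + suc n ℚ./ 1 ≡ 1ℚ ℚ.+ (+ n ℚ./ 1)
  suc/1 n = ≡.trans (≡.cong (λ z → (+ 1 ℤ.+ z) ℚ./ 1) (≡.sym (ℤ.*-identityʳ (+ n))))
    (≡.cong (1ℚ ℚ.+_) (mkℚ-n/1 n))

  natℚ-/1 : ∀ n → + n ℚ./ 1 ≡ natℚ n
  natℚ-/1 zero    = ≡.refl
  natℚ-/1 (suc n) = ≡.trans (suc/1 n) (≡.cong (1ℚ ℚ.+_) (natℚ-/1 n))

  natℚ-mono-< : ∀ {m n} → m ℕ.< n → natℚ m ℚ.< natℚ n
  natℚ-mono-< {zero}  {suc n} _           = ℚ.+-mono-<-≤ (ℚ.positive⁻¹ 1ℚ) (natℚ-nonNeg n)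
  natℚ-mono-< {suc m} {suc n} (ℕ.s≤s m<n) = ℚ.+-monoʳ-< 1ℚ (natℚ-mono-< m<n)

  /1-mono-< : ∀ {m n} → m ℕ.< n → + m ℚ./ 1 ℚ.< + n ℚ./ 1
  /1-mono-< {m} {n} m<n = ≡.subst₂ ℚ._<_ (≡.sym (natℚ-/1 m)) (≡.sym (natℚ-/1 n)) (natℚ-mono-< m<n)

  -- The numerator plus one suffices, as the denominator is at least one.
  natℚ-above : ∀ p → ∃[ n ] p ℚ.< natℚ n
  natℚ-above p@(ℚ.mkℚ (+ m) d _) = suc m ,
    ≡.subst (p ℚ.<_) (≡.trans (mkℚ-n/1 (suc m)) (natℚ-/1 (suc m))) (ℚ.*<* (≡.subst₂ ℤ._<_
      (≡.sym (ℤ.*-identityʳ (+ m))) (ℤ.pos-* (suc m) (suc d))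
      (ℤ.+<+ (ℕ.m≤m*n (suc m) (suc d)))))
  natℚ-above p@(ℚ.mkℚ -[1+ m ] d _) = 0 , ℚ.negative⁻¹ p

  m₁ m₂ : ℚ → ℚ → ℚ
  m₁ l u = l ℚ.+ ⅓ ℚ.* (u ℚ.- l)
  m₂ l u = l ℚ.+ ⅔ ℚ.* (u ℚ.- l)

  private
    third-gap : ∀ l u → (l ℚ.+ ⅔ ℚ.* (u ℚ.- l)) ℚ.- (l ℚ.+ ⅓ ℚ.* (u ℚ.- l)) ≡ ⅓ ℚ.* (u ℚ.- l)
    third-gap = solve 2 (λ l u →
      (l :+ con ⅔ :* (u :- l)) :- (l :+ con ⅓ :* (u :- l)) := con ⅓ :* (u :- l)) ≡.refl

    lower-gap : ∀ l u → (l ℚ.+ ⅓ ℚ.* (u ℚ.- l)) ℚ.- l ≡ ⅓ ℚ.* (u ℚ.- l)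
    lower-gap = solve 2 (λ l u → (l :+ con ⅓ :* (u :- l)) :- l := con ⅓ :* (u :- l)) ≡.refl

    upper-gap : ∀ l u → u ℚ.- (l ℚ.+ ⅔ ℚ.* (u ℚ.- l)) ≡ ⅓ ℚ.* (u ℚ.- l)
    upper-gap = solve 2 (λ l u → u :- (l :+ con ⅔ :* (u :- l)) := con ⅓ :* (u :- l)) ≡.refl

    lower-width : ∀ l u → u ℚ.- (l ℚ.+ ⅓ ℚ.* (u ℚ.- l)) ≡ ⅔ ℚ.* (u ℚ.- l)
    lower-width = solve 2 (λ l u → u :- (l :+ con ⅓ :* (u :- l)) := con ⅔ :* (u :- l)) ≡.refl

    upper-width : ∀ l u → (l ℚ.+ ⅔ ℚ.* (u ℚ.- l)) ℚ.- l ≡ ⅔ ℚ.* (u ℚ.- l)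
    upper-width = solve 2 (λ l u → (l :+ con ⅔ :* (u :- l)) :- l := con ⅔ :* (u :- l)) ≡.refl

    shrink-step : ∀ w m → w ℚ.* (m ℚ.+ 2ℚ) ℚ.- (⅔ ℚ.* w) ℚ.* ((1ℚ ℚ.+ m) ℚ.+ 2ℚ) ≡ ⅓ ℚ.* (w ℚ.* m)
    shrink-step = solve 2 (λ w m →
      w :* (m :+ con 2ℚ) :- (con ⅔ :* w) :* ((con 1ℚ :+ m) :+ con 2ℚ) := con ⅓ :* (w :* m)) ≡.refl

    third-pos : ∀ {l u} → l ℚ.< u → 0ℚ ℚ.< ⅓ ℚ.* (u ℚ.- l)
    third-pos l<u = 0<* (ℚ.positive⁻¹ ⅓) (<⇒0< l<u)

    l≤m₁ : ∀ {l u} → l ℚ.< u → l ℚ.≤ m₁ l u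
    l≤m₁ {l} {u} l<u = ℚ.<⇒≤ (0<⇒< {l} {m₁ l u} (≡.subst (0ℚ ℚ.<_) (≡.sym (lower-gap l u)) (third-pos l<u)))

    m₁<m₂ : ∀ {l u} → l ℚ.< u → m₁ l u ℚ.< m₂ l u
    m₁<m₂ {l} {u} l<u = 0<⇒< {m₁ l u} {m₂ l u} (≡.subst (0ℚ ℚ.<_) (≡.sym (third-gap l u)) (third-pos l<u))

    m₂≤u : ∀ {l u} → l ℚ.< u → m₂ l u ℚ.≤ u
    m₂≤u {l} {u} l<u = ℚ.<⇒≤ (0<⇒< {m₂ l u} {u} (≡.subst (0ℚ ℚ.<_) (≡.sym (upper-gap l u)) (third-pos l<u)))

  record Bracket (lo hi : ℚ → Set) : Set where
    constructor bracket
    field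
      left right : ℚ
      left<right : left ℚ.< right
      left-lo    : lo left
      right-hi   : hi right
    width : ℚ
    width = right ℚ.- left

  open Bracket

  -- Bisection would need the sign at a single point, which is undecidable over the reals. Two
  -- points `p < q` with a choice between `lo p` and `hi q` are enough: either answer keeps two
  -- thirds of the bracket.
  module Trisection (lo hi : ℚ → Set)
    (decide : ∀ (B : Bracket lo hi) {p q} → left B ℚ.≤ p → p ℚ.< q → q ℚ.≤ right B → lo p ⊎ hi q)
    (start : Bracket lo hi) where

    record Refines (B B′ : Bracket lo hi) : Set where
      field
        left-mono   : left B ℚ.≤ left B′
        right-mono  : right B′ ℚ.≤ right B
        width-third : width B′ ≡ ⅔ ℚ.* width B
    open Refines

    refine : ∀ B → ∃[ B′ ] Refines B B′
    refine B = Sum.[ keep-right , keep-left ]′ (decide B (l≤m₁ l<u) (m₁<m₂ l<u) (m₂≤u l<u))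
      where
      l = left B
      u = right B
      l<u = left<right B
      keep-right : lo (m₁ l u) → ∃[ B′ ] Refines B B′
      keep-right lo-m = bracket (m₁ l u) u (ℚ.<-≤-trans (m₁<m₂ l<u) (m₂≤u l<u)) lo-m (right-hi B) ,
        record { left-mono = l≤m₁ l<u ; right-mono = ℚ.≤-refl ; width-third = lower-width l u }
      keep-left : hi (m₂ l u) → ∃[ B′ ] Refines B B′
      keep-left hi-m = bracket l (m₂ l u) (ℚ.≤-<-trans (l≤m₁ l<u) (m₁<m₂ l<u)) (left-lo B) hi-m ,
        record { left-mono = ℚ.≤-refl ; right-mono = m₂≤u l<u ; width-third = upper-width l u }

    iterate : ℕ → Bracket lo hi
    iterate zero    = start
    iterate (suc n) = proj₁ (refine (iterate n))

    -- Since (2/3)ⁿ ≤ 2/(n+2).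
    width-bound : ∀ n → width (iterate n) ℚ.* (natℚ n ℚ.+ 2ℚ) ℚ.≤ width start ℚ.* 2ℚ
    width-bound zero    = ℚ.≤-refl
    width-bound (suc n) = ℚ.≤-trans
      (≡.subst (λ z → z ℚ.* ((1ℚ ℚ.+ natℚ n) ℚ.+ 2ℚ) ℚ.≤ w ℚ.* (natℚ n ℚ.+ 2ℚ))
        (≡.sym (width-third (proj₂ (refine (iterate n)))))
        (0≤⇒≤ (≡.subst (0ℚ ℚ.≤_) (≡.sym (shrink-step w (natℚ n)))
          (0≤* (ℚ.nonNegative⁻¹ ⅓) (0≤* (ℚ.<⇒≤ (<⇒0< (left<right (iterate n)))) (natℚ-nonNeg n))))))
      (width-bound n)
      where
      w = width (iterate n)
      0≤⇒≤ : ∀ {p q} → 0ℚ ℚ.≤ q ℚ.- p → p ℚ.≤ q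
      0≤⇒≤ {p} {q} h = ≡.subst₂ ℚ._≤_ (ℚ.+-identityˡ p) (sub-add p q) (ℚ.+-monoˡ-≤ p h)

    width-shrinks : ∀ ε → 0ℚ ℚ.< ε → ∃[ n ] width (iterate n) ℚ.< ε
    width-shrinks ε 0<ε =
      -- For `n` above `δ = 2W/ε`, where `W` is the initial width, `w (n+2) ≤ 2W = εδ < ε (n+2)`,
      -- and `n+2` cancels.
      let δ , 0<δ , εδ≡2W = divide ε (width start ℚ.* 2ℚ) 0<ε (0<* (<⇒0< (left<right start)) (ℚ.positive⁻¹ 2ℚ))
          n , δ<n = natℚ-above δ
          w = width (iterate n)
          0<n+2 = ℚ.+-mono-≤-< (natℚ-nonNeg n) (ℚ.positive⁻¹ 2ℚ)
          εδ<ε[n+2] = ℚ.*-monoʳ-<-pos ε {{ℚ.positive 0<ε}}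
            (ℚ.<-trans δ<n (≡.subst (ℚ._< natℚ n ℚ.+ 2ℚ) (ℚ.+-identityʳ (natℚ n))
              (ℚ.+-monoʳ-< (natℚ n) (ℚ.positive⁻¹ 2ℚ))))
      in n , ℚ.*-cancelʳ-<-nonNeg (natℚ n ℚ.+ 2ℚ) {{ℚ.nonNegative (ℚ.<⇒≤ 0<n+2)}}
        (ℚ.≤-<-trans (width-bound n) (≡.subst (ℚ._< ε ℚ.* (natℚ n ℚ.+ 2ℚ)) εδ≡2W εδ<ε[n+2]))

    left-iterate : ∀ n → left (iterate n) ℚ.≤ left (iterate (suc n))
    left-iterate n = left-mono (proj₂ (refine (iterate n)))

    right-iterate : ∀ n → right (iterate (suc n)) ℚ.≤ right (iterate n)
    right-iterate n = right-mono (proj₂ (refine (iterate n)))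

-- Order and finite sums in a real ring.

module Ordered (R : RealRing) where
  open RationalLemmas using (divide)
  open NestedIntervals using (suc/1)

  open RealRing R public hiding (zero)
  open SemiringSum semiring public

  -- The solver needs coefficients with decidable equality, so they are rationals embedded by `ι`.
  -- This is why identities given to it often contain `ι 1ℚ`: it is a constant for the solver, while
  -- `1#` is opaque.
  ℚ-morphism : CommutativeRing.rawRing ℚ.+-*-commutativeRing
    ACR.-Raw-AlmostCommutative⟶ ACR.fromCommutativeRing commutativeRing
  ℚ-morphism = record
    { ⟦_⟧ = ι ; +-homo = ι-+ ; *-homo = ι-* ; -‿homo = ι-neg ; 0-homo = ι-0 ; 1-homo = ι-1 }

  open RingSolver _ _ ℚ-morphism
    (λ p q → map (reflexive ∘ ≡.cong ι) (dec⇒maybe (p ℚ.≟ q))) public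
    using (solve; con; _:=_; _:+_; _:*_; _:-_; :-_)

  ≤-refl : ∀ {x} → x ≤ x
  ≤-refl = ≤-reflexive refl

  ≤-respˡ : ∀ {x y z} → x ≈ y → x ≤ z → y ≤ z
  ≤-respˡ e = ≤-trans (≤-reflexive (sym e))

  ≤-respʳ : ∀ {x y z} → x ≈ y → z ≤ x → z ≤ y
  ≤-respʳ e h = ≤-trans h (≤-reflexive e)

  0≤-⇒≤ : ∀ {x y} → 0# ≤ y - x → x ≤ y
  0≤-⇒≤ {x} {y} h = ≤-respˡ (+-identityˡ x)
    (≤-respʳ (solve 2 (λ x y → y :- x :+ x := y) refl x y) (+-mono-≤ h ≤-refl))

  ≤⇒0≤- : ∀ {x y} → x ≤ y → 0# ≤ y - x
  ≤⇒0≤- {x} {y} h = ≤-respˡ (-‿inverseʳ x) (+-mono-≤ h ≤-refl)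

  +-nonNeg : ∀ {x y} → 0# ≤ x → 0# ≤ y → 0# ≤ x + y
  +-nonNeg h k = ≤-respˡ (+-identityˡ 0#) (+-mono-≤ h k)

  *-monoˡ-≤ : ∀ {c x y} → 0# ≤ c → x ≤ y → c * x ≤ c * y
  *-monoˡ-≤ {c} {x} {y} 0≤c x≤y = 0≤-⇒≤ (≤-respʳ
    (solve 3 (λ c x y → c :* (y :- x) := c :* y :- c :* x) refl c x y)
    (*-nonNeg 0≤c (≤⇒0≤- x≤y)))

  *-monoʳ-≤ : ∀ {c x y} → 0# ≤ c → x ≤ y → x * c ≤ y * c
  *-monoʳ-≤ {c} {x} {y} 0≤c x≤y =
    ≤-respˡ (*-comm c x) (≤-respʳ (*-comm c y) (*-monoˡ-≤ 0≤c x≤y))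

  neg-anti-≤ : ∀ {x y} → x ≤ y → - y ≤ - x
  neg-anti-≤ {x} {y} h = 0≤-⇒≤ (≤-respʳ
    (solve 2 (λ x y → y :- x := (:- x) :- (:- y)) refl x y) (≤⇒0≤- h))

  neg≤0⇒0≤ : ∀ {x} → - x ≤ 0# → 0# ≤ x
  neg≤0⇒0≤ {x} h = ≤-respʳ (trans (+-identityˡ _) (solve 1 (λ x → :- (:- x) := x) refl x)) (≤⇒0≤- h)

  ≤-⇒+≤ : ∀ {x y z} → z ≤ y - x → x + z ≤ y
  ≤-⇒+≤ {x} {y} {z} h = ≤-respˡ (+-comm z x)
    (≤-respʳ (solve 2 (λ x y → y :- x :+ x := y) refl x y) (+-mono-≤ h ≤-refl))

  *-mono-≤ : ∀ {a b x y} → 0# ≤ a → 0# ≤ x → a ≤ b → x ≤ y → a * x ≤ b * y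
  *-mono-≤ 0≤a 0≤x a≤b x≤y = ≤-trans (*-monoʳ-≤ 0≤x a≤b) (*-monoˡ-≤ (≤-trans 0≤a a≤b) x≤y)

  0≤neg⇒≤0 : ∀ {x} → 0# ≤ - x → x ≤ 0#
  0≤neg⇒≤0 {x} h = 0≤-⇒≤ (≤-respʳ (sym (+-identityˡ (- x))) h)

  x-y≈0⇒x≈y : ∀ {x y} → x - y ≈ 0# → x ≈ y
  x-y≈0⇒x≈y {x} {y} h = trans (solve 2 (λ x y → x := x :- y :+ y) refl x y)
    (trans (+-congʳ h) (+-identityˡ y))

  x-y+y≈x : ∀ x y → x - y + y ≈ x
  x-y+y≈x = solve 2 (λ x y → x :- y :+ y := x) refl

  ι-- : ∀ p q → ι (p ℚ.- q) ≈ ι p - ι q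
  ι-- p q = trans (ι-+ p (ℚ.- q)) (+-congˡ (ι-neg q))

  ι-nonNeg : ∀ {p} → 0ℚ ℚ.≤ p → 0# ≤ ι p
  ι-nonNeg h = ≤-respˡ ι-0 (ι-mono h)

  -- Instead of the real `d`, its positive rational lower bound `c` is inverted: if `0 ≤ x`, then
  -- `x c ≤ x d ≤ 0`. Stability of the order permits this case distinction on the sign of `x`.
  *-cancel-≤0 : ∀ {c d x} → 0ℚ ℚ.< c → ι c ≤ d → x * d ≤ 0# → x ≤ 0#
  *-cancel-≤0 {c} {d} {x} 0<c c≤d xd≤0 = ≤-stable λ x≰0 → ≤-total x 0# Sum.[ x≰0 , x≰0 ∘ cancel ]
    where
    inverse = divide c 1ℚ 0<c (ℚ.positive⁻¹ 1ℚ)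
    1/c : ℚ
    1/c = proj₁ inverse
    0≤1/c : 0ℚ ℚ.≤ 1/c
    0≤1/c = ℚ.<⇒≤ (proj₁ (proj₂ inverse))
    cancel : 0# ≤ x → x ≤ 0#
    cancel 0≤x = ≤-respˡ x*c*1/c (≤-respʳ (zeroˡ (ι 1/c))
      (*-monoʳ-≤ (ι-nonNeg 0≤1/c) (≤-trans (*-monoˡ-≤ 0≤x c≤d) xd≤0)))
      where
      x*c*1/c : (x * ι c) * ι 1/c ≈ x
      x*c*1/c = trans (*-assoc x (ι c) (ι 1/c)) (trans (*-congˡ
        (trans (sym (ι-* c 1/c)) (trans (reflexive (≡.cong ι (proj₂ (proj₂ inverse)))) ι-1)))
        (*-identityʳ x))

  *-cancel-0≤ : ∀ {c d x} → 0ℚ ℚ.< c → ι c ≤ d → 0# ≤ x * d → 0# ≤ x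
  *-cancel-0≤ {c} {d} {x} 0<c c≤d h = neg≤0⇒0≤ (*-cancel-≤0 0<c c≤d
    (≤-respˡ (solve 2 (λ x d → :- (x :* d) := (:- x) :* d) refl x d)
      (≤-respʳ (trans (sym (+-identityˡ _)) (-‿inverseʳ 0#)) (neg-anti-≤ h))))

  0≤1 : 0# ≤ 1#
  0≤1 = ≤-respʳ ι-1 (ι-nonNeg (ℚ.nonNegative⁻¹ 1ℚ))

  sum-cong : ∀ {n} {f g : Fin n → Carrier} → (∀ i → f i ≈ g i) → sum f ≈ sum g
  sum-cong h = sum-cong-≋ h

  sum-mono : ∀ {n} {f g : Fin n → Carrier} → (∀ i → f i ≤ g i) → sum f ≤ sum g
  sum-mono {zero}  h = ≤-refl
  sum-mono {suc n} h = +-mono-≤ (h zero) (sum-mono (h ∘ suc))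

  fromℕ : ℕ → Carrier
  fromℕ n = ι (+ n ℚ./ 1)

  fromℕ-suc : ∀ n → fromℕ (suc n) ≈ 1# + fromℕ n
  fromℕ-suc n = trans (reflexive (≡.cong ι (suc/1 n))) (trans (ι-+ 1ℚ (+ n ℚ./ 1)) (+-congʳ ι-1))

  fromℕ-+ : ∀ m n → fromℕ (m ℕ.+ n) ≈ fromℕ m + fromℕ n
  fromℕ-+ zero n = trans (sym (+-identityˡ _)) (+-congʳ (sym ι-0))
  fromℕ-+ (suc m) n = trans (fromℕ-suc (m ℕ.+ n)) (trans (+-congˡ (fromℕ-+ m n))
    (trans (sym (+-assoc _ _ _)) (+-congʳ (sym (fromℕ-suc m)))))

  fromℕ-nonNeg : ∀ n → 0# ≤ fromℕ n
  fromℕ-nonNeg zero    = ≤-reflexive (sym ι-0)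
  fromℕ-nonNeg (suc n) = ≤-respʳ (sym (fromℕ-suc n)) (+-nonNeg 0≤1 (fromℕ-nonNeg n))

  fromℕ-mono : ∀ {m n} → m ℕ.≤ n → fromℕ m ≤ fromℕ n
  fromℕ-mono {m} {n} m≤n with ℕ.m≤n⇒∃[o]m+o≡n m≤n
  ... | o , ≡.refl = ≤-respˡ (+-identityʳ _) (≤-respʳ (sym (fromℕ-+ m o))
    (+-mono-≤ ≤-refl (fromℕ-nonNeg o)))

  sum-const : ∀ n c → sum {n} (λ _ → c) ≈ fromℕ n * c
  sum-const zero    c = trans (sym (zeroˡ c)) (*-congʳ (sym ι-0))
  sum-const (suc n) c = trans (+-cong (sym (*-identityˡ c)) (sum-const n c))
    (trans (sym (distribʳ c 1# (fromℕ n))) (*-congʳ (sym (fromℕ-suc n))))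

  sum-affine : ∀ {n} a b c (f g : Fin n → Carrier) →
    sum (λ i → a * f i + b * g i + c) ≈ a * sum f + b * sum g + fromℕ n * c
  sum-affine {n} a b c f g = trans (∑-distrib-+ (λ i → a * f i + b * g i) (λ _ → c))
    (+-cong (trans (∑-distrib-+ (λ i → a * f i) (λ i → b * g i))
      (+-cong (sym (*-distribˡ-sum a f)) (sym (*-distribˡ-sum b g)))) (sum-const n c))

  indicator : Bool → Carrier
  indicator b = if b then 1# else 0#

  indicator-nonNeg : ∀ b → 0# ≤ indicator b
  indicator-nonNeg true  = 0≤1
  indicator-nonNeg false = ≤-refl

  sum-zero : ∀ {n} {f : Fin n → Carrier} → (∀ i → f i ≈ 0#) → sum f ≈ 0#
  sum-zero {n} h = trans (sum-cong h) (sum-replicate-zero n)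

  sum-single : ∀ {n} {f : Fin n → Carrier} i → (∀ j → j ≡.≢ i → f j ≈ 0#) → sum f ≈ f i
  sum-single {f = f} zero h = trans
    (+-congˡ (sum-zero λ j → h (suc j) λ ())) (+-identityʳ _)
  sum-single {f = f} (suc i) h = trans
    (+-cong (h zero λ ()) (sum-single i λ j j≢i → h (suc j) (j≢i ∘ Fin.suc-injective)))
    (+-identityˡ _)

  ¬¬-argmax : ∀ {n} (f : Fin (suc n) → Carrier) → ¬ ¬ (∃[ v ] (∀ i → f i ≤ f v))
  ¬¬-argmax {zero} f ¬h = ¬h (zero , λ { zero → ≤-refl })
  ¬¬-argmax {suc n} f ¬h = ¬¬-argmax (f ∘ suc) λ (v , max) → ≤-total (f zero) (f (suc v)) λ where
    (inj₁ le) → ¬h (suc v , λ { zero → le ; (suc i) → max i })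
    (inj₂ ge) → ¬h (zero , λ { zero → ≤-refl ; (suc i) → ≤-trans (max i) ge })

-- The upper bound for the quadratic form.

module QuadraticForm (R : RealRing) where
  open Ordered R
  open import Relation.Binary.Reasoning.Setoid setoid

  -- The hub row of the eigenvalue equation of Cᶜ, with τ = 2k and denominators
  -- cleared; e is r - 1 - α, or 1 if k = 0.
  RootEquation : (α r e n τ : Carrier) → Set
  RootEquation α r e n τ = e * (r - α) * r ≈
    (n - 1#) * (e * (r - α) * α) + (1# - α) * (1# - α) * ((n - 1# - τ) * e + τ * (r - α))

  sum₂ : ∀ {n} → (Fin n → Fin n → Carrier) → Carrier
  sum₂ F = sum λ i → sum (F i)

  sum₂-cong : ∀ {n} {F G : Fin n → Fin n → Carrier} → (∀ i j → F i j ≈ G i j) → sum₂ F ≈ sum₂ G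
  sum₂-cong h = sum-cong λ i → sum-cong (h i)

  sum₂-mono : ∀ {n} {F G : Fin n → Fin n → Carrier} → (∀ i j → F i j ≤ G i j) → sum₂ F ≤ sum₂ G
  sum₂-mono h = sum-mono λ i → sum-mono (h i)

  sum₂-+ : ∀ {n} (F G : Fin n → Fin n → Carrier) → sum₂ (λ i j → F i j + G i j) ≈ sum₂ F + sum₂ G
  sum₂-+ F G = trans (sum-cong λ i → ∑-distrib-+ (F i) (G i))
    (∑-distrib-+ (λ i → sum (F i)) (λ i → sum (G i)))

  sum₂-row : ∀ {n} (F : Fin n → Fin n → Carrier) {s : Fin n → Carrier} (g : Fin n → Carrier) →
    (∀ i → sum (F i) ≈ s i) → sum₂ (λ i j → F i j * g i) ≈ sum (λ i → s i * g i)
  sum₂-row F g h = sum-cong λ i → trans (sym (*-distribʳ-sum (g i) (F i))) (*-congʳ (h i))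

  -- `P` marks the parent of each vertex, `N` the matching edges, `d` the root `v` and `t` the
  -- matched vertices, so that the adjacency matrix will be `P + Pᵀ + N`. The estimate sees the
  -- graph through these weights only.
  module _ {n : ℕ} (α r e τ : Carrier)
    (0≤α : 0# ≤ α) (0≤β : 0# ≤ 1# - α) (0≤e : 0# ≤ e) (0≤r-α : 0# ≤ r - α)
    (root : RootEquation α r e (fromℕ n) τ)
    (P N : Fin n → Fin n → Carrier) (d t x : Fin n → Carrier) (v : Fin n)
    (0≤P : ∀ i j → 0# ≤ P i j) (0≤N : ∀ i j → 0# ≤ N i j)
    (N-sym : ∀ i j → N i j ≈ N j i)
    (P-row : ∀ i → sum (P i) ≈ 1# - d i) (N-row : ∀ i → sum (N i) ≈ t i)
    (d-sum : ∀ (g : Fin n → Carrier) → sum (λ i → d i * g i) ≈ g v)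
    (t-v : t v ≈ 0#) (t-sum : sum t ≈ τ)
    (t-cases : ∀ i → t i ≈ 0# ⊎ (t i ≈ 1# × e ≈ r - 1# - α))
    (x-max : ∀ i → x i * x i ≤ x v * x v)
    where

    private
      D β M : Carrier
      D = e * (r - α)
      β = 1# - α
      M = x v * x v
      0≤D : 0# ≤ D
      0≤D = *-nonNeg 0≤e 0≤r-α
      f : Fin n → Fin n → Carrier
      f i j = x i * (α * x i + β * x j)
      -- `c₀` and `c₀ + c₁` are `D` times the coefficient of the parent's square, `α + β²/(r-α)`
      -- below an unmatched parent edge and `α + β²/(r-1-α)` for a matched child. Being affine in
      -- `t i`, one formula serves both.
      c₀ c₁ : Carrier
      c₀ = D * α + β * β * e
      c₁ = β * β * (r - α - e)
      -- `D` times the bound for the edge from `i` to its parent. The `t i` subtracted from `r` is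
      -- the share that the matching edge at `i` will claim.
      g : Fin n → Carrier
      g i = D * (r - t i) * (x i * x i) + (c₀ + c₁ * t i) * M

    private
      0≤c₀ : 0# ≤ c₀
      0≤c₀ = +-nonNeg (*-nonNeg 0≤D 0≤α) (*-nonNeg (*-nonNeg 0≤β 0≤β) 0≤e)

      -- The solver cannot use a case hypothesis such as `t i ≈ 0`; the identity is solved with an
      -- extra summand `y` that the hypothesis makes vanish.
      +-null : ∀ {x y z} → y ≈ 0# → x + y ≈ z → x ≈ z
      +-null {x} y≈0 h = trans (sym (trans (+-congˡ y≈0) (+-identityʳ x))) h

      -- The slack is a square plus a nonnegative multiple of `M - x j * x j`. The square vanishes
      -- when `x i` and `x j` are in the ratio of leaf to hub, or of rim to hub if `i` is matched,
      -- in the eigenvector of `Cᶜ`.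
      tree-bound : ∀ i j → D * (f i j + f j i) ≤ g i
      tree-bound i j with t-cases i
      ... | inj₁ t≈0 = 0≤-⇒≤ (≤-respʳ
          (+-null (trans (*-congʳ t≈0) (zeroˡ _))
            (solve 8 (λ e r α β t x y M →
              let D = e :* (r :- α) ; u = (r :- α) :* x :- β :* y
                  c₀ = D :* α :+ β :* β :* e ; c₁ = β :* β :* (r :- α :- e)
              in e :* (u :* u) :+ c₀ :* (M :- y :* y) :+ t :* (c₁ :* M :- D :* (x :* x)) :=
                 (D :* (r :- t) :* (x :* x) :+ (c₀ :+ c₁ :* t) :* M)
                   :- D :* (x :* (α :* x :+ β :* y) :+ y :* (α :* y :+ β :* x)))
              refl e r α β (t i) (x i) (x j) M))
          (+-nonNeg (*-nonNeg 0≤e (square-nonNeg ((r - α) * x i - β * x j)))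
            (*-nonNeg 0≤c₀ (≤⇒0≤- (x-max j)))))
      ... | inj₂ (t≈1 , e≈) = 0≤-⇒≤ (≤-respʳ
          (+-null slack
            (solve 8 (λ e r α β t x y M →
              let D = e :* (r :- α) ; u = e :* x :- β :* y
                  c₀ = D :* α :+ β :* β :* e ; c₁ = β :* β :* (r :- α :- e)
              in (r :- α) :* (u :* u) :+ (D :* α :+ β :* β :* (r :- α)) :* (M :- y :* y)
                   :+ (D :* (r :- t :- α :- e) :* (x :* x) :+ c₁ :* (t :* M :- M)) :=
                 (D :* (r :- t) :* (x :* x) :+ (c₀ :+ c₁ :* t) :* M)
                   :- D :* (x :* (α :* x :+ β :* y) :+ y :* (α :* y :+ β :* x)))
              refl e r α β (t i) (x i) (x j) M))
          (+-nonNeg (*-nonNeg 0≤r-α (square-nonNeg (e * x i - β * x j)))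
            (*-nonNeg (+-nonNeg (*-nonNeg 0≤D 0≤α) (*-nonNeg (*-nonNeg 0≤β 0≤β) 0≤r-α))
              (≤⇒0≤- (x-max j)))))
        where
        slack : D * (r - t i - α - e) * (x i * x i) + c₁ * (t i * M - M) ≈ 0#
        slack = trans (+-cong
          (trans (*-congʳ (trans (*-congˡ (trans (+-cong (+-congʳ (+-congˡ (-‿cong t≈1))) (-‿cong e≈))
            (-‿inverseʳ (r - 1# - α)))) (zeroʳ D))) (zeroˡ _))
          (trans (*-congˡ (trans (+-congʳ (trans (*-congʳ t≈1) (*-identityˡ M))) (-‿inverseʳ M)))
            (zeroʳ c₁)))
          (+-identityˡ 0#)

      -- Each vertex except `v` has exactly one parent edge, so `g` is summed over all vertices but
      -- `v`.
      tree-sum : sum₂ (λ i j → P i j * (D * (f i j + f j i))) ≤ sum g - g v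
      tree-sum = ≤-respʳ (begin
        sum₂ (λ i j → P i j * g i)                  ≈⟨ sum₂-row P g P-row ⟩
        sum (λ i → (1# - d i) * g i)                ≈⟨ sum-cong (λ i → trans
          (distribʳ (g i) 1# (- d i)) (+-cong (*-identityˡ (g i))
            (solve 2 (λ d g → (:- d) :* g := (:- con 1ℚ) :* (d :* g)) refl (d i) (g i)))) ⟩
        sum (λ i → g i + (- ι 1ℚ) * (d i * g i))    ≈⟨ ∑-distrib-+ g (λ i → (- ι 1ℚ) * (d i * g i)) ⟩
        sum g + sum (λ i → (- ι 1ℚ) * (d i * g i))  ≈⟨ +-congˡ (sym (*-distribˡ-sum (- ι 1ℚ) (λ i → d i * g i))) ⟩
        sum g + (- ι 1ℚ) * sum (λ i → d i * g i)    ≈⟨ +-congˡ (*-congˡ (d-sum g)) ⟩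
        sum g + (- ι 1ℚ) * g v                      ≈⟨ solve 2 (λ a b → a :+ (:- con 1ℚ) :* b := a :- b) refl (sum g) (g v) ⟩
        sum g - g v                                 ∎)
        (sum₂-mono λ i j → *-monoˡ-≤ (0≤P i j) (tree-bound i j))

      -- Each matching edge is shared equally by its two ends.
      matching-sum : sum₂ (λ i j → N i j * (D * f i j)) ≤ sum (λ i → t i * (D * (x i * x i)))
      matching-sum = ≤-respʳ (begin
        sum₂ (λ i j → N i j * h₁ i + N i j * h₂ j)                   ≈⟨ sum₂-+ (λ i j → N i j * h₁ i) (λ i j → N i j * h₂ j) ⟩
        sum₂ (λ i j → N i j * h₁ i) + sum₂ (λ i j → N i j * h₂ j)    ≈⟨ +-congˡ (trans (∑-comm (λ i j → N i j * h₂ j)) (sum₂-cong λ i j → *-congʳ (N-sym j i))) ⟩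
        sum₂ (λ i j → N i j * h₁ i) + sum₂ (λ i j → N i j * h₂ i)    ≈⟨ sym (sum₂-+ (λ i j → N i j * h₁ i) (λ i j → N i j * h₂ i)) ⟩
        sum₂ (λ i j → N i j * h₁ i + N i j * h₂ i)                   ≈⟨ sum₂-cong (λ i j → trans (sym (distribˡ (N i j) (h₁ i) (h₂ i))) (*-congˡ (h-total i))) ⟩
        sum₂ (λ i j → N i j * (D * (x i * x i)))                     ≈⟨ sum₂-row N (λ i → D * (x i * x i)) N-row ⟩
        sum (λ i → t i * (D * (x i * x i)))                          ∎)
        (sum₂-mono edge)
        where
        h₁ h₂ : Fin n → Carrier
        h₁ i = D * ((α + ι ½ * β) * (x i * x i))
        h₂ i = D * (ι ½ * β * (x i * x i))
        h-total : ∀ i → h₁ i + h₂ i ≈ D * (x i * x i)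
        h-total i = trans
          (solve 4 (λ D α β q → D :* ((α :+ con ½ :* β) :* q) :+ D :* (con ½ :* β :* q)
            := D :* ((α :+ β) :* q)) refl D α β (x i * x i))
          (*-congˡ (trans (*-congʳ (solve 2 (λ α o → α :+ (o :- α) := o) refl α 1#)) (*-identityˡ _)))
        edge : ∀ i j → N i j * (D * f i j) ≤ N i j * h₁ i + N i j * h₂ j
        edge i j = 0≤-⇒≤ (≤-respʳ
          (solve 6 (λ w D α β x y →
            w :* (D :* (con ½ :* β :* ((x :- y) :* (x :- y)))) :=
            (w :* (D :* ((α :+ con ½ :* β) :* (x :* x))) :+ w :* (D :* (con ½ :* β :* (y :* y))))
              :- w :* (D :* (x :* (α :* x :+ β :* y)))) refl (N i j) D α β (x i) (x j))
          (*-nonNeg (0≤N i j) (*-nonNeg 0≤D (*-nonNeg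
            (*-nonNeg (ι-nonNeg (ℚ.nonNegative⁻¹ ½)) 0≤β) (square-nonNeg (x i - x j))))))

      S : Carrier
      S = sum (λ i → x i * x i)

      -- The squares add up to `D r S`. The remaining multiple of `M` is `(n-1) c₀ + c₁ τ - D r`,
      -- the last term because `v` has no parent edge, and `root` says that it is zero.
      total : (sum g - g v) + sum (λ i → t i * (D * (x i * x i))) ≈ D * r * S
      total = begin
        (sum g - g v) + sum (λ i → t i * (D * (x i * x i)))
          ≈⟨ solve 3 (λ a b c → (a :- b) :+ c := (a :+ c) :- b) refl (sum g) (g v) _ ⟩
        (sum g + sum (λ i → t i * (D * (x i * x i)))) - g v
          ≈⟨ +-congʳ (sym (∑-distrib-+ g (λ i → t i * (D * (x i * x i))))) ⟩
        sum (λ i → g i + t i * (D * (x i * x i))) - g v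
          ≈⟨ +-congʳ (sum-cong λ i → solve 7 (λ D r t q c₀ c₁ M →
              (D :* (r :- t) :* q :+ (c₀ :+ c₁ :* t) :* M) :+ t :* (D :* q) :=
              D :* r :* q :+ c₁ :* M :* t :+ c₀ :* M) refl D r (t i) (x i * x i) c₀ c₁ M) ⟩
        sum (λ i → D * r * (x i * x i) + c₁ * M * t i + c₀ * M) - g v
          ≈⟨ +-congʳ (sum-affine (D * r) (c₁ * M) (c₀ * M) (λ i → x i * x i) t) ⟩
        (D * r * S + c₁ * M * sum t + fromℕ n * (c₀ * M)) - g v
          ≈⟨ +-cong (+-congʳ (+-congˡ (*-congˡ t-sum))) (-‿cong g-v) ⟩
        (D * r * S + c₁ * M * τ + fromℕ n * (c₀ * M)) - (D * r * M + c₀ * M)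
          ≈⟨ solve 8 (λ D r c₁ M τ n c₀ S →
              (D :* r :* S :+ c₁ :* M :* τ :+ n :* (c₀ :* M)) :- (D :* r :* M :+ c₀ :* M) :=
              D :* r :* S :+ M :* ((n :- con 1ℚ) :* c₀ :+ c₁ :* τ :- D :* r)) refl D r c₁ M τ (fromℕ n) c₀ S ⟩
        D * r * S + M * ((fromℕ n - ι 1ℚ) * c₀ + c₁ * τ - D * r)
          ≈⟨ +-congˡ (trans (*-congˡ balance) (zeroʳ M)) ⟩
        D * r * S + 0#
          ≈⟨ +-identityʳ _ ⟩
        D * r * S ∎
        where
        g-v : g v ≈ D * r * M + c₀ * M
        g-v = trans (solve 6 (λ D r t c₀ c₁ M →
          D :* (r :- t) :* M :+ (c₀ :+ c₁ :* t) :* M :=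
          (D :* r :* M :+ c₀ :* M) :+ t :* (c₁ :* M :- D :* M)) refl D r (t v) c₀ c₁ M)
          (trans (+-congˡ (trans (*-congʳ t-v) (zeroˡ _))) (+-identityʳ _))
        balance : (fromℕ n - ι 1ℚ) * c₀ + c₁ * τ - D * r ≈ 0#
        balance = trans (+-cong (+-congʳ (*-congʳ (+-congˡ (-‿cong ι-1)))) (-‿cong root))
          (trans (+-congʳ (solve 7 (λ n-1 e r α b τ D →
            n-1 :* (D :* α :+ b :* e) :+ (b :* (r :- α :- e)) :* τ :=
            n-1 :* (D :* α) :+ b :* ((n-1 :- τ) :* e :+ τ :* (r :- α))) refl
            (fromℕ n - 1#) e r α (β * β) τ D)) (-‿inverseʳ _))

    quadratic-form-bound :
      D * sum₂ (λ i j → (P i j + P j i + N i j) * f i j) ≤ D * r * S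
    quadratic-form-bound = ≤-respˡ (sym split) (≤-respʳ total (+-mono-≤ tree-sum matching-sum))
      where
      -- Exchanging the two sums moves the transposed weight `P j i` onto `f j i`, so both
      -- directions of a tree edge meet in one term.
      split : D * sum₂ (λ i j → (P i j + P j i + N i j) * f i j) ≈
        sum₂ (λ i j → P i j * (D * (f i j + f j i))) + sum₂ (λ i j → N i j * (D * f i j))
      split = begin
        D * sum₂ (λ i j → (P i j + P j i + N i j) * f i j)
          ≈⟨ trans (*-distribˡ-sum D (λ i → sum (λ j → (P i j + P j i + N i j) * f i j))) (sum-cong λ i → *-distribˡ-sum D (λ j → (P i j + P j i + N i j) * f i j)) ⟩
        sum₂ (λ i j → D * ((P i j + P j i + N i j) * f i j))
          ≈⟨ sum₂-cong (λ i j → solve 5 (λ D p q w f →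
              D :* ((p :+ q :+ w) :* f) := (p :* (D :* f) :+ q :* (D :* f)) :+ w :* (D :* f))
              refl D (P i j) (P j i) (N i j) (f i j)) ⟩
        sum₂ (λ i j → (P i j * (D * f i j) + P j i * (D * f i j)) + N i j * (D * f i j))
          ≈⟨ sum₂-+ (λ i j → P i j * (D * f i j) + P j i * (D * f i j)) (λ i j → N i j * (D * f i j)) ⟩
        sum₂ (λ i j → P i j * (D * f i j) + P j i * (D * f i j)) + W
          ≈⟨ +-congʳ (sum₂-+ (λ i j → P i j * (D * f i j)) (λ i j → P j i * (D * f i j))) ⟩
        (sum₂ (λ i j → P i j * (D * f i j)) + sum₂ (λ i j → P j i * (D * f i j))) + W
          ≈⟨ +-congʳ (+-congˡ (∑-comm (λ i j → P j i * (D * f i j)))) ⟩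
        (sum₂ (λ i j → P i j * (D * f i j)) + sum₂ (λ i j → P i j * (D * f j i))) + W
          ≈⟨ +-congʳ (sym (sum₂-+ (λ i j → P i j * (D * f i j)) (λ i j → P i j * (D * f j i)))) ⟩
        sum₂ (λ i j → P i j * (D * f i j) + P i j * (D * f j i)) + W
          ≈⟨ +-congʳ (sum₂-cong λ i j → solve 4 (λ p D a b → p :* (D :* a) :+ p :* (D :* b)
               := p :* (D :* (a :+ b))) refl (P i j) D (f i j) (f j i)) ⟩
        sum₂ (λ i j → P i j * (D * (f i j + f j i))) + W ∎
        where
        W = sum₂ (λ i j → N i j * (D * f i j))

-- A constructive intermediate value theorem.

module SignChange (R : RealRing) where
  open RationalLemmas using (divide; <⇒0<)
  open NestedIntervals
  open Ordered R

  -- A one-sided Lipschitz bound passes to the limit: `r` lies between the ends `l` and `u` of every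
  -- bracket, hence `f r ≤ f l + L (r - l)` and `f r ≥ f u - L (u - r)`, and both errors are at most
  -- `L` times the width.
  root : ∀ (f : Carrier → Carrier) (a b : ℚ) L → a ℚ.< b → 0# ≤ L →
    f (ι a) ≤ 0# → 0# ≤ f (ι b) →
    (∀ {p q} → a ℚ.≤ p → p ℚ.< q → q ℚ.≤ b → f (ι p) ≤ 0# ⊎ 0# ≤ f (ι q)) →
    (∀ {x y} → ι a ≤ x → x ≤ y → y ≤ ι b → f y - f x ≤ L * (y - x)) →
    ∃[ r ] (ι a ≤ r × r ≤ ι b × f r ≈ 0#)
  root f a b L a<b 0≤L fa≤0 0≤fb decide lipschitz =
    r , proj₁ (r-in 0) , proj₂ (r-in 0) , ≤-antisym fr≤0 0≤fr
    where
    -- The range condition travels with the sign, so that all brackets stay inside `[a, b]`, where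
    -- `decide` and `lipschitz` apply.
    lo hi : ℚ → Set
    lo p = a ℚ.≤ p × f (ι p) ≤ 0#
    hi q = q ℚ.≤ b × 0# ≤ f (ι q)
    open Bracket
    open Trisection lo hi
      (λ B l≤p p<q q≤u → Sum.map
        (ℚ.≤-trans (proj₁ (left-lo B)) l≤p ,_)
        (ℚ.≤-trans q≤u (proj₁ (right-hi B)) ,_)
        (decide (ℚ.≤-trans (proj₁ (left-lo B)) l≤p) p<q (ℚ.≤-trans q≤u (proj₁ (right-hi B)))))
      (bracket a b a<b (ℚ.≤-refl , fa≤0) (ℚ.≤-refl , 0≤fb))

    limit : ∃[ r ] (∀ n → ι (left (iterate n)) ≤ r × r ≤ ι (right (iterate n)))
    limit = nested (left ∘ iterate) (right ∘ iterate) left-iterate right-iterate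
      (λ n → ℚ.<⇒≤ (left<right (iterate n))) width-shrinks

    r : Carrier
    r = proj₁ limit
    r-in : ∀ n → ι (left (iterate n)) ≤ r × r ≤ ι (right (iterate n))
    r-in = proj₂ limit

    vanish : ∀ {x} → (∀ n → x ≤ L * ι (width (iterate n))) → x ≤ 0#
    vanish {x} h = archimedean λ δ 0<δ →
      let K , 0<K , L≤K = bounded L
          η , 0<η , Kη≡δ = divide K δ 0<K 0<δ
          n , small = width-shrinks η 0<η
          w = width (iterate n)
          0≤w = ℚ.<⇒≤ (<⇒0< (left<right (iterate n)))
      in ≤-trans (h n) (≤-trans (*-monoʳ-≤ (ι-nonNeg 0≤w) L≤K)
           (≤-respˡ (ι-* K w) (≤-trans
             (ι-mono (ℚ.*-monoˡ-≤-nonNeg K {{ℚ.nonNegative (ℚ.<⇒≤ 0<K)}} (ℚ.<⇒≤ small)))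
             (≤-reflexive (reflexive (≡.cong ι Kη≡δ))))))

    fr≤0 : f r ≤ 0#
    fr≤0 = vanish λ n →
      let l≤r , r≤u = r-in n
          a≤l , fl≤0 = left-lo (iterate n)
          b≥u , _ = right-hi (iterate n)
          l = left (iterate n) ; u = right (iterate n)
      in ≤-trans
        (≤-respʳ (+-identityʳ _) (≤-respˡ (x-y+y≈x (f r) (f (ι l)))
          (+-mono-≤ (lipschitz (ι-mono a≤l) l≤r (≤-trans r≤u (ι-mono b≥u))) fl≤0)))
        (*-monoˡ-≤ 0≤L (≤-respʳ (sym (ι-- u l)) (+-mono-≤ r≤u ≤-refl)))

    0≤fr : 0# ≤ f r
    0≤fr = neg≤0⇒0≤ (vanish λ n →
      let l≤r , r≤u = r-in n
          a≤l , _ = left-lo (iterate n)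
          b≥u , 0≤fu = right-hi (iterate n)
          l = left (iterate n) ; u = right (iterate n)
      in ≤-trans
        (≤-trans (≤-respˡ (+-identityˡ _) (+-mono-≤ 0≤fu ≤-refl))
          (lipschitz (≤-trans (ι-mono a≤l) l≤r) r≤u (ι-mono b≥u)))
        (*-monoˡ-≤ 0≤L (≤-respʳ (sym (ι-- u l)) (+-mono-≤ ≤-refl (neg-anti-≤ l≤r)))))

-- Existence of the root `r` of the equation of `Cᶜ`.

module SecularRoot (R : RealRing) where
  open RationalLemmas using (0<*; <⇒0<)
  open NestedIntervals using (2ℚ; /1-mono-<)
  open Ordered R
  open QuadraticForm R using (RootEquation)
  open SignChange R using (root)

  -- e(x) is x - 1 - α if k ≥ 1, and 1 if k = 0, when there is no rim and the
  -- factor x - 1 - α could vanish at the root.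
  module Secular (α e₀ κ n τ : Carrier) where
    e D f : Carrier → Carrier
    e x = e₀ + κ * x
    D x = e x * (x - α)
    f x = D x * x - ((n - ι 1ℚ) * (D x * α) +
      (ι 1ℚ - α) * (ι 1ℚ - α) * ((n - ι 1ℚ - τ) * e x + τ * (x - α)))

    -- `f` is written with `ι 1ℚ` for the solver; here it is traded for `1#`.
    rootEquation : ∀ {r} → f r ≈ 0# → RootEquation α r (e r) n τ
    rootEquation fr≈0 = trans (x-y≈0⇒x≈y fr≈0) (+-cong (*-congʳ n-1≈)
      (*-cong (*-cong (+-congʳ ι-1) (+-congʳ ι-1)) (+-congʳ (*-congʳ (+-congʳ n-1≈)))))
      where
      n-1≈ : n - ι 1ℚ ≈ n - 1#
      n-1≈ = +-congˡ (-‿cong ι-1)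

    -- The bound `c` keeps both factors of `D` away from zero to the right of `a`, so `D` can be
    -- cancelled there.
    module _ {a b c : ℚ} (a<b : a ℚ.< b) (0<c : 0ℚ ℚ.< c)
      (0≤α : 0# ≤ α) (0≤κ : 0# ≤ κ) (0≤b : 0ℚ ℚ.≤ b)
      (0≤N : 0# ≤ n - ι 1ℚ) (0≤p : 0# ≤ n - ι 1ℚ - τ) (0≤τ : 0# ≤ τ)
      (c≤e : ∀ {x} → ι a ≤ x → ι c ≤ e x) (c≤x-α : ∀ {x} → ι a ≤ x → ι c ≤ x - α)
      (fa≤0 : f (ι a) ≤ 0#) (0≤fb : 0# ≤ f (ι b)) where

      private
        N p B b² L : Carrier
        N = n - ι 1ℚ
        p = n - ι 1ℚ - τ
        B = ι b
        b² = (ι 1ℚ - α) * (ι 1ℚ - α)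
        L = (κ * B + e B) * B + e B * B

        0≤c : 0# ≤ ι c
        0≤c = ι-nonNeg (ℚ.<⇒≤ 0<c)

        0≤e : ∀ {x} → ι a ≤ x → 0# ≤ e x
        0≤e a≤x = ≤-trans 0≤c (c≤e a≤x)

        0≤x-α : ∀ {x} → ι a ≤ x → 0# ≤ x - α
        0≤x-α a≤x = ≤-trans 0≤c (c≤x-α a≤x)

        c²≤D : ∀ {x} → ι a ≤ x → ι (c ℚ.* c) ≤ D x
        c²≤D a≤x = ≤-respˡ (sym (ι-* c c)) (*-mono-≤ 0≤c 0≤c (c≤e a≤x) (c≤x-α a≤x))

        0<c² : 0ℚ ℚ.< c ℚ.* c
        0<c² = 0<* 0<c 0<c

        0≤b² : 0# ≤ b²
        0≤b² = square-nonNeg (ι 1ℚ - α)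

        e-step : ∀ x y → e y ≈ e x + κ * (y - x)
        e-step x y = solve 4 (λ e₀ κ x y → e₀ :+ κ :* y := (e₀ :+ κ :* x) :+ κ :* (y :- x)) refl e₀ κ x y

        -- f itself need not be monotone, but f / D is: this determines the sign
        -- of f at one of any two points.
        cross : ∀ x y → f y * D x - f x * D y ≈
          (y - x) * (D x * D y) + b² * (p * (e x * e y) * (y - x) + τ * ((x - α) * (y - α)) * (κ * (y - x)))
        cross x y = trans (solve 9 (λ ex ey x y α b p τ N →
          let Dx = ex :* (x :- α) ; Dy = ey :* (y :- α) in
          (Dy :* y :- (N :* (Dy :* α) :+ b :* (p :* ey :+ τ :* (y :- α)))) :* Dx
            :- (Dx :* x :- (N :* (Dx :* α) :+ b :* (p :* ex :+ τ :* (x :- α)))) :* Dy :=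
          (y :- x) :* (Dx :* Dy) :+ b :* (p :* (ex :* ey) :* (y :- x) :+ τ :* ((x :- α) :* (y :- α)) :* (ey :- ex)))
          refl (e x) (e y) x y α b² p τ N)
          (+-congˡ (*-congˡ (+-congˡ (*-congˡ (trans (+-congʳ (e-step x y))
            (solve 2 (λ a b → (a :+ b) :- a := b) refl (e x) (κ * (y - x))))))))

        -- By `cross`, `f s * D q` exceeds `f q * D s` by at least `(s - q) c⁴`, a positive
        -- rational. So `separated` settles the sign of one of the two products, and the positive
        -- factor `D` is cancelled.
        decide : ∀ {q s} → a ℚ.≤ q → q ℚ.< s → s ℚ.≤ b → f (ι q) ≤ 0# ⊎ 0# ≤ f (ι s)
        decide {q} {s} a≤q q<s s≤b = Sum.map (*-cancel-≤0 0<c² (c²≤D ιa≤s)) (*-cancel-0≤ 0<c² (c²≤D ιa≤q))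
          (separated 0<δ gap)
          where
          ιa≤q = ι-mono a≤q
          ιa≤s = ι-mono (ℚ.≤-trans a≤q (ℚ.<⇒≤ q<s))
          δ : ℚ
          δ = (s ℚ.- q) ℚ.* ((c ℚ.* c) ℚ.* (c ℚ.* c))
          0<δ : 0ℚ ℚ.< δ
          0<δ = 0<* (<⇒0< q<s) (0<* 0<c² 0<c²)
          0≤s-q : 0# ≤ ι s - ι q
          0≤s-q = ≤⇒0≤- (ι-mono (ℚ.<⇒≤ q<s))
          0≤c² : 0# ≤ ι (c ℚ.* c)
          0≤c² = ι-nonNeg (ℚ.<⇒≤ 0<c²)
          δ≤ : ι δ ≤ (ι s - ι q) * (D (ι q) * D (ι s))
          δ≤ = ≤-respˡ (sym (trans (ι-* _ _) (*-cong (ι-- s q) (ι-* _ _))))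
            (*-monoˡ-≤ 0≤s-q (*-mono-≤ 0≤c² 0≤c² (c²≤D ιa≤q) (c²≤D ιa≤s)))
          rest : 0# ≤ b² * (p * (e (ι q) * e (ι s)) * (ι s - ι q) + τ * ((ι q - α) * (ι s - α)) * (κ * (ι s - ι q)))
          rest = *-nonNeg 0≤b² (+-nonNeg
            (*-nonNeg (*-nonNeg 0≤p (*-nonNeg (0≤e ιa≤q) (0≤e ιa≤s))) 0≤s-q)
            (*-nonNeg (*-nonNeg 0≤τ (*-nonNeg (0≤x-α ιa≤q) (0≤x-α ιa≤s))) (*-nonNeg 0≤κ 0≤s-q)))
          gap : f (ι q) * D (ι s) + ι δ ≤ f (ι s) * D (ι q)
          gap = ≤-⇒+≤ (≤-respˡ (+-identityʳ (ι δ))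
            (≤-respʳ (sym (cross (ι q) (ι s))) (+-mono-≤ δ≤ rest)))

        -- The divided difference `(f y - f x) / (y - x)`, as a polynomial.
        h : Carrier → Carrier → Carrier
        h x y = (κ * (y - α) + e x) * (y - N * α) + e x * (x - α) - b² * (p * κ + τ)

        f-step : ∀ x y → f y - f x ≈ h x y * (y - x)
        f-step x y = trans (+-congʳ (+-cong (*-congʳ Dy≈)
          (-‿cong (+-cong (*-congˡ (*-congʳ Dy≈)) (*-congˡ (+-congʳ (*-congˡ (e-step x y))))))))
          (solve 9 (λ κ ex x y α N b p τ →
            let ey = ex :+ κ :* (y :- x) ; Dx = ex :* (x :- α) ; Dy = ey :* (y :- α) in
            (Dy :* y :- (N :* (Dy :* α) :+ b :* (p :* ey :+ τ :* (y :- α))))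
              :- (Dx :* x :- (N :* (Dx :* α) :+ b :* (p :* ex :+ τ :* (x :- α)))) :=
            ((κ :* (y :- α) :+ ex) :* (y :- N :* α) :+ ex :* (x :- α) :- b :* (p :* κ :+ τ)) :* (y :- x))
            refl κ (e x) x y α N b² p τ)
          where
          Dy≈ : D y ≈ (e x + κ * (y - x)) * (y - α)
          Dy≈ = *-congʳ (e-step x y)

        -- `L` arises from `h` by replacing `y - α`, `y - N α` and `x - α` by `B` and `e x` by
        -- `e B`, and dropping the last, subtracted term. Every summand of the difference is
        -- nonnegative on `[a, b]`.
        L-h : ∀ x y → L - h x y ≈ κ * ((B - y) + α + (B - x)) * B + (κ * (y - α) + e x) * (B - y)
          + (κ * (y - α) + e x) * (N * α) + κ * (B - x) * B + e x * ((B - x) + α) + b² * (p * κ + τ)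
        L-h x y = trans (+-congʳ (+-cong (*-congʳ (+-congˡ (e-step x B))) (*-congʳ (e-step x B))))
          (solve 8 (λ κ ex x y α Nα B β →
            let eB = ex :+ κ :* (B :- x) in
            ((κ :* B :+ eB) :* B :+ eB :* B) :- ((κ :* (y :- α) :+ ex) :* (y :- Nα) :+ ex :* (x :- α) :- β) :=
            κ :* ((B :- y) :+ α :+ (B :- x)) :* B :+ (κ :* (y :- α) :+ ex) :* (B :- y)
              :+ (κ :* (y :- α) :+ ex) :* Nα :+ κ :* (B :- x) :* B :+ ex :* ((B :- x) :+ α) :+ β)
            refl κ (e x) x y α (N * α) B (b² * (p * κ + τ)))

        0≤B : 0# ≤ B
        0≤B = ι-nonNeg 0≤b

        lipschitz : ∀ {x y} → ι a ≤ x → x ≤ y → y ≤ ι b → f y - f x ≤ L * (y - x)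
        lipschitz {x} {y} a≤x x≤y y≤b = ≤-respˡ (sym (f-step x y)) (*-monoʳ-≤ (≤⇒0≤- x≤y)
          (0≤-⇒≤ (≤-respʳ (sym (L-h x y))
            (+-nonNeg (+-nonNeg (+-nonNeg (+-nonNeg (+-nonNeg
              (*-nonNeg (*-nonNeg 0≤κ (+-nonNeg (+-nonNeg 0≤B-y 0≤α) 0≤B-x)) 0≤B)
              (*-nonNeg 0≤A 0≤B-y))
              (*-nonNeg 0≤A (*-nonNeg 0≤N 0≤α)))
              (*-nonNeg (*-nonNeg 0≤κ 0≤B-x) 0≤B))
              (*-nonNeg (0≤e a≤x) (+-nonNeg 0≤B-x 0≤α)))
              (*-nonNeg 0≤b² (+-nonNeg (*-nonNeg 0≤p 0≤κ) 0≤τ))))))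
          where
          0≤B-y = ≤⇒0≤- y≤b
          0≤B-x = ≤⇒0≤- (≤-trans x≤y y≤b)
          0≤A = +-nonNeg (*-nonNeg 0≤κ (0≤x-α (≤-trans a≤x x≤y))) (0≤e a≤x)

        0≤L : 0# ≤ L
        0≤L = +-nonNeg (*-nonNeg (+-nonNeg (*-nonNeg 0≤κ 0≤B) 0≤eB) 0≤B) (*-nonNeg 0≤eB 0≤B)
          where 0≤eB = 0≤e (ι-mono (ℚ.<⇒≤ a<b))

      secular-root : ∃[ r ] (ι a ≤ r × f r ≈ 0#)
      secular-root =
        let r , a≤r , _ , fr≈0 = root f a b L a<b 0≤L fa≤0 0≤fb decide lipschitz
        in r , a≤r , fr≈0

  -- Positivity of `e` and `r - α` is recorded by a rational lower bound `c`, the form in which they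
  -- can be cancelled.
  RootOf : Carrier → ℕ → ℕ → Set
  RootOf α n k = ∃[ r ] ∃[ e ] ∃[ c ] (0ℚ ℚ.< c × ι c ≤ e × ι c ≤ r - α ×
    RootEquation α r e (fromℕ n) (fromℕ (k ℕ.+ k)) × (k ≡ 0 ⊎ e ≈ r - 1# - α))

  root-of : ∀ α c → 0# ≤ α → 0ℚ ℚ.< c → ι c ≤ 1# - α →
    ∀ k p → 1 ℕ.≤ k ℕ.+ k ℕ.+ p → RootOf α (suc (k ℕ.+ k ℕ.+ p)) k
  root-of α c 0≤α 0<c c≤1-α k p 1≤N = from k ≡.refl
    where
    n N τ P : Carrier
    n = fromℕ (suc (k ℕ.+ k ℕ.+ p))
    N = fromℕ (k ℕ.+ k ℕ.+ p)
    τ = fromℕ (k ℕ.+ k)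
    P = fromℕ p
    n-1≈N : n - ι 1ℚ ≈ N
    n-1≈N = trans (+-congʳ (trans (fromℕ-suc (k ℕ.+ k ℕ.+ p)) (+-congʳ (sym ι-1))))
      (solve 2 (λ a b → (a :+ b) :- a := b) refl (ι 1ℚ) N)
    n-1-τ≈P : n - ι 1ℚ - τ ≈ P
    n-1-τ≈P = trans (+-congʳ (trans n-1≈N (fromℕ-+ (k ℕ.+ k) p)))
      (solve 2 (λ a b → (a :+ b) :- a := b) refl τ P)
    0≤N : 0# ≤ n - ι 1ℚ
    0≤N = ≤-respʳ (sym n-1≈N) (fromℕ-nonNeg (k ℕ.+ k ℕ.+ p))
    1≤n-1 : 0# ≤ (n - ι 1ℚ) - ι 1ℚ
    1≤n-1 = ≤⇒0≤- (≤-respʳ (sym n-1≈N) (fromℕ-mono {1} {k ℕ.+ k ℕ.+ p} 1≤N))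
    0≤P : 0# ≤ n - ι 1ℚ - τ
    0≤P = ≤-respʳ (sym n-1-τ≈P) (fromℕ-nonNeg p)
    0≤β : 0# ≤ ι 1ℚ - α
    0≤β = ≤-respʳ (+-congʳ (sym ι-1)) (≤-trans (ι-nonNeg (ℚ.<⇒≤ 0<c)) c≤1-α)

    c≤β : ι c ≤ ι 1ℚ - α
    c≤β = ≤-respʳ (+-congʳ (sym ι-1)) c≤1-α

    natural : ℚ
    natural = + suc (k ℕ.+ k ℕ.+ p) ℚ./ 1

    -- The case distinction on `k` is made on a copy, so the facts above are shared by both cases.
    from : ∀ k′ → k′ ≡ k → RootOf α (suc (k ℕ.+ k ℕ.+ p)) k
    from zero ≡.refl =
      -- The left end `1` is the root for the star on two vertices; from there on `f 1` is
      -- nonpositive.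
      let r , 1≤r , fr≈0 = secular-root {a = 1ℚ} {b = natural} {c = c}
            (/1-mono-< {1} {suc (k ℕ.+ k ℕ.+ p)} (ℕ.s≤s 1≤N)) 0<c 0≤α (≤-reflexive (sym ι-0))
            (ℚ.<⇒≤ (/1-mono-< {0} {suc (k ℕ.+ k ℕ.+ p)} (ℕ.s≤s ℕ.z≤n)))
            0≤N 0≤P (≤-reflexive (sym ι-0)) c≤e c≤x-α f1≤0 0≤fn
      in r , e r , c , 0<c , c≤e 1≤r , c≤x-α 1≤r , rootEquation fr≈0 , inj₁ ≡.refl
      where
      open Secular α (ι 1ℚ) (ι 0ℚ) n τ
      c≤e : ∀ {x} → ι 1ℚ ≤ x → ι c ≤ e x
      c≤e {x} _ = ≤-trans c≤β (0≤-⇒≤ (≤-respʳ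
        (solve 2 (λ α x → α := (con 1ℚ :+ con 0ℚ :* x) :- (con 1ℚ :- α)) refl α x) 0≤α))
      c≤x-α : ∀ {x} → ι 1ℚ ≤ x → ι c ≤ x - α
      c≤x-α 1≤x = ≤-trans c≤β (+-mono-≤ 1≤x ≤-refl)
      f1≤0 : f (ι 1ℚ) ≤ 0#
      f1≤0 = 0≤neg⇒≤0 (≤-respʳ
        (solve 2 (λ α n →
          let e = con 1ℚ :+ con 0ℚ :* con 1ℚ ; D = e :* (con 1ℚ :- α) ; β = con 1ℚ :- α in
          β :* ((n :- con 1ℚ) :- con 1ℚ) :=
          :- (D :* con 1ℚ :- ((n :- con 1ℚ) :* (D :* α) :+
            β :* β :* ((n :- con 1ℚ :- con 0ℚ) :* e :+ con 0ℚ :* (con 1ℚ :- α))))) refl α n)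
        (*-nonNeg 0≤β 1≤n-1))
      0≤fn : 0# ≤ f n
      0≤fn = ≤-respʳ
        (solve 2 (λ α n →
          let e = con 1ℚ :+ con 0ℚ :* n ; D = e :* (n :- α) ; β = con 1ℚ :- α ; N = n :- con 1ℚ in
          N :+ β :+ N :* N :* β :=
          D :* n :- (N :* (D :* α) :+
            β :* β :* ((n :- con 1ℚ :- con 0ℚ) :* e :+ con 0ℚ :* (n :- α)))) refl α n)
        (+-nonNeg (+-nonNeg 0≤N 0≤β) (*-nonNeg (*-nonNeg 0≤N 0≤N) 0≤β))
    from (suc k′) ≡.refl =
      -- The left end `2` is the root for a single triangle. To its right, `e x = x - 1 - α` is at
      -- least `1 - α`, hence at least `c`.
      let r , 2≤r , fr≈0 = secular-root {a = 2ℚ} {b = natural} {c = c}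
            (/1-mono-< {2} {suc (k ℕ.+ k ℕ.+ p)} (ℕ.s≤s (ℕ.≤-trans 2≤k+k (ℕ.m≤m+n (k ℕ.+ k) p)))) 0<c 0≤α
            (ι-nonNeg (ℚ.nonNegative⁻¹ 1ℚ))
            (ℚ.<⇒≤ (/1-mono-< {0} {suc (k ℕ.+ k ℕ.+ p)} (ℕ.s≤s ℕ.z≤n)))
            0≤N 0≤P (fromℕ-nonNeg (k ℕ.+ k)) c≤e c≤x-α f2≤0 0≤fn
      in r , e r , c , 0<c , c≤e 2≤r , c≤x-α 2≤r , rootEquation fr≈0 ,
         inj₂ (trans (solve 2 (λ α r → (:- con 1ℚ :- α) :+ con 1ℚ :* r := r :- con 1ℚ :- α) refl α r)
           (+-congʳ (+-congˡ (-‿cong ι-1))))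
      where
      open Secular α (- ι 1ℚ - α) (ι 1ℚ) n τ
      2≤k+k : 2 ℕ.≤ k ℕ.+ k
      2≤k+k = ℕ.+-mono-≤ {1} {suc k′} {1} {suc k′} (ℕ.s≤s ℕ.z≤n) (ℕ.s≤s ℕ.z≤n)
      c≤e : ∀ {x} → ι 2ℚ ≤ x → ι c ≤ e x
      c≤e {x} 2≤x = ≤-trans c≤β (0≤-⇒≤ (≤-respʳ
        (solve 2 (λ α x → x :- con 2ℚ := ((:- con 1ℚ :- α) :+ con 1ℚ :* x) :- (con 1ℚ :- α)) refl α x)
        (≤⇒0≤- 2≤x)))
      c≤x-α : ∀ {x} → ι 2ℚ ≤ x → ι c ≤ x - α
      c≤x-α {x} 2≤x = ≤-trans c≤β (+-mono-≤ (≤-trans (ι-mono (ℚ.<⇒≤ (/1-mono-< {1} {2} (ℕ.s≤s (ℕ.s≤s ℕ.z≤n))))) 2≤x) ≤-refl)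
      f2≤0 : f (ι 2ℚ) ≤ 0#
      f2≤0 = 0≤neg⇒≤0 (≤-respʳ
        (solve 3 (λ α n τ →
          let x = con 2ℚ ; e = (:- con 1ℚ :- α) :+ con 1ℚ :* x ; D = e :* (x :- α) ; β = con 1ℚ :- α
              N = n :- con 1ℚ in
          β :* ((x :- α) :* (τ :- con 2ℚ) :+ (N :- τ)) :=
          :- (D :* x :- (N :* (D :* α) :+ β :* β :* ((N :- τ) :* e :+ τ :* (x :- α))))) refl α n τ)
        (*-nonNeg 0≤β (+-nonNeg
          (*-nonNeg (≤-trans (ι-nonNeg (ℚ.<⇒≤ 0<c)) (c≤x-α ≤-refl)) (≤⇒0≤- (fromℕ-mono {2} {k ℕ.+ k} 2≤k+k)))
          0≤P)))
      0≤fn : 0# ≤ f n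
      0≤fn = ≤-respʳ
        (solve 3 (λ α n τ →
          let x = n ; e = (:- con 1ℚ :- α) :+ con 1ℚ :* x ; D = e :* (x :- α) ; β = con 1ℚ :- α
              N = n :- con 1ℚ in
          (N :+ β) :* ((N :- con 1ℚ) :+ β :+ N :* (N :- con 1ℚ) :* β) :+ β :* β :* (N :- τ) :=
          D :* x :- (N :* (D :* α) :+ β :* β :* ((N :- τ) :* e :+ τ :* (x :- α)))) refl α n τ)
        (+-nonNeg (*-nonNeg (+-nonNeg 0≤N 0≤β)
          (+-nonNeg (+-nonNeg 1≤n-1 0≤β) (*-nonNeg (*-nonNeg 0≤N 1≤n-1) 0≤β)))
          (*-nonNeg (*-nonNeg 0≤β 0≤β) 0≤P))

-- Cyclic indices, breadth-first trees and cycles in a cactus.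

module Cactus where
  open import Data.Fin.Base using (fromℕ)
  open import Relation.Binary.Construct.Closure.ReflexiveTransitive using (Star; ε; _◅_)
  open import Data.Nat.Base using (_≤_; z≤n; s≤s)
  open import Defs using (Graph; Connected; IsCactus; HasCycleCount; Cycle; next; _onCycle_; EdgeOf; _≈ᶜ_)
  open ≡ using (refl; sym; trans; cong; subst; subst₂; ≢-sym)

  toℕ-next : ∀ {m} (i : Fin (suc m)) → toℕ (next i) ≡ suc (toℕ i) % suc m
  toℕ-next {m} i = Fin.toℕ-fromℕ< (m%n<n (suc (toℕ i)) (suc m))

  next-last : ∀ {m} {i : Fin (suc m)} → toℕ i ≡ m → next i ≡ zero
  next-last {m} {i} e = Fin.toℕ-injective
    (trans (toℕ-next i) (trans (cong (λ t → suc t % suc m) e) (n%n≡0 (suc m))))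

  next-step : ∀ {m} {i j : Fin (suc m)} → toℕ j ≡ suc (toℕ i) → next i ≡ j
  next-step {m} {i} {j} e = Fin.toℕ-injective (trans (toℕ-next i)
    (trans (cong (_% suc m) (sym e)) (m<n⇒m%n≡m (Fin.toℕ<n j))))

  prev : ∀ {m} → Fin (suc m) → Fin (suc m)
  prev {m} zero    = fromℕ m
  prev     (suc i) = inject₁ i

  next-prev : ∀ {m} (i : Fin (suc m)) → next (prev i) ≡ i
  next-prev {m} zero    = next-last (Fin.toℕ-fromℕ m)
  next-prev     (suc i) = next-step (cong suc (sym (Fin.toℕ-inject₁ i)))

  -- This is where a length of at least three matters: on two positions, successor and predecessor
  -- coincide.
  next≢prev : ∀ {e} (i : Fin (3 ℕ.+ e)) → next i ≢ prev i
  next≢prev {e} zero eq with trans (sym (next-step {i = zero} {j = suc zero} refl)) eq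
  ... | ()
  next≢prev {e} (suc i) eq with ℕ.<-cmp (toℕ i) (suc e)
  ... | tri≈ _ i≡ _ = zero≢ i (cong suc i≡) (trans (sym (next-last (cong suc i≡))) eq)
    where
    zero≢ : ∀ (i : Fin (2 ℕ.+ e)) → suc (toℕ i) ≡ 2 ℕ.+ e → zero ≢ inject₁ i
    zero≢ (suc i) _ ()
  ... | tri< i< _ _ = ℕ.<-irrefl (trans (cong toℕ (sym eq′)) (toℕ-j)) (ℕ.≤-trans (ℕ.≤-reflexive (cong suc (Fin.toℕ-inject₁ i))) (ℕ.n≤1+n _))
    where
    j : Fin (3 ℕ.+ e)
    j = fromℕ< (s≤s (s≤s i<))
    toℕ-j : toℕ j ≡ suc (suc (toℕ i))
    toℕ-j = Fin.toℕ-fromℕ< (s≤s (s≤s i<))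
    eq′ : j ≡ inject₁ i
    eq′ = trans (sym (next-step {i = suc i} {j = j} toℕ-j)) eq
  ... | tri> _ _ i> = contradiction (Fin.toℕ<n i) (ℕ.≤⇒≯ i>)

  argmax : ∀ {m} (f : Fin (suc m) → ℕ) → ∃[ i ] (∀ j → f j ≤ f i)
  argmax {zero}  f = zero , λ { zero → ℕ.≤-refl }
  argmax {suc m} f with argmax (f ∘ suc)
  ... | i , max with ℕ.≤-total (f zero) (f (suc i))
  ...   | inj₁ le = suc i , λ { zero → le ; (suc j) → max j }
  ...   | inj₂ ge = zero , λ { zero → ℕ.≤-refl ; (suc j) → ℕ.≤-trans (max j) ge }

  least : ∀ {P : ℕ → Set} → (∀ d → Dec (P d)) → ∀ d → P d →
    ∃[ m ] (P m × (∀ {e} → P e → m ≤ e))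
  least P? zero p = zero , p , λ _ → z≤n
  least P? (suc d) p with P? zero
  ... | yes p₀ = zero , p₀ , λ _ → z≤n
  ... | no ¬p₀ with least (P? ∘ suc) d p
  ...   | m , pₘ , min = suc m , pₘ , λ { {zero} q → contradiction q ¬p₀ ; {suc e} q → s≤s (min q) }

  -- ℓ is the distance to the root v, p the parent of a vertex (and p v = v).
  record BreadthFirstTree {n} (G : Graph n) (v : Fin n) : Set where
    open Graph G
    field
      ℓ       : Fin n → ℕ
      p       : Fin n → Fin n
      ℓ-root  : ℓ v ≡ 0
      ℓ≡0⇒≡v  : ∀ {u} → ℓ u ≡ 0 → u ≡ v
      p-root  : p v ≡ v
      p-adj   : ∀ {u} → u ≢ v → Adj u (p u)
      p-level : ∀ {u} → u ≢ v → ℓ u ≡ suc (ℓ (p u))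
      adj-level : ∀ {u w} → Adj u w → ℓ w ≤ suc (ℓ u)

  breadthFirst : ∀ {n} (G : Graph n) → Connected G → ∀ v → BreadthFirstTree G v
  breadthFirst {n} G connected v = record
    { ℓ = λ u → proj₁ (node u)
    ; p = λ u → parent (proj₁ (node u)) u (proj₁ (proj₂ (node u)))
    ; ℓ-root = ℕ.n≤0⇒n≡0 (least-level v refl)
    ; ℓ≡0⇒≡v = λ {u} e → sym (subst (λ d → Reach d u) e (reach u))
    ; p-root = root-parent (proj₁ (node v)) (reach v) (least-level v refl)
    ; p-adj = λ {u} u≢v → parent-adj _ u (reach u) u≢v
    ; p-level = λ {u} u≢v → level _ u (reach u) (least-level u) u≢v
    ; adj-level = λ {u} {w} a → least-level w (u , reach u , a)
    }
    where
    open Graph G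
    -- A walk from `v` with exactly `d` steps. This is decidable by search, so connectedness yields
    -- a least `d`, and the last step of a shortest walk gives the parent.
    Reach : ℕ → Fin n → Set
    Reach zero    u = v ≡ u
    Reach (suc d) u = ∃[ w ] (Reach d w × Adj w u)

    reach? : ∀ u d → Dec (Reach d u)
    reach? u zero    = v Fin.≟ u
    reach? u (suc d) = Fin.any? λ w → reach? w d ×-dec adj? w u

    walk : ∀ {w u} d → Reach d w → Star Adj w u → ∃[ d ] Reach d u
    walk d r ε       = d , r
    walk d r (a ◅ s) = walk (suc d) (_ , r , a) s

    node : ∀ u → ∃[ d ] (Reach d u × (∀ {e} → Reach e u → d ≤ e))
    node u = let d , r = walk 0 refl (connected v u) in least (reach? u) d r

    reach : ∀ u → Reach (proj₁ (node u)) u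
    reach u = proj₁ (proj₂ (node u))

    least-level : ∀ u {e} → Reach e u → proj₁ (node u) ≤ e
    least-level u = proj₂ (proj₂ (node u))

    -- Zero steps reach only `v`, so the first clause makes the root its own parent.
    parent : ∀ d u → Reach d u → Fin n
    parent zero    u _       = u
    parent (suc d) u (w , _) = w

    root-parent : ∀ d (r : Reach d v) → d ≤ 0 → parent d v r ≡ v
    root-parent zero _ _ = refl

    parent-adj : ∀ d u (r : Reach d u) → u ≢ v → Adj u (parent d u r)
    parent-adj zero    u v≡u         u≢v = contradiction (sym v≡u) u≢v
    parent-adj (suc d) u (w , _ , a) u≢v = symm a

    -- A shortest walk to the parent extends by one step to `u`, and the walk to `u` reaches the
    -- parent in one step less.
    level : ∀ d u (r : Reach d u) → (∀ {e} → Reach e u → d ≤ e) → u ≢ v →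
      d ≡ suc (proj₁ (node (parent d u r)))
    level zero    u v≡u         _   u≢v = contradiction (sym v≡u) u≢v
    level (suc d) u (w , r , a) min _   =
      ℕ.≤-antisym (min (w , reach w , a)) (s≤s (least-level w r))

  -- The vertex list is an index so that distinctness, length and membership can be stated about it
  -- directly.
  data Path {n} (T : Fin n → Fin n → Set) : Fin n → Fin n → List (Fin n) → Set where
    [_] : ∀ x → Path T x x (x ∷ [])
    _∷_ : ∀ {x y z l} → T x y → Path T y z l → Path T x z (x ∷ l)

  _∷ʳ_ : ∀ {n T} {x y z : Fin n} {l} → Path T x y l → T y z → Path T x z (l ++ z ∷ [])
  [ x ] ∷ʳ t     = t ∷ [ _ ]
  (s ∷ path) ∷ʳ t = s ∷ (path ∷ʳ t)

  Unique-∷ʳ : ∀ {n} {l : List (Fin n)} {z} → Unique l → All (_≢ z) l → Unique (l ++ z ∷ [])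
  Unique-∷ʳ u fresh = Unique.++⁺ u ([] ∷ [])
    λ { (x∈l , here x≡z) → All.lookup fresh x∈l x≡z }

  lookup-injective : ∀ {n} {l : List (Fin n)} → Unique l → ∀ {i j} → lookup l i ≡ lookup l j → i ≡ j
  lookup-injective (_ ∷ _) {zero} {zero} _ = refl
  lookup-injective {l = _ ∷ l} (x∉l ∷ _) {zero} {suc j} e = contradiction e (All.lookup x∉l (∈-lookup j))
  lookup-injective {l = _ ∷ l} (x∉l ∷ _) {suc i} {zero} e = contradiction (sym e) (All.lookup x∉l (∈-lookup i))
  lookup-injective (_ ∷ u) {suc i} {suc j} e = cong suc (lookup-injective u e)

  path-head : ∀ {n T} {x z : Fin n} {a l} → Path T x z (a ∷ l) → a ≡ x
  path-head [ x ]   = refl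
  path-head (_ ∷ _) = refl

  path-step : ∀ {n T} {x z : Fin n} {a l} → Path T x z (a ∷ l) → (i : Fin (suc (length l))) →
    (toℕ i ≡ length l × lookup (a ∷ l) i ≡ z) ⊎
    (∃[ j ] (toℕ j ≡ suc (toℕ i) × T (lookup (a ∷ l) i) (lookup (a ∷ l) j)))
  path-step [ x ] zero = inj₁ (refl , refl)
  path-step {T = T} {l = b ∷ l} (t ∷ path) zero =
    inj₂ (suc zero , refl , subst (T _) (sym (path-head path)) t)
  path-step {l = b ∷ l} (t ∷ path) (suc i) with path-step path i
  ... | inj₁ (e , f)     = inj₁ (cong suc e , f)
  ... | inj₂ (j , e , t′) = inj₂ (suc j , cong suc e , t′)

  module _ {n} {G : Graph n} where
    open Graph G

    -- The last component says that `z x` is the only edge of the cycle that need not be a `T`-step;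
    -- with `T` the tree edges it isolates the non-tree edge of a fundamental cycle.
    close-path : ∀ {T x z l} → (∀ {a b} → T a b → Adj a b) → Path T x z l → Unique l →
      3 ≤ length l → Adj z x →
      ∃[ c ] ((∀ {y} → y ∈ l → y onCycle c) × EdgeOf {G = G} c z x ×
              (∀ i → T (Cycle.vertex c i) (Cycle.vertex c (next i)) ⊎
                     (Cycle.vertex c i ≡ z × Cycle.vertex c (next i) ≡ x)))
    close-path {T} {x} {z} {l@(a ∷ b ∷ c ∷ l′)} T⇒Adj path unique (s≤s (s≤s (s≤s _))) zx =
      cyc , (λ y∈l → Any.index y∈l , sym (lookup-index y∈l)) , (last , inj₁ (last-edge)) , edge
      where
      edge : ∀ i → T (lookup l i) (lookup l (next i)) ⊎ (lookup l i ≡ z × lookup l (next i) ≡ x)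
      edge i with path-step path i
      ... | inj₁ (e , i≡z)   = inj₂ (i≡z , trans (cong (lookup l) (next-last e)) (path-head path))
      ... | inj₂ (j , e , t) = inj₁ (subst (T (lookup l i)) (cong (lookup l) (sym (next-step e))) t)

      cyc : Cycle G
      cyc = record
        { excess = length l′
        ; vertex = lookup l
        ; injective = lookup-injective unique
        ; closed = λ i → Sum.[ T⇒Adj , (λ (e , f) → subst₂ Adj (sym e) (sym f) zx) ]′ (edge i)
        }

      last : Fin (3 ℕ.+ length l′)
      last = fromℕ (2 ℕ.+ length l′)

      last-edge : lookup l last ≡ z × lookup l (next last) ≡ x
      last-edge with path-step path last
      ... | inj₁ (e , i≡z)   = i≡z , trans (cong (lookup l) (next-last e)) (path-head path)
      ... | inj₂ (j , e , _) = contradiction (Fin.toℕ<n j)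
        (ℕ.≤⇒≯ (ℕ.≤-reflexive (trans (cong suc (sym (Fin.toℕ-fromℕ (2 ℕ.+ length l′)))) (sym e))))

    EdgeOf-swap : ∀ {c : Cycle G} {u w} → EdgeOf c u w → EdgeOf c w u
    EdgeOf-swap (i , e) = i , Sum.swap e

    EdgeOf⇒onCycle : ∀ {c : Cycle G} {u w} → EdgeOf c u w → u onCycle c × w onCycle c
    EdgeOf⇒onCycle (i , inj₁ (e , f)) = (i , e) , (next i , f)
    EdgeOf⇒onCycle (i , inj₂ (e , f)) = (next i , f) , (i , e)

  -- Non-tree edges and their fundamental cycles.

  module Matching {n} {G : Graph n} {v} (tree : BreadthFirstTree G v) where
    open Graph G
    open BreadthFirstTree tree

    Tree NonTree : Fin n → Fin n → Set
    Tree a b = Adj a b × (p a ≡ b ⊎ p b ≡ a)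
    NonTree a b = Adj a b × p a ≢ b × p b ≢ a

    nonTree? : ∀ a b → Dec (NonTree a b)
    nonTree? a b = adj? a b ×-dec ¬? (p a Fin.≟ b) ×-dec ¬? (p b Fin.≟ a)

    nonTree-swap : ∀ {a b} → NonTree a b → NonTree b a
    nonTree-swap (ab , pa≢b , pb≢a) = symm ab , pb≢a , pa≢b

    tree-or-nonTree : ∀ {a b} → Adj a b → ¬ NonTree a b → p a ≡ b ⊎ p b ≡ a
    tree-or-nonTree {a} {b} ab ¬nt with p a Fin.≟ b | p b Fin.≟ a
    ... | yes e  | _      = inj₁ e
    ... | no _   | yes e  = inj₂ e
    ... | no pa≢b | no pb≢a = contradiction (ab , pa≢b , pb≢a) ¬nt

    ¬adj-self : ∀ {a b} → Adj a b → a ≢ b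
    ¬adj-self ab a≡b = irrefl a≡b ab

    suc-level⇒≢v : ∀ {u d} → ℓ u ≡ suc d → u ≢ v
    suc-level⇒≢v e refl = contradiction (trans (sym ℓ-root) e) λ ()

    p-level′ : ∀ {u d} → ℓ u ≡ suc d → ℓ (p u) ≡ d
    p-level′ e = ℕ.suc-injective (trans (sym (p-level (suc-level⇒≢v e))) e)

    tree-up : ∀ {u d} → ℓ u ≡ suc d → Tree u (p u)
    tree-up e = p-adj (suc-level⇒≢v e) , inj₁ refl

    tree-down : ∀ {u d} → ℓ u ≡ suc d → Tree (p u) u
    tree-down e = symm (p-adj (suc-level⇒≢v e)) , inj₂ refl

    -- A neighbour of `v` has level at most one, so its parent has level zero and is `v`: all edges
    -- at the root are tree edges.
    nonTree⇒≢v : ∀ {a b} → NonTree a b → a ≢ v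
    nonTree⇒≢v {b = b} (ab , _ , pb≢a) refl = pb≢a (ℓ≡0⇒≡v (ℕ.n≤0⇒n≡0 (ℕ.s≤s⁻¹
      (subst₂ _≤_ (p-level (≢-sym (¬adj-self ab))) (cong suc ℓ-root) (adj-level ab)))))

    -- `below` keeps vertices of the next level fresh when the path is extended at its ends. `px∈`
    -- and `py∈` will supply the second common vertex of two fundamental cycles.
    record Climb (d : ℕ) (x y : Fin n) : Set where
      field
        vertices : List (Fin n)
        path     : Path Tree x y vertices
        unique   : Unique vertices
        below    : All (λ z → ℓ z ≤ d) vertices
        long     : 3 ≤ length vertices
        px∈      : p x ∈ vertices
        py∈      : p y ∈ vertices

    path-head∈ : ∀ {T : Fin n → Fin n → Set} {x z l} → Path T x z l → x ∈ l
    path-head∈ [ x ]   = here refl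
    path-head∈ (_ ∷ _) = here refl

    path-last∈ : ∀ {T : Fin n → Fin n → Set} {x z l} → Path T x z l → z ∈ l
    path-last∈ [ x ]     = here refl
    path-last∈ (_ ∷ path) = there (path-last∈ path)

    above⇒∉ : ∀ {d x l} → ℓ x ≡ suc d → All (λ z → ℓ z ≤ d) l → All (_≢ x) l
    above⇒∉ e = All.map λ { ℓz≤d refl → ℕ.1+n≰n (ℕ.≤-trans (ℕ.≤-reflexive (sym e)) ℓz≤d) }

    -- Two vertices of the same level are joined by climbing to their first
    -- common ancestor.
    climb : ∀ d {x y} → ℓ x ≡ d → ℓ y ≡ d → x ≢ y → Climb d x y
    climb zero    ex ey x≢y = contradiction (trans (ℓ≡0⇒≡v ex) (sym (ℓ≡0⇒≡v ey))) x≢y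
    climb (suc d) {x} {y} ex ey x≢y with p x Fin.≟ p y
    ... | yes px≡py = record
      { vertices = x ∷ p x ∷ y ∷ []
      ; path     = tree-up ex ∷ (subst (λ z → Tree z y) (sym px≡py) (tree-down ey) ∷ [ y ])
      ; unique   = (x≢px ∷ x≢y ∷ []) ∷ (px≢y ∷ []) ∷ [] ∷ []
      ; below    = ℕ.≤-reflexive ex ∷ ℕ.≤-trans (ℕ.≤-reflexive (p-level′ ex)) (ℕ.n≤1+n d)
                 ∷ ℕ.≤-reflexive ey ∷ []
      ; long     = s≤s (s≤s (s≤s z≤n))
      ; px∈      = there (here refl)
      ; py∈      = there (here (sym px≡py))
      }
      where
      x≢px : x ≢ p x
      x≢px = ¬adj-self (proj₁ (tree-up ex))
      px≢y : p x ≢ y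
      px≢y e = ¬adj-self (proj₁ (tree-down ey)) (trans (sym px≡py) e)
    ... | no px≢py = record
      { vertices = x ∷ (vertices ++ y ∷ [])
      ; path     = tree-up ex ∷ (path ∷ʳ tree-down ey)
      ; unique   = All.++⁺ (All.map ≢-sym (above⇒∉ ex below)) (x≢y ∷ [])
                 ∷ Unique-∷ʳ unique (above⇒∉ ey below)
      ; below    = ℕ.≤-reflexive ex ∷ All.++⁺ (All.map ℕ.m≤n⇒m≤1+n below) (ℕ.≤-reflexive ey ∷ [])
      ; long     = ℕ.m≤n⇒m≤1+n (ℕ.≤-trans long
                     (ℕ.≤-trans (ℕ.m≤m+n _ 1) (ℕ.≤-reflexive (sym (List.length-++ vertices)))))
      ; px∈      = there (∈-++⁺ˡ (path-head∈ path))
      ; py∈      = there (∈-++⁺ˡ (path-last∈ path))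
      }
      where open Climb (climb d (p-level′ ex) (p-level′ ey) px≢py)

    -- Two such cycles at `u` share `u` and `p u`, by `u∈` and `pu∈`; `only` tells them apart by
    -- their single non-tree edge.
    record Fundamental (u w : Fin n) : Set where
      field
        cycle : Cycle G
        u∈    : u onCycle cycle
        w∈    : w onCycle cycle
        pu∈   : p u onCycle cycle
        pw∈   : p w onCycle cycle
        edge  : EdgeOf cycle u w
        only  : ∀ {a b} → EdgeOf cycle a b → NonTree a b → (a ≡ u × b ≡ w) ⊎ (a ≡ w × b ≡ u)

    tree⇒¬nonTree : ∀ {a b} → Tree a b → ¬ NonTree a b
    tree⇒¬nonTree (_ , t) (_ , s , s′) = Sum.[ s , s′ ]′ t

    close : ∀ {u w l} → Path Tree u w l → Unique l → 3 ≤ length l → p u ∈ l → p w ∈ l →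
      NonTree u w → Fundamental u w
    close {u} {w} path unique long pu∈ pw∈ (uw , _) =
      let c , on , edge , edges = close-path proj₁ path unique long (symm uw)
      in record
        { cycle = c
        ; u∈ = on (path-head∈ path) ; w∈ = on (path-last∈ path) ; pu∈ = on pu∈ ; pw∈ = on pw∈
        ; edge = EdgeOf-swap {c = c} edge
        ; only = λ where
            (i , inj₁ (e , f)) nt → Sum.[
              (λ t → contradiction (subst₂ NonTree (sym e) (sym f) nt) (tree⇒¬nonTree t)) ,
              (λ (e′ , f′) → inj₂ (trans (sym e) e′ , trans (sym f) f′)) ]′ (edges i)
            (i , inj₂ (e , f)) nt → Sum.[
              (λ t → contradiction (subst₂ NonTree (sym e) (sym f) (nonTree-swap nt)) (tree⇒¬nonTree t)) ,
              (λ (e′ , f′) → inj₁ (trans (sym f) f′ , trans (sym e) e′)) ]′ (edges i)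
        }

    -- Adjacent levels differ by at most one. On equal levels the tree path between the ends is
    -- closed up. Otherwise the path runs from `u` to `p w`, which differs from `u` because the edge
    -- is not in the tree, and then steps down to `w`.
    fundamental-≤ : ∀ {u w} → ℓ u ≤ ℓ w → NonTree u w → Fundamental u w
    fundamental-≤ {u} {w} ℓu≤ℓw nt@(uw , _ , pw≢u) with ℕ.m≤n⇒m<n∨m≡n ℓu≤ℓw
    ... | inj₂ ℓu≡ℓw = close path unique long px∈ py∈ nt
      where open Climb (climb (ℓ u) refl (sym ℓu≡ℓw) (¬adj-self uw))
    ... | inj₁ ℓu<ℓw = close (path ∷ʳ tree-down ℓw≡) (Unique-∷ʳ unique (above⇒∉ ℓw≡ below))
        (ℕ.≤-trans long (ℕ.≤-trans (ℕ.m≤m+n _ 1) (ℕ.≤-reflexive (sym (List.length-++ vertices)))))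
        (∈-++⁺ˡ px∈) (∈-++⁺ˡ (path-last∈ path)) nt
      where
      ℓw≡ : ℓ w ≡ suc (ℓ u)
      ℓw≡ = ℕ.≤-antisym (adj-level uw) ℓu<ℓw
      open Climb (climb (ℓ u) refl (p-level′ ℓw≡) (≢-sym pw≢u))

    fundamental : ∀ {u w} → NonTree u w → Fundamental u w
    fundamental {u} {w} nt with ℕ.≤-total (ℓ u) (ℓ w)
    ... | inj₁ le = fundamental-≤ le nt
    ... | inj₂ ge = record
      { cycle = cycle ; u∈ = w∈ ; w∈ = u∈ ; pu∈ = pw∈ ; pw∈ = pu∈
      ; edge = EdgeOf-swap {c = cycle} edge ; only = λ e nt′ → Sum.swap (only e nt′) }
      where open Fundamental (fundamental-≤ ge (nonTree-swap nt))

    abstract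
      -- At a vertex of maximal level, at most one of the two cycle edges leads
      -- to its parent.
      cycle-nonTree : ∀ (c : Cycle G) → ∃[ a ] ∃[ b ] (EdgeOf c a b × NonTree a b)
      cycle-nonTree c = choose (p x Fin.≟ vertex (next i))
        where
        open Cycle c
        i : Fin (3 ℕ.+ excess)
        i = proj₁ (argmax (ℓ ∘ vertex))
        x : Fin n
        x = vertex i
        no-child : ∀ j → Adj x (vertex j) → p (vertex j) ≢ x
        no-child j xj pj≡x with vertex j Fin.≟ v
        ... | yes j≡v = ¬adj-self xj (trans (sym pj≡x) (trans (cong p j≡v) (trans p-root (sym j≡v))))
        ... | no j≢v = ℕ.1+n≰n (ℕ.≤-trans
          (ℕ.≤-reflexive (trans (cong (suc ∘ ℓ) (sym pj≡x)) (sym (p-level j≢v))))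
          (proj₂ (argmax (ℓ ∘ vertex)) j))
        adj-prev : Adj x (vertex (prev i))
        adj-prev = symm (subst (λ j → Adj (vertex (prev i)) (vertex j)) (next-prev i) (closed (prev i)))
        choose : Dec (p x ≡ vertex (next i)) → ∃[ a ] ∃[ b ] (EdgeOf c a b × NonTree a b)
        choose (no px≢) = x , vertex (next i) , (i , inj₁ (refl , refl)) ,
          closed i , px≢ , no-child (next i) (closed i)
        choose (yes px≡) = x , vertex (prev i) , (prev i , inj₂ (refl , cong vertex (next-prev i))) ,
          adj-prev , (λ px≡prev → next≢prev i (injective (trans (sym px≡) px≡prev))) ,
          no-child (prev i) adj-prev

    module _ (cactus : IsCactus G) where

      nonTree-unique : ∀ {u w w′} → NonTree u w → NonTree u w′ → w ≡ w′
      nonTree-unique {u} {w} {w′} nt nt′ with w Fin.≟ w′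
      ... | yes e = e
      ... | no w≢w′ = contradiction
        (proj₂ cactus F.cycle F′.cycle distinct u (p u) F.u∈ F′.u∈ F.pu∈ F′.pu∈)
        (¬adj-self (p-adj (nonTree⇒≢v nt)))
        where
        module F = Fundamental (fundamental nt)
        module F′ = Fundamental (fundamental nt′)
        distinct : ¬ (F.cycle ≈ᶜ F′.cycle)
        distinct same with F′.only (Equivalence.to (same u w) F.edge) nt
        ... | inj₁ (_ , w≡w′)  = w≢w′ w≡w′
        ... | inj₂ (u≡w′ , _) = ¬adj-self (proj₁ nt′) u≡w′

      module _ {k} (count : HasCycleCount G k) where
        open Bijection count using (to; injective; surjective)

        a b : Fin k → Fin n
        a i = proj₁ (cycle-nonTree (to i))
        b i = proj₁ (proj₂ (cycle-nonTree (to i)))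

        ab-edge : ∀ i → EdgeOf (to i) (a i) (b i)
        ab-edge i = proj₁ (proj₂ (proj₂ (cycle-nonTree (to i))))

        ab-nonTree : ∀ i → NonTree (a i) (b i)
        ab-nonTree i = proj₂ (proj₂ (proj₂ (cycle-nonTree (to i))))

        -- An enumeration of the matched vertices, with both ends of the edge chosen on each cycle;
        -- the lemmas below show that it is without repetition and complete, so that there are `2k`
        -- of them.
        ends : Fin (k ℕ.+ k) → Fin n
        ends j = Sum.[ a , b ]′ (splitAt k j)

        -- Cycles sharing both ends of their chosen edges share two vertices.
        same-edge : ∀ {i j} → (a i ≡ a j × b i ≡ b j) ⊎ (a i ≡ b j × b i ≡ a j) → i ≡ j
        same-edge {i} {j} shared with i Fin.≟ j
        ... | yes e = e
        ... | no i≢j = contradiction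
          (proj₂ cactus (to i) (to j) (i≢j ∘ injective) (a i) (b i)
            (proj₁ (on i)) (Sum.[ (λ (e , _) → subst (_onCycle to j) (sym e) (proj₁ (on j))) ,
                                 (λ (e , _) → subst (_onCycle to j) (sym e) (proj₂ (on j))) ]′ shared)
            (proj₂ (on i)) (Sum.[ (λ (_ , f) → subst (_onCycle to j) (sym f) (proj₂ (on j))) ,
                                 (λ (_ , f) → subst (_onCycle to j) (sym f) (proj₁ (on j))) ]′ shared))
          (¬adj-self (proj₁ (ab-nonTree i)))
          where
          on : ∀ i → (a i onCycle to i) × (b i onCycle to i)
          on i = EdgeOf⇒onCycle {c = to i} (ab-edge i)

        ends-nonTree : ∀ j → ∃[ w ] NonTree (ends j) w
        ends-nonTree j with splitAt k j
        ... | inj₁ i = b i , ab-nonTree i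
        ... | inj₂ i = a i , nonTree-swap (ab-nonTree i)

        -- A common end forces, by the matching property, the other ends to agree too, so the cycles
        -- coincide. In the mixed case this turns `a i ≡ b j` into `a i ≡ b i`, a loop.
        ends-injective : ∀ {i j} → ends i ≡ ends j → i ≡ j
        ends-injective {i} {j} e = trans (sym (Fin.join-splitAt k k i))
          (trans (cong (join k k) (lemma (splitAt k i) (splitAt k j) e)) (Fin.join-splitAt k k j))
          where
          lemma : ∀ (s t : Fin k ⊎ Fin k) → Sum.[ a , b ]′ s ≡ Sum.[ a , b ]′ t → s ≡ t
          lemma (inj₁ i) (inj₁ j) e = cong inj₁ (same-edge (inj₁
            (e , nonTree-unique (ab-nonTree i) (subst (λ z → NonTree z (b j)) (sym e) (ab-nonTree j)))))
          lemma (inj₂ i) (inj₂ j) e = cong inj₂ (same-edge (inj₁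
            (nonTree-unique (nonTree-swap (ab-nonTree i))
              (subst (λ z → NonTree z (a j)) (sym e) (nonTree-swap (ab-nonTree j))) , e)))
          lemma (inj₁ i) (inj₂ j) e with mate
            where mate = nonTree-unique (ab-nonTree i)
                    (subst (λ z → NonTree z (a j)) (sym e) (nonTree-swap (ab-nonTree j)))
          ... | b≡a with same-edge {i} {j} (inj₂ (e , b≡a))
          ...   | refl = contradiction e (¬adj-self (proj₁ (ab-nonTree i)))
          lemma (inj₂ i) (inj₁ j) e with lemma (inj₁ j) (inj₂ i) (sym e)
          ... | ()

        -- The fundamental cycle of the edge is one of the `k` counted cycles. The edge chosen on
        -- that cycle is a non-tree edge, so by `only` it is the given one.
        ends-surjective : ∀ {u w} → NonTree u w → ∃[ j ] ends j ≡ u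
        ends-surjective {u} {w} nt = found (only (Equivalence.to (same (a i) (b i)) (ab-edge i)) (ab-nonTree i))
          where
          open Fundamental (fundamental nt)
          i : Fin k
          i = proj₁ (surjective cycle)
          same : to i ≈ᶜ cycle
          same = proj₂ (surjective cycle) refl
          found : (a i ≡ u × b i ≡ w) ⊎ (a i ≡ w × b i ≡ u) → ∃[ j ] ends j ≡ u
          found (inj₁ (ai≡u , _)) = i ↑ˡ k ,
            trans (cong Sum.[ a , b ]′ (Fin.splitAt-↑ˡ k i k)) ai≡u
          found (inj₂ (_ , bi≡u)) = k ↑ʳ i ,
            trans (cong Sum.[ a , b ]′ (Fin.splitAt-↑ʳ k k i)) bi≡u

        ends≢v : ∀ j → ends j ≢ v
        ends≢v j = nonTree⇒≢v (proj₂ (ends-nonTree j))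

        -- The root is unmatched, so it is distinct from the `2k` distinct ends.
        1+2k≤n : suc (k ℕ.+ k) ≤ n
        1+2k≤n = Fin.injective⇒≤ {f = f} f-injective
          where
          f : Fin (suc (k ℕ.+ k)) → Fin n
          f zero    = v
          f (suc j) = ends j
          f-injective : ∀ {i j} → f i ≡ f j → i ≡ j
          f-injective {zero}  {zero}  _ = refl
          f-injective {zero}  {suc j} e = contradiction (sym e) (ends≢v j)
          f-injective {suc i} {zero}  e = contradiction e (ends≢v i)
          f-injective {suc i} {suc j} e = cong suc (ends-injective e)

-- Rows of the matrix and an eigenvector of `Cᶜ`.

module Extremal (R : RealRing) where
  open import Defs using (Graph; degree; Cᶜ)
  open Ordered R
  open QuadraticForm R using (RootEquation)
  open import Relation.Binary.Reasoning.Setoid setoid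

  indicator-yes : ∀ {A : Set} (d : Dec A) → A → indicator (does d) ≈ 1#
  indicator-yes (yes _) _ = refl
  indicator-yes (no ¬a) a = contradiction a ¬a

  indicator-no : ∀ {A : Set} (d : Dec A) → ¬ A → indicator (does d) ≈ 0#
  indicator-no (yes a) ¬a = contradiction a ¬a
  indicator-no (no _)  _  = refl

  count-filter : ∀ {A : Set} {P : A → Set} (P? : Decidable P) {n} (g : Fin n → A) →
    fromℕ (length (filter P? (tabulate g))) ≈ sum (λ j → indicator (does (P? (g j))))
  count-filter P? {zero} g = ι-0
  count-filter P? {suc n} g with P? (g zero)
  ... | yes _ = trans (fromℕ-suc (length (filter P? (tabulate (g ∘ suc)))))
    (+-congˡ (count-filter P? (g ∘ suc)))
  ... | no _ = trans (count-filter P? (g ∘ suc)) (sym (+-identityˡ _))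

  module _ {n} (G : Graph n) where
    open Graph G

    adjacency : Fin n → Fin n → Carrier
    adjacency i j = indicator (does (adj? i j))

    matrix : Carrier → Fin n → Fin n → Carrier
    matrix α i j = α * (if does (i Fin.≟ j) then fromℕ (degree G i) else 0#) + (1# - α) * adjacency i j

    product : Carrier → (Fin n → Carrier) → Fin n → Fin n → Carrier
    product α x i j = matrix α i j * x j

    Eigenvector : Carrier → Carrier → (Fin n → Carrier) → Set
    Eigenvector α μ x = ¬ (∀ i → x i ≈ 0#) × (∀ i → sum (product α x i) ≈ μ * x i)

    -- The degree is a row sum of the adjacency matrix, so the diagonal entry can be distributed
    -- over the neighbours. This gives the edge-by-edge form of the estimates.
    matrix-row : ∀ α (x : Fin n → Carrier) i →
      sum (product α x i) ≈
      sum (λ j → adjacency i j * (α * x i + (1# - α) * x j))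
    matrix-row α x i = begin
      sum (λ j → (α * δ j + β * A j) * x j)
        ≈⟨ sum-cong (λ j → solve 5 (λ α d β a x → (α :* d :+ β :* a) :* x := α :* (d :* x) :+ a :* (β :* x))
             refl α (δ j) β (A j) (x j)) ⟩
      sum (λ j → α * (δ j * x j) + A j * (β * x j))
        ≈⟨ ∑-distrib-+ (λ j → α * (δ j * x j)) (λ j → A j * (β * x j)) ⟩
      sum (λ j → α * (δ j * x j)) + sum (λ j → A j * (β * x j))
        ≈⟨ +-congʳ (begin
             sum (λ j → α * (δ j * x j)) ≈⟨ sum-single i off-diagonal ⟩
             α * (δ i * x i)             ≈⟨ *-congˡ (*-congʳ diagonal) ⟩
             α * (sum A * x i)           ≈⟨ solve 3 (λ α s x → α :* (s :* x) := s :* (α :* x)) refl α (sum A) (x i) ⟩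
             sum A * (α * x i)           ≈⟨ *-distribʳ-sum (α * x i) A ⟩
             sum (λ j → A j * (α * x i)) ∎) ⟩
      sum (λ j → A j * (α * x i)) + sum (λ j → A j * (β * x j))
        ≈⟨ sym (∑-distrib-+ (λ j → A j * (α * x i)) (λ j → A j * (β * x j))) ⟩
      sum (λ j → A j * (α * x i) + A j * (β * x j))
        ≈⟨ sum-cong (λ j → sym (distribˡ (A j) (α * x i) (β * x j))) ⟩
      sum (λ j → A j * (α * x i + β * x j)) ∎
      where
      β : Carrier
      β = 1# - α
      A δ : Fin n → Carrier
      A = adjacency i
      δ j = if does (i Fin.≟ j) then fromℕ (degree G i) else 0#
      diagonal : δ i ≈ sum A
      diagonal with i Fin.≟ i
      ... | yes _ = count-filter (adj? i) (λ j → j)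
      ... | no i≢i = contradiction ≡.refl i≢i
      off-diagonal : ∀ j → j ≢ i → α * (δ j * x j) ≈ 0#
      off-diagonal j j≢i with i Fin.≟ j
      ... | yes i≡j = contradiction (≡.sym i≡j) j≢i
      ... | no _ = trans (*-congˡ (zeroˡ (x j))) (zeroʳ α)

  sum-threshold : ∀ m p b c →
    sum {m ℕ.+ p} (λ j → if toℕ j ℕ.<ᵇ m then b else c) ≈ fromℕ m * b + fromℕ p * c
  sum-threshold zero p b c = trans (sum-const p c)
    (trans (sym (+-identityˡ _)) (+-congʳ (sym (trans (*-congʳ ι-0) (zeroˡ b)))))
  sum-threshold (suc m) p b c = trans (+-congˡ (sum-threshold m p b c))
    (trans (sym (+-assoc _ _ _)) (+-congʳ (trans (+-congʳ (sym (*-identityˡ b)))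
      (trans (sym (distribʳ b 1# (fromℕ m))) (*-congʳ (sym (fromℕ-suc m)))))))

  module Windmill (k p : ℕ) (α r e : Carrier)
    (root : RootEquation α r e (fromℕ (suc (k ℕ.+ k ℕ.+ p))) (fromℕ (k ℕ.+ k)))
    (e-cases : k ≡ 0 ⊎ e ≈ r - 1# - α) where

    N : ℕ
    N = k ℕ.+ k ℕ.+ p

    -- The solution of `(r-α) leaf = β hub` and `e rim = β hub`, scaled so that no quotient appears.
    β hub rim leaf : Carrier
    β    = 1# - α
    hub  = e * (r - α)
    rim  = β * (r - α)
    leaf = β * e

    y : Fin (suc N) → Carrier
    y zero    = hub
    y (suc j) = if toℕ j ℕ.<ᵇ k ℕ.+ k then rim else leaf

    G : Graph (suc N)
    G = Cᶜ (suc N) k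
    open Graph G

    hub-adj : ∀ j → Adj zero (suc j)
    hub-adj j = inj₁ (inj₁ (≡.refl , λ ()))

    <ᵇ-true : ∀ {m n} → m ℕ.< n → (m ℕ.<ᵇ n) ≡ true
    <ᵇ-true {m} {n} m<n with m ℕ.<ᵇ n | ℕ.<⇒<ᵇ m<n
    ... | true | _ = ≡.refl

    <ᵇ-false : ∀ {m n} → ¬ m ℕ.< n → (m ℕ.<ᵇ n) ≡ false
    <ᵇ-false {m} {n} m≮n with m ℕ.<ᵇ n | ℕ.<ᵇ⇒< m n
    ... | true  | f = contradiction (f _) m≮n
    ... | false | _ = ≡.refl

    y-rim : ∀ {j} → toℕ j ℕ.< k ℕ.+ k → y (suc j) ≈ rim
    y-rim j< = reflexive (≡.cong (if_then rim else leaf) (<ᵇ-true j<))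

    y-leaf : ∀ {j} → ¬ toℕ j ℕ.< k ℕ.+ k → y (suc j) ≈ leaf
    y-leaf j≮ = reflexive (≡.cong (if_then rim else leaf) (<ᵇ-false j≮))

    -- Indices are counted without the hub, hence one lower than the vertex numbers of `Cᶜ`: the
    -- triangle partners are `i` and `k + i` for `i < k`.
    RimPair : ℕ → ℕ → Set
    RimPair i j = (i ℕ.< k × j ≡ k ℕ.+ i) ⊎ (j ℕ.< k × i ≡ k ℕ.+ j)

    adj⇒pair : ∀ {i j : Fin N} → Adj (suc i) (suc j) → RimPair (toℕ i) (toℕ j)
    adj⇒pair (inj₁ (inj₂ (_ , i≤ , e))) = inj₁ (i≤ , ℕ.suc-injective (≡.trans e (ℕ.+-suc k _)))
    adj⇒pair (inj₂ (inj₂ (_ , j≤ , e))) = inj₂ (j≤ , ℕ.suc-injective (≡.trans e (ℕ.+-suc k _)))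

    pair⇒adj : ∀ {i j : Fin N} → RimPair (toℕ i) (toℕ j) → Adj (suc i) (suc j)
    pair⇒adj (inj₁ (i< , e)) = inj₁ (inj₂ (ℕ.s≤s ℕ.z≤n , i< , ≡.trans (≡.cong suc e) (≡.sym (ℕ.+-suc k _))))
    pair⇒adj (inj₂ (j< , e)) = inj₂ (inj₂ (ℕ.s≤s ℕ.z≤n , j< , ≡.trans (≡.cong suc e) (≡.sym (ℕ.+-suc k _))))

    pair-unique : ∀ {i j j′} → RimPair i j → RimPair i j′ → j ≡ j′
    pair-unique (inj₁ (_ , e)) (inj₁ (_ , e′)) = ≡.trans e (≡.sym e′)
    pair-unique (inj₂ (_ , e)) (inj₂ (_ , e′)) = ℕ.+-cancelˡ-≡ k _ _ (≡.trans (≡.sym e) e′)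
    pair-unique (inj₁ (i< , _)) (inj₂ (_ , ≡.refl)) = contradiction i< (ℕ.≤⇒≯ (ℕ.m≤m+n k _))
    pair-unique (inj₂ (_ , ≡.refl)) (inj₁ (i< , _)) = contradiction i< (ℕ.≤⇒≯ (ℕ.m≤m+n k _))

    pair-< : ∀ {i j} → RimPair i j → i ℕ.< k ℕ.+ k × j ℕ.< k ℕ.+ k
    pair-< (inj₁ (i< , ≡.refl)) = ℕ.≤-trans i< (ℕ.m≤m+n k k) , ℕ.+-monoʳ-< k i<
    pair-< (inj₂ (j< , ≡.refl)) = ℕ.+-monoʳ-< k j< , ℕ.≤-trans j< (ℕ.m≤m+n k k)

    mate : ∀ {i} → i ℕ.< k ℕ.+ k → ∃[ j ] RimPair i j
    mate {i} i<2k with i ℕ.<? k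
    ... | yes i<k = k ℕ.+ i , inj₁ (i<k , ≡.refl)
    ... | no i≮k with ℕ.m≤n⇒∃[o]m+o≡n (ℕ.≮⇒≥ i≮k)
    ...   | j , ≡.refl = j , inj₂ (ℕ.+-cancelˡ-< k j k i<2k , ≡.refl)

    row : Fin (suc N) → Carrier
    row i = sum (λ j → adjacency G i j * (α * y i + β * y j))

    -- After substituting `rim` and `leaf` this row is `RootEquation`; it is the only row that uses
    -- `root`.
    hub-row : row zero ≈ r * hub
    hub-row = begin
      row zero
        ≈⟨ +-cong (trans (*-congʳ (indicator-no (adj? zero zero) (irrefl ≡.refl))) (zeroˡ _))
             (sum-cong λ j → trans (*-congʳ (indicator-yes (adj? zero (suc j)) (hub-adj j))) (*-identityˡ _)) ⟩
      0# + sum (λ j → α * hub + β * y (suc j))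
        ≈⟨ +-identityˡ _ ⟩
      sum (λ j → α * hub + β * y (suc j))
        ≈⟨ ∑-distrib-+ {N} (λ _ → α * hub) (λ j → β * y (suc j)) ⟩
      sum {N} (λ _ → α * hub) + sum (λ j → β * y (suc j))
        ≈⟨ +-cong (sum-const N (α * hub)) (trans (sym (*-distribˡ-sum β (λ j → y (suc j))))
             (*-congˡ (sum-threshold (k ℕ.+ k) p rim leaf))) ⟩
      fromℕ N * (α * hub) + β * (τ * rim + fromℕ p * leaf)
        ≈⟨ +-cong (*-congʳ (sym n-1≈N)) (*-congˡ (+-congˡ (*-congʳ (sym n-1-τ≈p)))) ⟩
      (n - 1#) * (α * hub) + β * (τ * rim + (n - 1# - τ) * leaf)
        ≈⟨ solve 8 (λ N p τ α β e h X →
             N :* (α :* h) :+ β :* (τ :* (β :* X) :+ p :* (β :* e)) :=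
             N :* (h :* α) :+ β :* β :* (p :* e :+ τ :* X)) refl (n - 1#) (n - 1# - τ) τ α β e hub (r - α) ⟩
      (n - 1#) * (hub * α) + β * β * ((n - 1# - τ) * e + τ * (r - α))
        ≈⟨ sym root ⟩
      hub * r
        ≈⟨ *-comm hub r ⟩
      r * hub ∎
      where
      n τ : Carrier
      n = fromℕ (suc N)
      τ = fromℕ (k ℕ.+ k)
      n-1≈N : n - 1# ≈ fromℕ N
      n-1≈N = trans (+-congʳ (fromℕ-suc N)) (solve 2 (λ a b → (a :+ b) :- a := b) refl 1# (fromℕ N))
      n-1-τ≈p : n - 1# - τ ≈ fromℕ p
      n-1-τ≈p = trans (+-congʳ (trans n-1≈N (fromℕ-+ (k ℕ.+ k) p)))
        (solve 2 (λ a b → (a :+ b) :- a := b) refl τ (fromℕ p))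

    spoke : ∀ i → adjacency G (suc i) zero * (α * y (suc i) + β * hub) ≈ α * y (suc i) + β * hub
    spoke i = trans (*-congʳ (indicator-yes (adj? (suc i) zero) (symm {zero} {suc i} (hub-adj i)))) (*-identityˡ _)

    rim-row : ∀ i → toℕ i ℕ.< k ℕ.+ k → row (suc i) ≈ r * y (suc i)
    rim-row i i<2k = begin
      row (suc i)
        ≈⟨ +-cong (spoke i) (sum-single m off-mate) ⟩
      (α * y (suc i) + β * hub) + adjacency G (suc i) (suc m) * (α * y (suc i) + β * y (suc m))
        ≈⟨ +-cong (+-congʳ (*-congˡ (y-rim i<2k)))
             (*-cong (indicator-yes (adj? (suc i) (suc m)) (pair⇒adj pair))
               (+-cong (*-congˡ (y-rim i<2k)) (*-congˡ (y-rim (proj₂ (pair-< pair)))))) ⟩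
      (α * rim + β * hub) + 1# * (α * rim + β * rim)
        ≈⟨ +-congˡ (*-identityˡ _) ⟩
      (α * rim + β * hub) + (α * rim + β * rim)
        ≈⟨ solve 4 (λ α β e X → (α :* (β :* X) :+ β :* (e :* X)) :+ (α :* (β :* X) :+ β :* (β :* X))
             := (α :+ α :+ e :+ β) :* (β :* X)) refl α β e (r - α) ⟩
      (α + α + e + β) * rim
        -- Here the value of `e` enters: `2α + (r-1-α) + (1-α) = r`.
        ≈⟨ *-congʳ (trans (+-congʳ (+-congˡ e≈)) (solve 3 (λ α r o →
             α :+ α :+ (r :- o :- α) :+ (o :- α) := r) refl α r 1#)) ⟩
      r * rim
        ≈⟨ *-congˡ (sym (y-rim i<2k)) ⟩
      r * y (suc i) ∎
      where
      e≈ : e ≈ r - 1# - α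
      e≈ = Sum.[ (λ { ≡.refl → contradiction i<2k λ () }) , (λ h → h) ]′ e-cases
      m<N : proj₁ (mate i<2k) ℕ.< N
      m<N = ℕ.≤-trans (proj₂ (pair-< (proj₂ (mate i<2k)))) (ℕ.m≤m+n (k ℕ.+ k) p)
      m : Fin N
      m = fromℕ< m<N
      pair : RimPair (toℕ i) (toℕ m)
      pair = ≡.subst (RimPair (toℕ i)) (≡.sym (Fin.toℕ-fromℕ< m<N)) (proj₂ (mate i<2k))
      off-mate : ∀ j → j ≢ m → adjacency G (suc i) (suc j) * (α * y (suc i) + β * y (suc j)) ≈ 0#
      off-mate j j≢m = trans (*-congʳ (indicator-no (adj? (suc i) (suc j))
        λ a → j≢m (Fin.toℕ-injective (pair-unique (adj⇒pair a) pair)))) (zeroˡ _)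

    leaf-row : ∀ i → ¬ toℕ i ℕ.< k ℕ.+ k → row (suc i) ≈ r * y (suc i)
    leaf-row i i≮2k = begin
      row (suc i)
        ≈⟨ +-cong (spoke i) (sum-zero λ j → trans (*-congʳ (indicator-no (adj? (suc i) (suc j))
             λ a → i≮2k (proj₁ (pair-< (adj⇒pair a))))) (zeroˡ _)) ⟩
      (α * y (suc i) + β * hub) + 0#
        ≈⟨ +-identityʳ _ ⟩
      α * y (suc i) + β * hub
        ≈⟨ +-congʳ (*-congˡ (y-leaf i≮2k)) ⟩
      α * leaf + β * hub
        ≈⟨ solve 4 (λ α β e r → α :* (β :* e) :+ β :* (e :* (r :- α)) := r :* (β :* e)) refl α β e r ⟩
      r * leaf
        ≈⟨ *-congˡ (sym (y-leaf i≮2k)) ⟩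
      r * y (suc i) ∎

    eigenvector : ∀ i → row i ≈ r * y i
    eigenvector zero    = hub-row
    eigenvector (suc i) with toℕ i ℕ.<? k ℕ.+ k
    ... | yes i<2k = rim-row i i<2k
    ... | no i≮2k  = leaf-row i i≮2k

-- The eigenvalue bound for a cactus.

module Bound (R : RealRing) where
  open import Defs using (Graph; Cᶜ; IsCactus; HasCycleCount)
  open RationalLemmas using (0<*)
  open Ordered R
  open QuadraticForm R
  open SecularRoot R using (RootOf; root-of)
  open Extremal R
  open Cactus using (BreadthFirstTree; module Matching)
  open import Relation.Binary.Reasoning.Setoid setoid

  private
    x≈1+0+0 : ∀ {x a b c} → x ≈ 1# → a ≈ 1# → b ≈ 0# → c ≈ 0# → x ≈ a + b + c
    x≈1+0+0 x a b c = trans x (sym (trans (+-cong (trans (+-cong a b) (+-identityʳ 1#)) c) (+-identityʳ 1#)))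

    x≈0+1+0 : ∀ {x a b c} → x ≈ 1# → a ≈ 0# → b ≈ 1# → c ≈ 0# → x ≈ a + b + c
    x≈0+1+0 x a b c = trans x (sym (trans (+-cong (trans (+-cong a b) (+-identityˡ 1#)) c) (+-identityʳ 1#)))

    x≈0+0+1 : ∀ {x a b c} → x ≈ 1# → a ≈ 0# → b ≈ 0# → c ≈ 1# → x ≈ a + b + c
    x≈0+0+1 x a b c = trans x (sym (trans (+-cong (trans (+-cong a b) (+-identityˡ 0#)) c) (+-identityˡ 1#)))

    x≈0+0+0 : ∀ {x a b c} → x ≈ 0# → a ≈ 0# → b ≈ 0# → c ≈ 0# → x ≈ a + b + c
    x≈0+0+0 x a b c = trans x (sym (trans (+-cong (trans (+-cong a b) (+-identityˡ 0#)) c) (+-identityˡ 0#)))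

  term≤sum : ∀ {n} {f : Fin n → Carrier} → (∀ i → 0# ≤ f i) → ∀ i → f i ≤ sum f
  term≤sum {suc n} {f} 0≤f zero    = ≤-respˡ (+-identityʳ (f zero))
    (+-mono-≤ ≤-refl (≤-respˡ (sum-zero {n} λ _ → refl) (sum-mono (0≤f ∘ suc))))
  term≤sum {suc n} {f} 0≤f (suc i) = ≤-respˡ (+-identityˡ (f (suc i)))
    (+-mono-≤ (0≤f zero) (term≤sum (0≤f ∘ suc) i))

  module _ {n} {G : Graph n} {v} (tree : BreadthFirstTree G v)
    (cactus : IsCactus G) {k} (count : HasCycleCount G k) where
    open Graph G
    open BreadthFirstTree tree
    open Matching tree

    private
      -- The root is its own parent, so `P` has to exclude it explicitly.
      P N : Fin n → Fin n → Carrier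
      P i j = indicator (does (¬? (i Fin.≟ v) ×-dec p i Fin.≟ j))
      N i j = indicator (does (nonTree? i j))
      matched? : ∀ i → Dec (∃[ w ] NonTree i w)
      matched? i = Fin.any? (nonTree? i)
      d t : Fin n → Carrier
      d i = indicator (does (i Fin.≟ v))
      t i = indicator (does (matched? i))

      P-yes : ∀ {i j} → i ≢ v → p i ≡ j → P i j ≈ 1#
      P-yes {i} {j} i≢v e = indicator-yes (¬? (i Fin.≟ v) ×-dec p i Fin.≟ j) (i≢v , e)

      P-no : ∀ {i j} → ¬ (i ≢ v × p i ≡ j) → P i j ≈ 0#
      P-no {i} {j} = indicator-no (¬? (i Fin.≟ v) ×-dec p i Fin.≟ j)

      parent-adj : ∀ {i j} → i ≢ v × p i ≡ j → Adj i j
      parent-adj {i} (i≢v , e) = ≡.subst (Adj i) e (p-adj i≢v)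

      -- Levels would have to increase in both directions. Consequently a tree edge contributes to
      -- only one of `P i j` and `P j i`.
      ¬mutual : ∀ {i j} → i ≢ v × p i ≡ j → ¬ (j ≢ v × p j ≡ i)
      ¬mutual (i≢v , ≡.refl) (j≢v , e) = ℕ.<-irrefl (≡.trans (p-level j≢v) (≡.cong (suc ∘ ℓ) e))
        (ℕ.≤-trans (ℕ.≤-reflexive (≡.sym (p-level i≢v))) (ℕ.n≤1+n _))

      child≢v : ∀ {i j} → Adj i j → p i ≡ j → i ≢ v
      child≢v ij e ≡.refl = irrefl (≡.trans (≡.sym p-root) e) ij

      adjacency-split : ∀ i j → adjacency G i j ≈ P i j + P j i + N i j
      adjacency-split i j = by-adj (adj? i j)
        where
        by-tree : Adj i j → p i ≡ j ⊎ p j ≡ i → adjacency G i j ≈ P i j + P j i + N i j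
        by-tree ij (inj₁ e) = x≈1+0+0 (indicator-yes (adj? i j) ij) (P-yes (child≢v ij e) e)
          (P-no (¬mutual (child≢v ij e , e))) (indicator-no (nonTree? i j) λ (_ , pi≢j , _) → pi≢j e)
        by-tree ij (inj₂ e) = x≈0+1+0 (indicator-yes (adj? i j) ij)
          (P-no (¬mutual (child≢v (symm ij) e , e))) (P-yes (child≢v (symm ij) e) e)
          (indicator-no (nonTree? i j) λ (_ , _ , pj≢i) → pj≢i e)
        by-nonTree : Adj i j → Dec (NonTree i j) → adjacency G i j ≈ P i j + P j i + N i j
        by-nonTree ij (yes nt@(_ , pi≢j , pj≢i)) = x≈0+0+1 (indicator-yes (adj? i j) ij)
          (P-no (pi≢j ∘ proj₂)) (P-no (pj≢i ∘ proj₂)) (indicator-yes (nonTree? i j) nt)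
        by-nonTree ij (no ¬nt) = by-tree ij (tree-or-nonTree ij ¬nt)
        by-adj : Dec (Adj i j) → adjacency G i j ≈ P i j + P j i + N i j
        by-adj (yes ij) = by-nonTree ij (nonTree? i j)
        by-adj (no ¬ij) = x≈0+0+0 (indicator-no (adj? i j) ¬ij) (P-no (¬ij ∘ parent-adj))
          (P-no (¬ij ∘ symm ∘ parent-adj)) (indicator-no (nonTree? i j) (¬ij ∘ proj₁))

      P-row : ∀ i → sum (P i) ≈ 1# - d i
      P-row i = cases (i Fin.≟ v)
        where
        cases : Dec (i ≡ v) → sum (P i) ≈ 1# - d i
        cases (yes i≡v) = trans (sum-zero {f = P i} λ j → P-no {i} {j} λ (i≢v , _) → i≢v i≡v)
          (sym (trans (+-congˡ (-‿cong (indicator-yes (i Fin.≟ v) i≡v))) (-‿inverseʳ 1#)))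
        cases (no i≢v) = trans (sum-single (p i) λ j j≢ → P-no λ (_ , e) → j≢ (≡.sym e))
          (trans (P-yes i≢v ≡.refl) (sym (trans
            (+-congˡ (-‿cong (indicator-no (i Fin.≟ v) i≢v)))
            (trans (sym (+-identityʳ _)) (x-y+y≈x 1# 0#)))))

      N-row : ∀ i → sum (N i) ≈ t i
      N-row i = cases (matched? i)
        where
        cases : Dec (∃[ w ] NonTree i w) → sum (N i) ≈ t i
        cases (yes (w , nt)) = trans
          (sum-single w λ j j≢w → indicator-no (nonTree? i j) λ nt′ → j≢w (nonTree-unique cactus nt′ nt))
          (trans (indicator-yes (nonTree? i w) nt) (sym (indicator-yes (matched? i) (w , nt))))
        cases (no ¬m) = trans (sum-zero λ j → indicator-no (nonTree? i j) λ nt → ¬m (j , nt))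
          (sym (indicator-no (matched? i) ¬m))

      N-sym : ∀ i j → N i j ≈ N j i
      N-sym i j = cases (nonTree? i j)
        where
        cases : Dec (NonTree i j) → N i j ≈ N j i
        cases (yes nt) = trans (indicator-yes (nonTree? i j) nt)
          (sym (indicator-yes (nonTree? j i) (nonTree-swap nt)))
        cases (no ¬nt) = trans (indicator-no (nonTree? i j) ¬nt)
          (sym (indicator-no (nonTree? j i) (¬nt ∘ nonTree-swap)))

      d-sum : ∀ (g : Fin n → Carrier) → sum (λ i → d i * g i) ≈ g v
      d-sum g = trans
        (sum-single v λ j j≢v → trans (*-congʳ (indicator-no (j Fin.≟ v) j≢v)) (zeroˡ (g j)))
        (trans (*-congʳ (indicator-yes (v Fin.≟ v) ≡.refl)) (*-identityˡ (g v)))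

      t-v : t v ≈ 0#
      t-v = indicator-no (matched? v) λ (_ , nt) → nonTree⇒≢v nt ≡.refl

      end : Fin (k ℕ.+ k) → Fin n
      end = ends cactus count

      -- Double counting: as `end` enumerates the matched vertices without repetition, `t i` is the
      -- number of `j` with `end j ≡ i`, and summing over `i` first gives one for each `j`.
      t-sum : sum t ≈ fromℕ (k ℕ.+ k)
      t-sum = begin
        sum t
          ≈⟨ sum-cong (λ i → hits i (matched? i)) ⟩
        sum (λ i → sum (λ j → indicator (does (end j Fin.≟ i))))
          ≈⟨ ∑-comm (λ i j → indicator (does (end j Fin.≟ i))) ⟩
        sum (λ j → sum (λ i → indicator (does (end j Fin.≟ i))))
          ≈⟨ sum-cong (λ j → trans
               (sum-single (end j) λ i i≢ → indicator-no (end j Fin.≟ i) (i≢ ∘ ≡.sym))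
               (indicator-yes (end j Fin.≟ end j) ≡.refl)) ⟩
        sum {k ℕ.+ k} (λ _ → 1#)
          ≈⟨ trans (sum-const (k ℕ.+ k) 1#) (*-identityʳ _) ⟩
        fromℕ (k ℕ.+ k) ∎
        where
        hits : ∀ i → Dec (∃[ w ] NonTree i w) → t i ≈ sum (λ j → indicator (does (end j Fin.≟ i)))
        hits i (yes (w , nt)) =
          let j , ej≡i = ends-surjective cactus count nt
          in trans (indicator-yes (matched? i) (w , nt)) (sym (trans
               (sum-single j λ j′ j′≢j → indicator-no (end j′ Fin.≟ i)
                 λ e → j′≢j (ends-injective cactus count (≡.trans e (≡.sym ej≡i))))
               (indicator-yes (end j Fin.≟ i) ej≡i)))
        hits i (no ¬m) = trans (indicator-no (matched? i) ¬m) (sym (sum-zero λ j →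
          indicator-no (end j Fin.≟ i) λ e → ¬m (≡.subst (λ i → ∃[ w ] NonTree i w) e
            (ends-nonTree cactus count j))))

    -- The form estimate says `S D (μ - r) ≤ 0`. Were `μ - r ≥ δ > 0`, cancelling `δ` and `D` would
    -- give `S ≤ 0` and every `x i` would vanish. So `μ - r ≤ δ` for each positive `δ`.
    eigenvalue-bound : ∀ α r e c → 0# ≤ α → 0# ≤ 1# - α → 0ℚ ℚ.< c → ι c ≤ e → ι c ≤ r - α →
      RootEquation α r e (fromℕ n) (fromℕ (k ℕ.+ k)) → k ≡ 0 ⊎ e ≈ r - 1# - α →
      ∀ μ (x : Fin n → Carrier) → (∀ i → x i * x i ≤ x v * x v) → ¬ (∀ i → x i ≈ 0#) →
      (∀ i → sum (λ j → adjacency G i j * (α * x i + (1# - α) * x j)) ≈ μ * x i) → μ ≤ r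
    eigenvalue-bound α r e c 0≤α 0≤β 0<c c≤e c≤r-α root e-cases μ x x-max x≉0 eigen =
      0≤-⇒≤ (neg≤0⇒0≤′ (archimedean λ δ 0<δ → ≤-stable λ ¬h → ≤-total (μ - r) (ι δ) Sum.[ ¬h ,
        (λ δ≤μ-r → x≉0 λ i → square≤0⇒≈0 (≤-trans
          (term≤sum {f = λ i → x i * x i} (λ i → square-nonNeg (x i)) i)
          (*-cancel-≤0 (0<* 0<c 0<c) c²≤D (*-cancel-≤0 0<δ δ≤μ-r S*D*[μ-r]≤0)))) ]))
      where
      D S : Carrier
      D = e * (r - α)
      S = sum (λ i → x i * x i)
      0≤c : 0# ≤ ι c
      0≤c = ι-nonNeg (ℚ.<⇒≤ 0<c)
      c²≤D : ι (c ℚ.* c) ≤ D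
      c²≤D = ≤-respˡ (sym (ι-* c c)) (*-mono-≤ 0≤c 0≤c c≤e c≤r-α)
      neg≤0⇒0≤′ : μ - r ≤ 0# → 0# ≤ r - μ
      neg≤0⇒0≤′ h = neg≤0⇒0≤ (≤-respˡ (solve 2 (λ μ r → μ :- r := :- (r :- μ)) refl μ r) h)

      -- For `k = 0` there are no ends, hence no matched vertex; a matched vertex therefore selects
      -- the second alternative of `e-cases`.
      t-cases : ∀ i → t i ≈ 0# ⊎ (t i ≈ 1# × e ≈ r - 1# - α)
      t-cases i = cases (matched? i)
        where
        cases : Dec (∃[ w ] NonTree i w) → t i ≈ 0# ⊎ (t i ≈ 1# × e ≈ r - 1# - α)
        cases (no ¬m) = inj₁ (indicator-no (matched? i) ¬m)
        cases (yes m@(_ , nt)) = inj₂ (indicator-yes (matched? i) m , Sum.[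
          (λ { ≡.refl → contradiction (proj₁ (ends-surjective cactus count nt)) Fin.¬Fin0 }) ,
          (λ h → h) ]′ e-cases)

      form : sum₂ (λ i j → (P i j + P j i + N i j) * (x i * (α * x i + (1# - α) * x j))) ≈ μ * S
      form = trans (sum-cong λ i → begin
        sum (λ j → (P i j + P j i + N i j) * (x i * (α * x i + (1# - α) * x j)))
          ≈⟨ sum-cong (λ j → trans (*-congʳ (sym (adjacency-split i j)))
               (solve 3 (λ a x y → a :* (x :* y) := x :* (a :* y)) refl
                 (adjacency G i j) (x i) (α * x i + (1# - α) * x j))) ⟩
        sum (λ j → x i * (adjacency G i j * (α * x i + (1# - α) * x j)))
          ≈⟨ sym (*-distribˡ-sum (x i) (λ j → adjacency G i j * (α * x i + (1# - α) * x j))) ⟩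
        x i * sum (λ j → adjacency G i j * (α * x i + (1# - α) * x j))
          ≈⟨ *-congˡ (eigen i) ⟩
        x i * (μ * x i)
          ≈⟨ solve 2 (λ x μ → x :* (μ :* x) := μ :* (x :* x)) refl (x i) μ ⟩
        μ * (x i * x i) ∎)
        (sym (*-distribˡ-sum μ (λ i → x i * x i)))

      bound : D * (μ * S) ≤ D * r * S
      bound = ≤-respˡ (*-congˡ form) (quadratic-form-bound α r e (fromℕ (k ℕ.+ k))
        0≤α 0≤β (≤-trans 0≤c c≤e) (≤-trans 0≤c c≤r-α) root P N d t x v
        (λ i j → indicator-nonNeg (does (¬? (i Fin.≟ v) ×-dec p i Fin.≟ j)))
        (λ i j → indicator-nonNeg (does (nonTree? i j))) N-sym P-row N-row d-sum t-v t-sum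
        t-cases x-max)

      S*D*[μ-r]≤0 : (S * D) * (μ - r) ≤ 0#
      S*D*[μ-r]≤0 = ≤-respˡ (solve 4 (λ D μ r S → D :* (μ :* S) :- D :* r :* S := (S :* D) :* (μ :- r))
        refl D μ r S) (≤-respʳ (-‿inverseʳ (D * r * S)) (+-mono-≤ bound ≤-refl))

  -- A single vertex has no neighbours, so the rows of both matrices agree.
  eigenvector₁ : (G H : Graph 1) → ∀ α μ x → Eigenvector G α μ x → Eigenvector H α μ x
  eigenvector₁ G H α μ x (x≉0 , eigen) = x≉0 , λ i →
    trans (matrix-row H α x i) (trans (sum-cong λ j → *-congʳ {α * x i + (1# - α) * x j} (trans (no-loop H i j) (sym (no-loop G i j))))
      (trans (sym (matrix-row G α x i)) (eigen i)))
    where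
    no-loop : ∀ (G : Graph 1) i j → adjacency G i j ≈ 0#
    no-loop G zero zero = indicator-no (Graph.adj? G zero zero) (Graph.irrefl G ≡.refl)

  extremal-bound : ∀ k p → 1 ℕ.≤ k ℕ.+ k ℕ.+ p → ∀ {G : Graph (suc (k ℕ.+ k ℕ.+ p))} {v} →
    BreadthFirstTree G v → IsCactus G → HasCycleCount G k →
    ∀ α c → 0# ≤ α → 0ℚ ℚ.< c → ι c ≤ 1# - α → ∀ μ x →
    (∀ i → x i * x i ≤ x v * x v) → Eigenvector G α μ x →
    ∃[ r ] (μ ≤ r × ∃[ y ] Eigenvector (Cᶜ (suc (k ℕ.+ k ℕ.+ p)) k) α r y)
  extremal-bound k p 1≤N {G} tree cactus count α c 0≤α 0<c c≤β μ x x-max (x≉0 , eigen) =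
    compare (root-of α c 0≤α 0<c c≤β k p 1≤N)
    where
    -- The axioms of `RealRing` admit the zero ring; that it is not the case here is drawn from the
    -- nonzero vector `x`.
    positive≰0 : ∀ {q} → 0ℚ ℚ.< q → ¬ ι q ≤ 0#
    positive≰0 {q} 0<q h = x≉0 λ i → square≤0⇒≈0 (*-cancel-≤0 0<q ≤-refl
      (≤-respʳ (zeroʳ (x i * x i)) (*-monoˡ-≤ (square-nonNeg (x i)) h)))
    compare : RootOf α (suc (k ℕ.+ k ℕ.+ p)) k →
      ∃[ r ] (μ ≤ r × ∃[ y ] Eigenvector (Cᶜ (suc (k ℕ.+ k ℕ.+ p)) k) α r y)
    compare (r , e , c′ , 0<c′ , c′≤e , c′≤r-α , root , e-cases) =
      r , eigenvalue-bound tree cactus count α r e c′ 0≤α (≤-trans (ι-nonNeg (ℚ.<⇒≤ 0<c)) c≤β)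
            0<c′ c′≤e c′≤r-α root e-cases μ x x-max x≉0
            (λ i → trans (sym (matrix-row G α x i)) (eigen i)) ,
      y , (λ y≈0 → positive≰0 (0<* 0<c′ 0<c′) (≤-trans c′²≤hub (≤-reflexive (y≈0 Fin.zero)))) ,
      λ i → trans (matrix-row (Cᶜ (suc (k ℕ.+ k ℕ.+ p)) k) α y i) (eigenvector i)
      where
      open Windmill k p α r e root e-cases using (y; hub; eigenvector)
      0≤c′ : 0# ≤ ι c′
      0≤c′ = ι-nonNeg (ℚ.<⇒≤ 0<c′)
      c′²≤hub : ι (c′ ℚ.* c′) ≤ hub
      c′²≤hub = ≤-respˡ (sym (ι-* c′ c′)) (*-mono-≤ 0≤c′ 0≤c′ c′≤e c′≤r-α)

  -- On one vertex the bracket `[1, n]` for the root degenerates; there `μ` itself is an eigenvalue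
  -- of `Cᶜ`. All other cases have at least two vertices.
  dominating-eigenvalue : ∀ k p {G : Graph (suc (k ℕ.+ k ℕ.+ p))} {v} →
    BreadthFirstTree G v → IsCactus G → HasCycleCount G k →
    ∀ α c → 0# ≤ α → 0ℚ ℚ.< c → ι c ≤ 1# - α → ∀ μ x →
    (∀ i → x i * x i ≤ x v * x v) → Eigenvector G α μ x →
    ∃[ r ] (μ ≤ r × ∃[ y ] Eigenvector (Cᶜ (suc (k ℕ.+ k ℕ.+ p)) k) α r y)
  dominating-eigenvalue zero zero {G} _ _ _ α _ _ _ _ μ x _ eigen =
    μ , ≤-refl , x , eigenvector₁ G (Cᶜ 1 0) α μ x eigen
  dominating-eigenvalue zero    (suc p) = extremal-bound zero (suc p) (ℕ.s≤s ℕ.z≤n)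
  dominating-eigenvalue (suc k) p       = extremal-bound (suc k) p (ℕ.s≤s ℕ.z≤n)

-- Cauchy sequences form a real ring.

module RealInstance where
  open import Defs hiding (fromℕ; sum)
  open RationalLemmas
  open ≡ using (refl; sym; trans; cong; subst; subst₂)

  Eventually : (ℕ → Set) → Set
  Eventually P = ∃[ N ] (∀ n → N ℕ.≤ n → P n)

  always : ∀ {P : ℕ → Set} → (∀ n → P n) → Eventually P
  always p = 0 , λ n _ → p n

  eventually-zip : ∀ {P Q R : ℕ → Set} → (∀ n → P n → Q n → R n) →
    Eventually P → Eventually Q → Eventually R
  eventually-zip f (M , p) (N , q) = M ℕ.⊔ N , λ n le →
    f n (p n (ℕ.m⊔n≤o⇒m≤o M N le)) (q n (ℕ.m⊔n≤o⇒n≤o M N le))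

  eventually-map : ∀ {P Q : ℕ → Set} → (∀ n → P n → Q n) →
    Eventually P → Eventually Q
  eventually-map f (N , p) = N , λ n le → f n (p n le)

  -- `x ≈ y` unfolds to `Null` of the termwise difference, so transitivity and the congruence laws
  -- for sums and products reduce to closure properties of null sequences.
  Null : (ℕ → ℚ) → Set
  Null s = ∀ ε → 0ℚ ℚ.< ε → Eventually (λ n → ℚ.∣ s n ∣ ℚ.< ε)

  null-resp : ∀ {s t} → (∀ n → s n ≡ t n) → Null s → Null t
  null-resp e h ε 0<ε = eventually-map (λ n → subst (λ z → ℚ.∣ z ∣ ℚ.< ε) (e n)) (h ε 0<ε)

  null-+ : ∀ {s t} → Null s → Null t → Null (λ n → s n ℚ.+ t n)
  null-+ {s} {t} hs ht ε 0<ε = eventually-zip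
    (λ n a b → subst (ℚ.∣ s n ℚ.+ t n ∣ ℚ.<_) (half+half ε)
      (ℚ.≤-<-trans (ℚ.∣p+q∣≤∣p∣+∣q∣ (s n) (t n)) (ℚ.+-mono-< a b)))
    (hs (half ε) (half-pos 0<ε)) (ht (half ε) (half-pos 0<ε))

  ∣seq∣-bounded : ∀ x → ∃[ K ] (0ℚ ℚ.< K × Eventually (λ n → ℚ.∣ seq x n ∣ ℚ.< K))
  ∣seq∣-bounded x with cauchy x 1ℚ (ℚ.positive⁻¹ 1ℚ)
  ... | N , close = ℚ.∣ seq x N ∣ ℚ.+ 1ℚ ,
    ℚ.+-mono-≤-< (ℚ.0≤∣p∣ (seq x N)) (ℚ.positive⁻¹ 1ℚ) , N , λ n N≤n →
    subst (λ z → ℚ.∣ z ∣ ℚ.< ℚ.∣ seq x N ∣ ℚ.+ 1ℚ)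
      (add-sub (seq x n) (seq x N))
      (ℚ.≤-<-trans (ℚ.∣p+q∣≤∣p∣+∣q∣ (seq x N) (seq x n ℚ.- seq x N))
        (ℚ.+-monoʳ-< ℚ.∣ seq x N ∣ (close n N N≤n ℕ.≤-refl)))

  null-* : ∀ x {s} → Null s → Null (λ n → seq x n ℚ.* s n)
  null-* x {s} hs ε 0<ε =
    let K , 0<K , x<K   = ∣seq∣-bounded x
        δ , 0<δ , Kδ≡ε = divide K ε 0<K 0<ε
    in eventually-zip (λ n a b → subst (ℚ.∣ seq x n ℚ.* s n ∣ ℚ.<_) Kδ≡ε
         (∣*∣< (seq x n) (s n) 0<K a b)) x<K (hs δ 0<δ)

  pointwise : ∀ {x y} → (∀ n → seq x n ≡ seq y n) → x ≈ y
  pointwise {x} {y} e ε 0<ε = always λ n → subst (λ z → ℚ.∣ z ∣ ℚ.< ε)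
    (sym (trans (cong (ℚ._- seq y n) (e n)) (ℚ.+-inverseʳ (seq y n)))) 0<ε

  ≈-sym : ∀ {x y} → x ≈ y → y ≈ x
  ≈-sym {x} {y} h ε 0<ε = eventually-map
    (λ n → subst (ℚ._< ε) (∣-∣-swap (seq x n) (seq y n))) (h ε 0<ε)

  ≈-trans : ∀ {x y z} → x ≈ y → y ≈ z → x ≈ z
  ≈-trans {x} {y} {z} h k = null-resp
    (λ n → sub-telescope
      (seq x n) (seq y n) (seq z n)) (null-+ h k)

  +ℝ-cong : ∀ {x y u v} → x ≈ y → u ≈ v → x +ℝ u ≈ y +ℝ v
  +ℝ-cong {x} {y} {u} {v} h k = null-resp
    (λ n → sub-sum
      (seq x n) (seq y n) (seq u n) (seq v n)) (null-+ h k)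

  *ℝ-cong : ∀ {x y u v} → x ≈ y → u ≈ v → x *ℝ u ≈ y *ℝ v
  *ℝ-cong {x} {y} {u} {v} h k = null-resp
    (λ n → sub-product
      (seq x n) (seq y n) (seq u n) (seq v n))
    (null-+ (null-* x k) (null-* v h))

  -ℝ-cong : ∀ {x y} → x ≈ y → -ℝ x ≈ -ℝ y
  -ℝ-cong {x} {y} h ε 0<ε = eventually-map
    (λ n → subst (λ z → z ℚ.< ε)
      (trans (sym (ℚ.∣-p∣≡∣p∣ (seq x n ℚ.- seq y n))) (cong ℚ.∣_∣
        (sub-neg (seq x n) (seq y n)))))
    (h ε 0<ε)

  ≈⇒≤ : ∀ {x y} → x ≈ y → x ≤ℝ y
  ≈⇒≤ {x} {y} h ε 0<ε = eventually-map
    (λ n a → subst (ℚ._< seq y n ℚ.+ ε)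
      (add-sub (seq x n) (seq y n))
      (ℚ.+-monoʳ-< (seq y n) (∣∣<⇒< a)))
    (h ε 0<ε)

  ≤ℝ-trans : ∀ {x y z} → x ≤ℝ y → y ≤ℝ z → x ≤ℝ z
  ≤ℝ-trans {x} {y} {z} h k ε 0<ε = eventually-zip
    (λ n a b → subst (seq x n ℚ.<_)
      (trans (ℚ.+-assoc (seq z n) (half ε) (half ε)) (cong (seq z n ℚ.+_) (half+half ε)))
      (ℚ.<-trans a (ℚ.+-monoˡ-< (half ε) b)))
    (h (half ε) (half-pos 0<ε)) (k (half ε) (half-pos 0<ε))

  ≤ℝ-antisym : ∀ {x y} → x ≤ℝ y → y ≤ℝ x → x ≈ y
  ≤ℝ-antisym {x} {y} h k ε 0<ε = eventually-zip
    (λ n a b → ∣∣<-intro (lemma (seq x n) (seq y n) a)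
      (subst (ℚ._< ε) (sym (neg-sub (seq x n) (seq y n)))
        (lemma (seq y n) (seq x n) b)))
    (h ε 0<ε) (k ε 0<ε)
    where
    lemma : ∀ p q → p ℚ.< q ℚ.+ ε → p ℚ.- q ℚ.< ε
    lemma p q h = subst (p ℚ.- q ℚ.<_)
      (add-sub-cancelˡ q ε) (ℚ.+-monoˡ-< (ℚ.- q) h)

  +ℝ-mono-≤ : ∀ {x y u v} → x ≤ℝ y → u ≤ℝ v → x +ℝ u ≤ℝ y +ℝ v
  +ℝ-mono-≤ {x} {y} {u} {v} h k ε 0<ε = eventually-zip
    (λ n a b → subst (seq x n ℚ.+ seq u n ℚ.<_)
      (trans (sum-shift
        (seq y n) (seq v n) (half ε))
        (cong ((seq y n ℚ.+ seq v n) ℚ.+_) (half+half ε)))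
      (ℚ.+-mono-< a b))
    (h (half ε) (half-pos 0<ε)) (k (half ε) (half-pos 0<ε))

  *ℝ-nonNeg : ∀ {x y} → 0ℝ ≤ℝ x → 0ℝ ≤ℝ y → 0ℝ ≤ℝ x *ℝ y
  *ℝ-nonNeg {x} {y} hx hy ε 0<ε =
    let K , 0<K , x<K   = ∣seq∣-bounded x
        L , 0<L , y<L   = ∣seq∣-bounded y
        δ , 0<δ , Kδ≡ε = divide K ε 0<K 0<ε
        η , 0<η , Lη≡ε = divide L ε 0<L 0<ε
    in eventually-zip
         (λ n (a , b) (c , d) →
           product-bound 0<ε 0<K 0<L 0<δ 0<η Kδ≡ε Lη≡ε (seq x n) (seq y n) a b c d)
         (eventually-zip (λ _ → _,_) x<K (hx η 0<η))
         (eventually-zip (λ _ → _,_) y<L (hy δ 0<δ))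

  square-nonNegℝ : ∀ x → 0ℝ ≤ℝ x *ℝ x
  square-nonNegℝ x ε 0<ε = always λ n → ℚ.+-mono-≤-< (square-nonNegℚ (seq x n)) 0<ε

  squareℝ≤0⇒≈0 : ∀ {x} → x *ℝ x ≤ℝ 0ℝ → x ≈ 0ℝ
  squareℝ≤0⇒≈0 {x} h ε 0<ε = eventually-map
    (λ n a → subst (λ z → ℚ.∣ z ∣ ℚ.< ε) (sym (ℚ.+-identityʳ (seq x n)))
      (small (seq x n) (subst (seq x n ℚ.* seq x n ℚ.<_) (ℚ.+-identityˡ (ε ℚ.* ε)) a)))
    (h (ε ℚ.* ε) (0<* 0<ε 0<ε))
    where
    small : ∀ p → p ℚ.* p ℚ.< ε ℚ.* ε → ℚ.∣ p ∣ ℚ.< ε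
    small p h with ℚ.∣ p ∣ ℚ.<? ε
    ... | yes a = a
    ... | no a = contradiction h (ℚ.<-irrefl refl ∘ λ h → ℚ.<-≤-trans h
      (subst (ε ℚ.* ε ℚ.≤_) (∣p∣²≡p²)
        (ℚ.≤-trans (ℚ.*-monoˡ-≤-nonNeg ε {{ℚ.nonNegative (ℚ.<⇒≤ 0<ε)}} (ℚ.≮⇒≥ a))
          (ℚ.*-monoʳ-≤-nonNeg ℚ.∣ p ∣ {{ℚ.∣-∣-nonNeg p}} (ℚ.≮⇒≥ a)))))
      where
      ∣p∣²≡p² : ℚ.∣ p ∣ ℚ.* ℚ.∣ p ∣ ≡ p ℚ.* p
      ∣p∣²≡p² = trans (sym (ℚ.∣p*q∣≡∣p∣*∣q∣ p p)) (ℚ.0≤p⇒∣p∣≡p (square-nonNegℚ p))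

  fromℚ-mono : ∀ {p q} → p ℚ.≤ q → fromℚ p ≤ℝ fromℚ q
  fromℚ-mono {p} {q} h ε 0<ε = always λ _ →
    subst (ℚ._< q ℚ.+ ε) (ℚ.+-identityʳ p) (ℚ.+-mono-≤-< h 0<ε)

  -- Comparing single sufficiently late terms of x and y decides the order up to ε.
  compare : ∀ x y ε → 0ℚ ℚ.< ε →
    Eventually (λ n → seq x n ℚ.< seq y n ℚ.+ ε) ⊎ y <ℝ x
  compare x y ε 0<ε =
    let θ , 0<θ , 5θ≡ε = divide (1ℚ ℚ.+ 1ℚ ℚ.+ 1ℚ ℚ.+ 1ℚ ℚ.+ 1ℚ) ε (ℚ.positive⁻¹ _) 0<ε
        M , x-close = cauchy x θ 0<θ
        N , y-close = cauchy y θ 0<θ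
        M≤ = ℕ.m≤m⊔n M N
        N≤ = ℕ.m≤n⊔m M N
    in decide θ 0<θ (trans (sym (five θ)) 5θ≡ε) (M ℕ.⊔ N)
         (λ n le → x-close n (M ℕ.⊔ N) (ℕ.≤-trans M≤ le) M≤)
         (λ n le → y-close n (M ℕ.⊔ N) (ℕ.≤-trans N≤ le) N≤)
    where
    decide : ∀ θ → 0ℚ ℚ.< θ → θ ℚ.+ θ ℚ.+ θ ℚ.+ θ ℚ.+ θ ≡ ε → ∀ K →
      (∀ n → K ℕ.≤ n → ℚ.∣ seq x n ℚ.- seq x K ∣ ℚ.< θ) →
      (∀ n → K ℕ.≤ n → ℚ.∣ seq y n ℚ.- seq y K ∣ ℚ.< θ) →
      Eventually (λ n → seq x n ℚ.< seq y n ℚ.+ ε) ⊎ y <ℝ x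
    decide θ 0<θ 5θ≡ε K x-close y-close with seq x K ℚ.<? seq y K ℚ.+ (θ ℚ.+ θ ℚ.+ θ)
    ... | yes a = inj₁ (K , λ n le → 0<⇒< (subst (λ e → 0ℚ ℚ.< (seq y n ℚ.+ e) ℚ.- seq x n) 5θ≡ε
      (subst (0ℚ ℚ.<_) (gap-upper (seq x n) (seq x K) (seq y n) (seq y K) θ)
        (0<+ (0<+ (<⇒0< (∣∣<⇒< (x-close n le))) (<⇒0< (∣∣<⇒-< (y-close n le)))) (<⇒0< a)))))
    ... | no a = inj₂ (θ , 0<θ , K , λ n le → 0<⇒< (subst (0ℚ ℚ.<_)
        (gap-lower (seq x n) (seq x K) (seq y n) (seq y K) θ)
        (ℚ.+-mono-<-≤ (0<+ (<⇒0< (∣∣<⇒-< (x-close n le))) (<⇒0< (∣∣<⇒< (y-close n le))))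
          (≤⇒0≤ (ℚ.≮⇒≥ a)))))

  <⇒≤ℝ : ∀ {x y} → x <ℝ y → x ≤ℝ y
  <⇒≤ℝ {x} {y} (δ , 0<δ , h) ε 0<ε = eventually-map
    (λ n a → ℚ.<-trans (p<p+q 0<δ) (ℚ.<-trans a (p<p+q 0<ε))) h

  ≤⇒≮ : ∀ {x y} → x ≤ℝ y → ¬ (y <ℝ x)
  ≤⇒≮ {x} {y} h (δ , 0<δ , k) =
    let N , p = eventually-zip {R = λ _ → seq x 0 ℚ.< seq x 0}
          (λ n a b → contradiction (ℚ.<-trans a b) (ℚ.<-irrefl refl)) (h δ 0<δ) k
    in ℚ.<-irrefl refl (p N ℕ.≤-refl)

  -- If both alternatives fail, `compare` can never answer `y <ℝ x`, so at every `ε` it yields the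
  -- bound for `x ≤ℝ y`.
  ≤ℝ-total : ∀ x y → ¬ ¬ (x ≤ℝ y ⊎ y ≤ℝ x)
  ≤ℝ-total x y ¬h = ¬h (inj₁ λ ε 0<ε → Sum.[ (λ p → p) ,
    (λ q → contradiction (inj₂ (<⇒≤ℝ {y} {x} q)) ¬h) ] (compare x y ε 0<ε))

  ≤ℝ-stable : ∀ {x y} → ¬ ¬ (x ≤ℝ y) → x ≤ℝ y
  ≤ℝ-stable {x} {y} ¬¬h ε 0<ε = Sum.[ (λ p → p) ,
    (λ q → contradiction (λ h → ≤⇒≮ {x} {y} h q) ¬¬h) ] (compare x y ε 0<ε)

  -- `x + δ` is compared with zero up to the error `δ`: either `x + δ < δ` eventually, so `x ≤ 0`,
  -- or `0 < x + δ ≤ y`.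
  separatedℝ : ∀ {x y δ} → 0ℚ ℚ.< δ → x +ℝ fromℚ δ ≤ℝ y → x ≤ℝ 0ℝ ⊎ 0ℝ ≤ℝ y
  separatedℝ {x} {y} {δ} 0<δ h = Sum.map
    (λ x+δ<δ ε 0<ε → eventually-map
      (λ n a → ℚ.<-trans (subst₂ ℚ._<_ (add-sub-cancelʳ (seq x n) δ) (add-sub-cancelʳ 0ℚ δ) (ℚ.+-monoˡ-< (ℚ.- δ) a))
        (subst (0ℚ ℚ.<_) (sym (ℚ.+-identityˡ ε)) 0<ε)) x+δ<δ)
    (λ 0<x+δ → ≤ℝ-trans {0ℝ} {x +ℝ fromℚ δ} {y} (<⇒≤ℝ {0ℝ} {x +ℝ fromℚ δ} 0<x+δ) h)
    (compare (x +ℝ fromℚ δ) 0ℝ δ 0<δ)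

  archimedeanℝ : ∀ {x} → (∀ δ → 0ℚ ℚ.< δ → x ≤ℝ fromℚ δ) → x ≤ℝ 0ℝ
  archimedeanℝ {x} h ε 0<ε = eventually-map
    (λ n a → subst (seq x n ℚ.<_) (trans (half+half ε) (sym (ℚ.+-identityˡ ε))) a)
    (h (half ε) (half-pos 0<ε) (half ε) (half-pos 0<ε))

  boundedℝ : ∀ x → ∃[ K ] (0ℚ ℚ.< K × x ≤ℝ fromℚ K)
  boundedℝ x =
    let K , 0<K , x<K = ∣seq∣-bounded x
    in K , 0<K , λ ε 0<ε → eventually-map
      (λ n a → ℚ.<-trans (∣∣<⇒< a) (p<p+q 0<ε)) x<K

  monotone : ∀ (u : ℕ → ℚ) → (∀ n → u (suc n) ℚ.≤ u n) → ∀ {m n} → m ℕ.≤ n → u n ℚ.≤ u m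
  monotone u desc m≤n = go (ℕ.≤⇒≤′ m≤n)
    where
    go : ∀ {m n} → m ℕ.≤′ n → u n ℚ.≤ u m
    go ℕ.≤′-refl       = ℚ.≤-refl
    go (ℕ.≤′-step m≤n) = ℚ.≤-trans (desc _) (go m≤n)

  -- The sequence of left ends is itself the real number sought: beyond `N`, any two of its terms
  -- differ by at most `u N - l N`.
  nestedℝ : ∀ (l u : ℕ → ℚ) → (∀ n → l n ℚ.≤ l (suc n)) →
    (∀ n → u (suc n) ℚ.≤ u n) → (∀ n → l n ℚ.≤ u n) →
    (∀ ε → 0ℚ ℚ.< ε → ∃[ N ] u N ℚ.- l N ℚ.< ε) →
    ∃[ r ] (∀ n → fromℚ (l n) ≤ℝ r × r ≤ℝ fromℚ (u n))
  nestedℝ l u l-inc u-dec l≤u shrink = mkℝ l l-cauchy , λ n →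
    (λ ε 0<ε → n , λ m n≤m → ℚ.≤-<-trans (l-mono n≤m) (p<p+q 0<ε)) ,
    (λ ε 0<ε → n , λ m n≤m → ℚ.≤-<-trans (below n≤m) (p<p+q 0<ε))
    where
    l-mono : ∀ {m n} → m ℕ.≤ n → l m ℚ.≤ l n
    l-mono {m} {n} m≤n = subst₂ ℚ._≤_ (neg-neg (l m)) (neg-neg (l n))
      (ℚ.neg-antimono-≤ (monotone (λ n → ℚ.- l n) (λ n → ℚ.neg-antimono-≤ (l-inc n)) m≤n))
    below : ∀ {m n} → m ℕ.≤ n → l n ℚ.≤ u m
    below {m} {n} m≤n = ℚ.≤-trans (l≤u n) (monotone u u-dec m≤n)
    l-cauchy : Cauchy l
    l-cauchy ε 0<ε =
      let N , small = shrink ε 0<ε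
          close : ∀ m n → N ℕ.≤ m → N ℕ.≤ n → l m ℚ.- l n ℚ.< ε
          close m n N≤m N≤n = ℚ.≤-<-trans
            (ℚ.+-mono-≤ (below N≤m) (ℚ.neg-antimono-≤ (l-mono N≤n))) small
      in N , λ m n N≤m N≤n → ∣∣<-intro (close m n N≤m N≤n)
           (subst (ℚ._< ε) (sym (neg-sub (l m) (l n))) (close n m N≤n N≤m))

  ℝ-commutativeRing : CommutativeRing _ _
  ℝ-commutativeRing = record
    { Carrier = ℝ ; _≈_ = _≈_ ; _+_ = _+ℝ_ ; _*_ = _*ℝ_ ; -_ = -ℝ_ ; 0# = 0ℝ ; 1# = 1ℝ
    ; isCommutativeRing = record
      { isRing = record
        { +-isAbelianGroup = record
          { isGroup = record
            { isMonoid = record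
              { isSemigroup = record
                { isMagma = record
                  { isEquivalence = record
                    { refl = λ {x} → ptw x x λ _ → refl
                    ; sym = λ {x} {y} → ≈-sym {x} {y}
                    ; trans = λ {x} {y} {z} → ≈-trans {x} {y} {z} }
                  ; ∙-cong = λ {x} {y} {u} {v} → +ℝ-cong {x} {y} {u} {v} }
                ; assoc = λ x y z → ptw ((x +ℝ y) +ℝ z) (x +ℝ (y +ℝ z)) λ n → ℚ.+-assoc (seq x n) (seq y n) (seq z n) }
              ; identity = (λ x → ptw (0ℝ +ℝ x) x λ n → ℚ.+-identityˡ (seq x n))
                         , (λ x → ptw (x +ℝ 0ℝ) x λ n → ℚ.+-identityʳ (seq x n)) }
            ; inverse = (λ x → ptw ((-ℝ x) +ℝ x) 0ℝ λ n → ℚ.+-inverseˡ (seq x n))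
                      , (λ x → ptw (x +ℝ (-ℝ x)) 0ℝ λ n → ℚ.+-inverseʳ (seq x n))
            ; ⁻¹-cong = λ {x} {y} → -ℝ-cong {x} {y} }
          ; comm = λ x y → ptw (x +ℝ y) (y +ℝ x) λ n → ℚ.+-comm (seq x n) (seq y n) }
        ; *-cong = λ {x} {y} {u} {v} → *ℝ-cong {x} {y} {u} {v}
        ; *-assoc = λ x y z → ptw ((x *ℝ y) *ℝ z) (x *ℝ (y *ℝ z)) λ n → ℚ.*-assoc (seq x n) (seq y n) (seq z n)
        ; *-identity = (λ x → ptw (1ℝ *ℝ x) x λ n → ℚ.*-identityˡ (seq x n))
                     , (λ x → ptw (x *ℝ 1ℝ) x λ n → ℚ.*-identityʳ (seq x n))
        ; distrib = (λ x y z → ptw (x *ℝ (y +ℝ z)) ((x *ℝ y) +ℝ (x *ℝ z)) λ n → ℚ.*-distribˡ-+ (seq x n) (seq y n) (seq z n))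
                  , (λ x y z → ptw ((y +ℝ z) *ℝ x) ((y *ℝ x) +ℝ (z *ℝ x)) λ n → ℚ.*-distribʳ-+ (seq x n) (seq y n) (seq z n)) }
      ; *-comm = λ x y → ptw (x *ℝ y) (y *ℝ x) λ n → ℚ.*-comm (seq x n) (seq y n) } }
    where
    ptw : ∀ x y → (∀ n → seq x n ≡ seq y n) → x ≈ y
    ptw x y = pointwise {x} {y}

  realRing : RealRing
  realRing = record
    { commutativeRing = ℝ-commutativeRing
    ; _≤_ = _≤ℝ_
    ; ≤-reflexive = λ {x} {y} → ≈⇒≤ {x} {y}
    ; ≤-trans = λ {x} {y} {z} → ≤ℝ-trans {x} {y} {z}
    ; ≤-antisym = λ {x} {y} → ≤ℝ-antisym {x} {y}
    ; ≤-stable = λ {x} {y} → ≤ℝ-stable {x} {y}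
    ; ≤-total = ≤ℝ-total
    ; +-mono-≤ = λ {x} {y} {u} {v} → +ℝ-mono-≤ {x} {y} {u} {v}
    ; *-nonNeg = λ {x} {y} → *ℝ-nonNeg {x} {y}
    ; square-nonNeg = square-nonNegℝ
    ; square≤0⇒≈0 = λ {x} → squareℝ≤0⇒≈0 {x}
    ; ι = fromℚ
    ; ι-+ = λ p q → pointwise {fromℚ (p ℚ.+ q)} {fromℚ p +ℝ fromℚ q} λ _ → refl
    ; ι-* = λ p q → pointwise {fromℚ (p ℚ.* q)} {fromℚ p *ℝ fromℚ q} λ _ → refl
    ; ι-neg = λ p → pointwise {fromℚ (ℚ.- p)} { -ℝ fromℚ p} λ _ → refl
    ; ι-0 = pointwise {0ℝ} {0ℝ} λ _ → refl
    ; ι-1 = pointwise {1ℝ} {1ℝ} λ _ → refl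
    ; ι-mono = fromℚ-mono
    ; separated = λ {x} {y} → separatedℝ {x} {y}
    ; archimedean = λ {x} → archimedeanℝ {x}
    ; bounded = boundedℝ
    ; nested = nestedℝ
    }

-- Transfer to the matrices of the statement, and the theorem.

open import Defs
open import Data.Nat.Base using (ℕ; _≤_)
open RationalLemmas using (0<⇒<; <⇒0<; 0<+)
open RealInstance
open Extremal realRing using (matrix; product; adjacency; Eigenvector)
open Bound realRing using (dominating-eigenvalue)
open Cactus using (BreadthFirstTree; breadthFirst; module Matching)
open ≡ using (refl; subst)

private
  module O = Ordered realRing

<1⇒gap : ∀ {α} → α <ℝ 1ℝ → ∃[ c ] (0ℚ ℚ.< c × fromℚ c ≤ℝ 1ℝ -ℝ α)
<1⇒gap {α} (c , 0<c , h) = c , 0<c , λ ε 0<ε → eventually-map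
  (λ n a → 0<⇒< (subst (0ℚ ℚ.<_) (rearrange (seq α n) c ε) (0<+ (<⇒0< a) 0<ε))) h
  where
  rearrange : ∀ a c ε → (1ℚ ℚ.- (a ℚ.+ c)) ℚ.+ ε ≡ ((1ℚ ℚ.- a) ℚ.+ ε) ℚ.- c
  rearrange = solve 3 (λ a c ε → (con 1ℚ :- (a :+ c)) :+ ε := ((con 1ℚ :- a) :+ ε) :- c) refl
    where open ℚ-Solver.+-*-Solver

-- realRing and Defs spell the same sums and matrices differently; matching
-- them definitionally would unfold Cauchy proofs, so they are compared by _≈_.
sum-≈ : ∀ {n} (f g : Fin n → ℝ) → (∀ i → f i ≈ g i) → O.sum f ≈ sum g
sum-≈ {zero}  f g h = pointwise {0ℝ} {0ℝ} λ _ → refl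
sum-≈ {suc n} f g h = +ℝ-cong {f zero} {g zero} {O.sum (λ i → f (suc i))} {sum (λ i → g (suc i))}
  (h zero) (sum-≈ (λ i → f (suc i)) (λ i → g (suc i)) λ i → h (suc i))

if-≈ : ∀ b (x y x′ y′ : ℝ) → x ≈ x′ → y ≈ y′ → (if b then x else y) ≈ (if b then x′ else y′)
if-≈ true  x y x′ y′ p q = p
if-≈ false x y x′ y′ p q = q

≈-refl : ∀ x → x ≈ x
≈-refl x = pointwise {x} {x} λ _ → refl

degree-≈ : ∀ {n} (G : Graph n) i j →
  (if does (i Fin.≟ j) then O.fromℕ (degree G i) else O.0#) ≈ degreeMatrix G i j
degree-≈ G i j = if-≈ (does (i Fin.≟ j)) (O.fromℕ (degree G i)) O.0# (fromℕ (degree G i)) 0ℝ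
  (≈-refl (fromℕ (degree G i))) (≈-refl 0ℝ)

adjacency-≈ : ∀ {n} (G : Graph n) i j → adjacency G i j ≈ adjacencyMatrix G i j
adjacency-≈ G i j = if-≈ (does (Graph.adj? G i j)) O.1# O.0# 1ℝ 0ℝ (≈-refl 1ℝ) (≈-refl 0ℝ)

entry-≈ : ∀ α d d′ a a′ → d ≈ d′ → a ≈ a′ →
  (α O.* d) O.+ ((O.1# O.- α) O.* a) ≈ α *ℝ d′ +ℝ (1ℝ -ℝ α) *ℝ a′
entry-≈ α d d′ a a′ p q = +ℝ-cong {α *ℝ d} {α *ℝ d′} {(1ℝ -ℝ α) *ℝ a} {(1ℝ -ℝ α) *ℝ a′}
  (*ℝ-cong {α} {α} {d} {d′} (≈-refl α) p)
  (*ℝ-cong {1ℝ -ℝ α} {1ℝ -ℝ α} {a} {a′} (≈-refl (1ℝ -ℝ α)) q)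

matrix-≈ : ∀ {n} (G : Graph n) α i j → matrix G α i j ≈ A[_] G α i j
matrix-≈ G α i j = entry-≈ α (if does (i Fin.≟ j) then O.fromℕ (degree G i) else O.0#) (degreeMatrix G i j)
  (adjacency G i j) (adjacencyMatrix G i j) (degree-≈ G i j) (adjacency-≈ G i j)

product-≈ : ∀ {n} (G : Graph n) α (x : Fin n → ℝ) i j →
  product G α x i j ≈ A[_] G α i j *ℝ x j
product-≈ G α x i j = *ℝ-cong {matrix G α i j} {A[_] G α i j} {x j} {x j} (matrix-≈ G α i j) (≈-refl (x j))

*ᵥ-≈ : ∀ {n} (G : Graph n) α (x : Fin n → ℝ) i → O.sum (product G α x i) ≈ (A[_] G α *ᵥ x) i
*ᵥ-≈ G α x i = sum-≈ (product G α x i) (λ j → A[_] G α i j *ℝ x j) (product-≈ G α x i)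

eigenvector⁺ : ∀ {n} (G : Graph n) α μ x → ¬ (∀ i → x i ≈ 0ℝ) →
  (∀ i → (A[_] G α *ᵥ x) i ≈ μ *ℝ x i) → Eigenvector G α μ x
eigenvector⁺ G α μ x x≉0 eigen = x≉0 , λ i →
  ≈-trans {O.sum (product G α x i)} {(A[_] G α *ᵥ x) i} {μ *ℝ x i} (*ᵥ-≈ G α x i) (eigen i)

eigenvector⁻ : ∀ {n} (G : Graph n) α μ x → Eigenvector G α μ x → IsEigenvalue (A[_] G α) μ
eigenvector⁻ G α μ x (x≉0 , eigen) = x , x≉0 , λ i →
  ≈-trans {(A[_] G α *ᵥ x) i} {O.sum (product G α x i)} {μ *ℝ x i}
    (≈-sym {O.sum (product G α x i)} {(A[_] G α *ᵥ x) i} (*ᵥ-≈ G α x i)) (eigen i)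

theorem6 : (n k : ℕ) → 1 ≤ n →
    (α : ℝ) → 0ℝ ≤ℝ α → α <ℝ 1ℝ →
    (G : Graph n) → G ∈𝒞 k →
    (ρG ρC : ℝ) →
    IsSpectralRadius G α ρG →
    IsSpectralRadius (Cᶜ n k) α ρC →
    ρG ≤ℝ ρC
theorem6 (suc n) k _ α 0≤α α<1 G G∈ ρG ρC ((x , x≉0 , eigen) , _) (_ , largest) =
  ≤ℝ-stable {ρG} {ρC} λ ρG≰ρC → O.¬¬-argmax (λ i → x i *ℝ x i) λ (v , x-max) →
    ρG≰ρC (bound v x-max (ℕ.m≤n⇒∃[o]m+o≡n (Matching.1+2k≤n (tree v) isCactus cycleCount)))
  where
  open _∈𝒞_ G∈
  tree : ∀ v → BreadthFirstTree G v
  tree = breadthFirst G (proj₁ isCactus)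
  -- `p = n - 1 - 2k` is the number of pendant edges of `Cᶜ`; writing the order as `1 + 2k + p`
  -- gives it the form in which the eigenvector of `Cᶜ` was found.
  bound : ∀ v → (∀ i → x i *ℝ x i ≤ℝ x v *ℝ x v) →
    ∃[ p ] suc (k ℕ.+ k) ℕ.+ p ≡ suc n → ρG ≤ℝ ρC
  bound v x-max (p , refl) =
    let c , 0<c , c≤β = <1⇒gap {α} α<1
        r , ρG≤r , y , eigen-y = dominating-eigenvalue k p (tree v) isCactus cycleCount
          α c 0≤α 0<c c≤β ρG x x-max (eigenvector⁺ G α ρG x x≉0 eigen)
    in ≤ℝ-trans {ρG} {r} {ρC} ρG≤r (largest r (eigenvector⁻ (Cᶜ (suc n) k) α r y eigen-y))
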